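{- For the bilinear form on $\Pi(\mathbf x)$ defined by $\langle m_\pi,h_\sigma\rangle=n!\delta_{\pi,\sigma}$, the following hold for all set partitions $\pi,\sigma$ of $[n]$: $\langle e_\pi,e_\sigma\rangle=n!(\pi\wedge\sigma)!$; $\langle e_\pi,h_\sigma\rangle=n!\delta_{\pi\wedge\sigma,\hat0}$; $\langle e_\pi,p_\sigma\rangle=(-1)^\sigma n!\zeta(\sigma,\pi)$; $\langle e_\pi,m_\sigma\rangle=(-1)^\sigma n!\lambda(\sigma,\pi)!\zeta(\sigma,\pi)$; $\langle h_\pi,h_\sigma\rangle=n!(\pi\wedge\sigma)!$; $\langle h_\pi,p_\sigma\rangle=n!\zeta(\sigma,\pi)$; $\langle h_\pi,m_\sigma\rangle=n!\delta_{\pi,\sigma}$; $\langle p_\pi,p_\sigma\rangle=n!\frac{\delta_{\pi,\sigma}}{|\mu(\hat0,\pi)|}$; $\langle p_\pi,m_\sigma\rangle=n!\frac{\mu(\sigma,\pi)\zeta(\sigma,\pi)}{|\mu(\hat0,\pi)|}$; $\langle m_\pi,m_\sigma\rangle=n!\sum_{\tau\ge\pi\vee\sigma}\frac{\mu(\pi,\tau)\mu(\sigma,\tau)}{|\mu(\hat0,\tau)|}$. In particular each of these formulas defines the same bilinear form.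
   Context: $\Pi(\mathbf{x})$ is the algebra of bounded-degree elements of $\mathbb{Q}\langle\langle x_1,x_2,\ldots\rangle\rangle$ (noncommuting variables) invariant under all permutations of the variables; the form is extended bilinearly and is $0$ between partitions of different sets. Set partitions of $[n]$ form the refinement lattice $\Pi_n$ with meet $\wedge$, join $\vee$, minimum $\hat0$, Möbius function $\mu$, and zeta function $\zeta(\sigma,\pi)=1$ if $\sigma\le\pi$, $0$ otherwise. For a set partition $\tau$ with block sizes $b_i$, $\tau!=\prod b_i!$; $(-1)^\sigma$ is the sign of a permutation whose cycles are the blocks of $\sigma$; for $\sigma\le\pi$, $\lambda(\sigma,\pi)$ is the integer partition whose parts are the numbers of blocks of $\sigma$ contained in each block of $\pi$, and $\lambda(\sigma,\pi)!$ is the product of factorials of its parts. With sums over $n$-tuples $(i_1,\dots,i_n)$ of positive integers: $m_\pi=\sum x_{i_1}\cdots x_{i_n}$ with $i_j=i_k$ iff $j,k$ in the same block of $\pi$; $p_\pi=\sum x_{i_1}\cdots x_{i_n}$ with $i_j=i_k$ whenever $j,k$ in the same block; $e_\pi=\sum x_{i_1}\cdots x_{i_n}$ with $i_j\neq i_k$ whenever $j\ne k$ in the same block. For $f:[n]\to\{x_1,x_2,\ldots\}$ let $\ker f$ be the set partition of nonempty fibers, $M_f=f(1)\cdots f(n)$; then $h_\pi=\sum_{(f,L)}M_f$ over pairs with $L$ a linear ordering of each block of $(\ker f)\wedge\pi$. -}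

module Defs where

open import Data.Bool.Base using (Bool; true; false; if_then_else_; _∧_; _∨_; not)
open import Data.Nat.Base as ℕ using (ℕ; zero; suc; _≡ᵇ_; _!)
open import Data.Fin.Base using (Fin; toℕ)
open import Data.Fin.Properties using (_≟_)
open import Data.Vec.Base using (Vec; []; _∷_; lookup)
open import Data.List.Base using (List; []; _∷_; map; concatMap; allFin; foldr; upTo)
open import Data.Bool.ListAction using (all; any)
open import Data.Integer.Base as ℤ using (ℤ; +_; -_)
open import Data.Rational.Base as ℚ using (ℚ; 0ℚ; 1ℚ)
open import Relation.Nullary.Decidable using (⌊_⌋)
open import Relation.Binary.PropositionalEquality using (_≡_)
open import Function.Bundles using (_↔_; Inverse)

-- Set partitions of [n] = Fin n.
-- A set partition is represented by a block labelling  π : Fin n → ℕ ;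
-- the partition it denotes is the kernel of π (i, j in the same block
-- iff π i ≡ π j).  All notions below depend only on that kernel.

SetPartition : ℕ → Set
SetPartition n = Fin n → ℕ

BRel : ℕ → Set
BRel n = Fin n → Fin n → Bool

infixr 7 _⋀_ _⋁_
infix 4 _≤ᵇ_ _≐ᵇ_
infixl 6 _÷ℕ_

⟦_⟧ : ∀ {n} → SetPartition n → BRel n
⟦ π ⟧ i j = π i ≡ᵇ π j

_⋀_ : ∀ {n} → BRel n → BRel n → BRel n
(R ⋀ S) i j = R i j ∧ S i j

-- join: transitive closure of the union (n squaring steps suffice)
private
  step : ∀ {n} → BRel n → BRel n
  step {n} T i j = T i j ∨ any (λ l → T i l ∧ T l j) (allFin n)

  iter : ∀ {n} → ℕ → BRel n → BRel n
  iter zero T = T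
  iter (suc k) T = iter k (step T)

_⋁_ : ∀ {n} → BRel n → BRel n → BRel n
_⋁_ {n} R S = iter n (λ i j → R i j ∨ S i j)

_≤ᵇ_ : ∀ {n} → BRel n → BRel n → Bool
_≤ᵇ_ {n} R S = all (λ i → all (λ j → not (R i j) ∨ S i j) (allFin n)) (allFin n)

_≐ᵇ_ : ∀ {n} → BRel n → BRel n → Bool
R ≐ᵇ S = (R ≤ᵇ S) ∧ (S ≤ᵇ R)

𝟘̂ : ∀ {n} → SetPartition n
𝟘̂ i = toℕ i

isBottom : ∀ {n} → BRel n → Bool
isBottom R = R ≤ᵇ ⟦ 𝟘̂ ⟧

ζ : ∀ {n} → SetPartition n → SetPartition n → ℚ
ζ σ π = if ⟦ σ ⟧ ≤ᵇ ⟦ π ⟧ then 1ℚ else 0ℚ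

δ : Bool → ℚ
δ b = if b then 1ℚ else 0ℚ

-- Blocks.  A block is indexed by its least element i.

isBlockMin : ∀ {n} → BRel n → Fin n → Bool
isBlockMin {n} R i = not (any (λ j → R i j ∧ (toℕ j ℕ.<ᵇ toℕ i)) (allFin n))

count : ∀ {n} → (Fin n → Bool) → ℕ
count {n} P = foldr (λ j acc → (if P j then 1 else 0) ℕ.+ acc) 0 (allFin n)

prodBlocksℕ : ∀ {n} → BRel n → (Fin n → ℕ) → ℕ
prodBlocksℕ {n} R g = foldr (λ i acc → (if isBlockMin R i then g i else 1) ℕ.* acc) 1 (allFin n)

prodBlocksℤ : ∀ {n} → BRel n → (Fin n → ℤ) → ℤ
prodBlocksℤ {n} R g = foldr (λ i acc → (if isBlockMin R i then g i else ℤ.1ℤ) ℤ.* acc) ℤ.1ℤ (allFin n)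

blockSize : ∀ {n} → BRel n → Fin n → ℕ
blockSize R i = count (R i)

fact : ∀ {n} → BRel n → ℕ
fact R = prodBlocksℕ R (λ i → blockSize R i !)

negOnePow : ℕ → ℤ
negOnePow zero = ℤ.1ℤ
negOnePow (suc k) = - negOnePow k

-- (-1)^σ : sign of a permutation whose cycles are the blocks of σ
sgn : ∀ {n} → SetPartition n → ℤ
sgn σ = prodBlocksℤ ⟦ σ ⟧ (λ i → negOnePow (blockSize ⟦ σ ⟧ i ℕ.∸ 1))

-- λ(σ,π)! for σ ≤ π : product over blocks B of π of
-- (number of blocks of σ contained in B)!
lamFact : ∀ {n} → SetPartition n → SetPartition n → ℕ
lamFact σ π = prodBlocksℕ ⟦ π ⟧
  (λ i → count (λ j → isBlockMin ⟦ σ ⟧ j ∧ ⟦ π ⟧ i j) !)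

-- Enumeration of all set partitions of [n] (each exactly once), via
-- restricted growth functions.

private
  rgf : (k m : ℕ) → List (Vec ℕ k)
  rgf zero m = [] ∷ []
  rgf (suc k) m =
    concatMap (λ l → map (l ∷_) (rgf k (if l ≡ᵇ m then suc m else m))) (upTo (suc m))

allPartitions : (n : ℕ) → List (SetPartition n)
allPartitions n = map (λ v → lookup v) (rgf n 0)

sumℚ : ∀ {A : Set} → (A → ℚ) → List A → ℚ
sumℚ f = foldr (λ a acc → f a ℚ.+ acc) 0ℚ

sumℤ : ∀ {A : Set} → (A → ℤ) → List A → ℤ
sumℤ f = foldr (λ a acc → f a ℤ.+ acc) ℤ.0ℤ

-- Möbius function of Π_n, by the recursion
--   μ(σ,σ) = 1,  μ(σ,π) = - Σ_{σ ≤ τ < π} μ(σ,τ),  μ(σ,π) = 0 if σ ≰ π.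
-- The fuel argument bounds the recursion depth; chains in Π_n have length
-- < n, so fuel n is always enough.

private
  mobiusF : ∀ {n} → ℕ → SetPartition n → SetPartition n → ℤ
  mobiusF {n} fuel σ π with ⟦ σ ⟧ ≐ᵇ ⟦ π ⟧ | ⟦ σ ⟧ ≤ᵇ ⟦ π ⟧ | fuel
  ... | true  | _     | _ = ℤ.1ℤ
  ... | false | false | _ = ℤ.0ℤ
  ... | false | true  | zero = ℤ.0ℤ
  ... | false | true  | suc k =
    - sumℤ (λ τ → if (⟦ σ ⟧ ≤ᵇ ⟦ τ ⟧) ∧ (⟦ τ ⟧ ≤ᵇ ⟦ π ⟧) ∧ not (⟦ τ ⟧ ≐ᵇ ⟦ π ⟧)
                   then mobiusF k σ τ else ℤ.0ℤ)
           (allPartitions n)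

μ : ∀ {n} → SetPartition n → SetPartition n → ℤ
μ {n} = mobiusF n

ℕ→ℚ : ℕ → ℚ
ℕ→ℚ k = (+ k) ℚ./ 1

ℤ→ℚ : ℤ → ℚ
ℤ→ℚ z = z ℚ./ 1

-- q / d  for a natural d; only ever used with d ≠ 0 (d = |μ(0̂,π)|),
-- the value at d = 0 is an irrelevant convention.
_÷ℕ_ : ℚ → ℕ → ℚ
q ÷ℕ zero = 0ℚ
q ÷ℕ suc d = q ℚ.* ((+ 1) ℚ./ suc d)

absMu0 : ∀ {n} → SetPartition n → ℕ
absMu0 π = ℤ.∣ μ 𝟘̂ π ∣

-- The homogeneous degree-n part of Q⟨⟨x_1,x_2,...⟩⟩.
-- A word x_{i_1}⋯x_{i_n} is a map Fin n → ℕ (variable x_{k+1} ↦ k);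
-- a homogeneous degree-n series is its coefficient function.

Word : ℕ → Set
Word n = Fin n → ℕ

Series : ℕ → Set
Series n = Word n → ℚ

_+ˢ_ : ∀ {n} → Series n → Series n → Series n
(f +ˢ g) w = f w ℚ.+ g w

_·ˢ_ : ∀ {n} → ℚ → Series n → Series n
(c ·ˢ f) w = c ℚ.* f w

Invariant : ∀ {n} → Series n → Set
Invariant {n} f = (ρ : ℕ ↔ ℕ) (w : Word n) → f (λ i → Inverse.to ρ (w i)) ≡ f w

-- The four families.  The kernel of a word w is ⟦ w ⟧.
-- m_π : coefficient 1 on words with ker w = π
m : ∀ {n} → SetPartition n → Series n
m π w = δ (⟦ w ⟧ ≐ᵇ ⟦ π ⟧)

p : ∀ {n} → SetPartition n → Series n
p π w = δ (⟦ π ⟧ ≤ᵇ ⟦ w ⟧)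

e : ∀ {n} → SetPartition n → Series n
e π w = δ (isBottom (⟦ π ⟧ ⋀ ⟦ w ⟧))

-- h_π : coefficient of w = number of pairs (f, L) with M_f = w, i.e.
-- (f = w and) the number of ways L of linearly ordering each block of
-- (ker w) ∧ π, which is ((ker w) ∧ π)!
h : ∀ {n} → SetPartition n → Series n
h π w = ℕ→ℚ (fact (⟦ w ⟧ ⋀ ⟦ π ⟧))

-- A bilinear form on the degree-n part of Π(x) normalised by
-- ⟨m_π, h_σ⟩ = n! δ_{π,σ}.  The form is given on all series but only
-- required to be bilinear on invariant ones (i.e. on Π(x)_n); it must
-- respect (pointwise) equality of series.

record IsMHForm (n : ℕ) (B : Series n → Series n → ℚ) : Set where
  field
    ext    : ∀ f f' g g' → (∀ w → f w ≡ f' w) → (∀ w → g w ≡ g' w) → B f g ≡ B f' g'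
    addˡ   : ∀ f f' g → Invariant f → Invariant f' → Invariant g →
             B (f +ˢ f') g ≡ B f g ℚ.+ B f' g
    scaleˡ : ∀ c f g → Invariant f → Invariant g → B (c ·ˢ f) g ≡ c ℚ.* B f g
    addʳ   : ∀ f g g' → Invariant f → Invariant g → Invariant g' →
             B f (g +ˢ g') ≡ B f g ℚ.+ B f g'
    scaleʳ : ∀ c f g → Invariant f → Invariant g → B f (c ·ˢ g) ≡ c ℚ.* B f g
    mh     : ∀ π σ → B (m π) (h σ) ≡ ℕ→ℚ (n !) ℚ.* δ (⟦ π ⟧ ≐ᵇ ⟦ σ ⟧)

module Submission where

-- Write |μ| for |μ(0̂,·)|.  A series whose coefficient at a word depends only
-- on the kernel of the word is Σ f(τ) m_τ, so ⟨f, h_σ⟩ = n! f(σ) for every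
-- such f.  Both h_τ = Σ_{ρ≤τ} |μ|(ρ) p_ρ and m_σ = Σ_τ μ(σ,τ) p_τ hold, the
-- first being a triangular system with invertible diagonal; hence ⟨f, p_ρ⟩ is
-- found by checking a candidate against the values ⟨f, h_τ⟩, and ⟨f, m_σ⟩ is
-- Σ_τ μ(σ,τ) ⟨f, p_τ⟩.
--
-- The facts needed about μ are Σ_{τ≤π} μ(ρ,τ) = δ, Σ_{τ≤π} sgn τ μ(ρ,τ) =
-- sgn ρ λ(ρ,π)! and their special cases for ρ = 0̂.  They all come from one
-- weighted sum over the ways to build the partitions above ρ by merging its
-- blocks one at a time, evaluated at the weights t = 1 and t = -1.

-- The induction on n removes the element zero, but `allPartitions` does not recurse that way: it
-- labels zero first and carries a running bound. The merging sum `∑≥` places zero last and meets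
-- the enumeration only through the fact that every partition is listed exactly once. If the result
-- must stay below R, a new block of ρ with c earlier blocks of ρ in its block of R contributes the
-- factor 1 + tc. At t = -1 the first block of ρ that R merges with an earlier one gives 1 - 1 = 0,
-- so the product is a delta, which is the defining property of μ. At t = 1 the factors belonging to
-- one block of R run through 1, 2, 3, ... and multiply to a factorial. Every merge also reverses
-- the sign of a partition, so the two weights of σ differ by sgn ρ sgn σ; this is the origin of the
-- signs in the formulas with e. A partition is a labelling, with no canonical representative and no
-- extensionality, so every function that is summed over partitions must be shown to depend on the
-- kernel only.

open import Defs
open import Algebra.Bundles using (CommutativeMonoid; CommutativeRing)
import Algebra.Properties.CommutativeMonoid.Sum as FinSum
import Algebra.Properties.Semiring.Sum as SemiringSum
open import Data.Bool.Base using (Bool; true; false; if_then_else_; _∧_; _∨_; not)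
open import Data.Bool.ListAction using (all; any)
open import Data.Bool.Properties using (T-≡; ∧-identityʳ; ∧-comm; ∧-assoc; ∧-zeroʳ)
open import Data.Empty using (⊥-elim)
open import Data.Fin.Base using (Fin; zero; suc; toℕ)
open import Data.Fin.Properties using (toℕ-injective)
open import Data.Integer.Base as ℤ using (ℤ; +_; -_; 0ℤ; 1ℤ)
import Data.Integer.Properties as ℤ
open import Data.Integer.Tactic.RingSolver using (solve-∀)
open import Data.List.Base using (List; []; _∷_; _++_; map; concatMap; allFin; tabulate; upTo; foldr; applyUpTo)
open import Data.List.Membership.Propositional using (_∈_; lose; find)
open import Data.List.Relation.Unary.All as All using (All; []; _∷_)
import Data.List.Relation.Unary.All.Properties as All
open import Data.List.Relation.Unary.Any using (here; there; any?)
open import Data.Nat.Base as ℕ using (ℕ; zero; suc; _!; _≡ᵇ_)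
import Data.Nat.Properties as ℕ
open import Data.Product.Base using (_×_; _,_; proj₁; proj₂; ∃-syntax)
open import Data.Sum.Base using (inj₁; inj₂)
open import Data.Vec.Base using (Vec; []; _∷_; lookup)
import Data.Vec.Functional
open import Function.Base using (_∘_; id; case_of_)
open import Function.Bundles using (Equivalence; Inverse)
open import Level using (0ℓ)
import Relation.Binary.Reasoning.Setoid as SetoidReasoning
open import Relation.Binary.PropositionalEquality using (_≡_; refl; sym; trans; cong; cong₂; subst; module ≡-Reasoning)
open import Relation.Nullary using (¬_; yes; no; contradiction)

-- The private functions behind allPartitions, μ and _⋁_ cannot be named here.
-- Each is recovered as the solution of a metavariable: a with-abstraction
-- generalises an argument that is fixed in the public definition to a
-- variable, and the resulting unification problem is a pattern.

data Is {A : Set} : A → Set where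
  is : ∀ a → Is a

mutual
  rgf : (k m : ℕ) → List (Vec ℕ k)
  rgf k m = _

  rgf-link : ∀ k → Is (allPartitions k)
  rgf-link k with 0
  ... | w = is (map lookup (rgf k w))

mutual
  iterTrue : ∀ n → ℕ → BRel n
  iterTrue n k = _

  iterTrue-link : ∀ k → Is ((λ _ _ → true) ⋁ (λ (i j : Fin (suc k)) → true))
  iterTrue-link k with suc k
  ... | n = is (iterTrue n k)

mutual
  iter : ∀ {n} → ℕ → BRel n → BRel n
  iter k T = _

  iter-link : ∀ n k → Is (iterTrue n k)
  iter-link n k with (λ (i j : Fin n) → true)
  ... | T = is (iter k T)

mutual
  -- The recursive call inside `μ` appears only once both tests are decided, hence the `rewrite` in
  -- the link. The recursion lowers the fuel and keeps n fixed, so the blocks that follow turn the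
  -- two test results, and then the ambient `suc k`, into parameters independent of the fuel.
  möbius₁ : ∀ k → SetPartition (suc k) → SetPartition (suc k) → ℤ
  möbius₁ k σ τ = _

  möbius₁-link : ∀ k (σ π : SetPartition (suc k)) →
    (⟦ σ ⟧ ≐ᵇ ⟦ π ⟧) ≡ false → (⟦ σ ⟧ ≤ᵇ ⟦ π ⟧) ≡ true →
    μ σ π ≡ - sumℤ (λ τ → if (⟦ σ ⟧ ≤ᵇ ⟦ τ ⟧) ∧ (⟦ τ ⟧ ≤ᵇ ⟦ π ⟧) ∧ not (⟦ τ ⟧ ≐ᵇ ⟦ π ⟧)
                          then möbius₁ k σ τ else 0ℤ)
                   (allPartitions (suc k))
  möbius₁-link k σ π p q rewrite p | q = refl

mutual
  möbius₂ : ∀ k → SetPartition (suc k) → SetPartition (suc k) → Bool → ℤ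
  möbius₂ k σ τ b = _

  möbius₂-link : ∀ k (σ π : SetPartition (suc k)) → Is (möbius₁ k σ π)
  möbius₂-link k σ π with ⟦ σ ⟧ ≐ᵇ ⟦ π ⟧
  ... | b = is (möbius₂ k σ π b)

mutual
  möbius₃ : ∀ k → SetPartition (suc k) → SetPartition (suc k) → Bool → Bool → ℤ
  möbius₃ k σ τ b c = _

  möbius₃-link : ∀ k (σ π : SetPartition (suc k)) b → Is (möbius₂ k σ π b)
  möbius₃-link k σ π b with ⟦ σ ⟧ ≤ᵇ ⟦ π ⟧
  ... | c = is (möbius₃ k σ π b c)

mutual
  möbiusWith : ∀ n → ℕ → SetPartition n → SetPartition n → Bool → Bool → ℤ
  möbiusWith n k σ τ b c = _

  möbiusWith-link : ∀ k (σ π : SetPartition (suc k)) b c → Is (möbius₃ k σ π b c)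
  möbiusWith-link k σ π b c with suc k
  ... | n = is (möbiusWith n k σ π b c)

möbius : ∀ {n} → ℕ → SetPartition n → SetPartition n → ℤ
möbius k σ π = möbiusWith _ k σ π (⟦ σ ⟧ ≐ᵇ ⟦ π ⟧) (⟦ σ ⟧ ≤ᵇ ⟦ π ⟧)

-- Booleans

bool-ext : ∀ {a b} → (a ≡ true → b ≡ true) → (b ≡ true → a ≡ true) → a ≡ b
bool-ext {false} {false} f g = refl
bool-ext {false} {true}  f g = g refl
bool-ext {true}  {false} f g = sym (f refl)
bool-ext {true}  {true}  f g = refl

true≢false : ∀ {b} {A : Set} → b ≡ true → b ≡ false → A
true≢false refl ()

¬true : ∀ {b} → ¬ b ≡ true → b ≡ false
¬true {false} f = refl
¬true {true}  f = ⊥-elim (f refl)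

∧-intro : ∀ {a b} → a ≡ true → b ≡ true → a ∧ b ≡ true
∧-intro refl refl = refl

∧-elimˡ : ∀ {a b} → a ∧ b ≡ true → a ≡ true
∧-elimˡ {true} _ = refl

∧-elimʳ : ∀ {a b} → a ∧ b ≡ true → b ≡ true
∧-elimʳ {true} p = p

≡ᵇ-intro : ∀ {a b} → a ≡ b → (a ≡ᵇ b) ≡ true
≡ᵇ-intro {a} {b} p = Equivalence.to T-≡ (ℕ.≡⇒≡ᵇ a b p)

≡ᵇ-elim : ∀ {a b} → (a ≡ᵇ b) ≡ true → a ≡ b
≡ᵇ-elim {a} {b} p = ℕ.≡ᵇ⇒≡ a b (Equivalence.from T-≡ p)

anyF : ∀ {n} → (Fin n → Bool) → Bool
anyF {zero}  f = false
anyF {suc n} f = f zero ∨ anyF (f ∘ suc)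

any-tabulate : ∀ {A : Set} {n} (f : A → Bool) (g : Fin n → A) → any f (tabulate g) ≡ anyF (f ∘ g)
any-tabulate {n = zero}  f g = refl
any-tabulate {n = suc n} f g = cong (f (g zero) ∨_) (any-tabulate f (g ∘ suc))

anyF-intro : ∀ {n} {f : Fin n → Bool} i → f i ≡ true → anyF f ≡ true
anyF-intro {f = f} zero p rewrite p = refl
anyF-intro {f = f} (suc i) p with f zero
... | true  = refl
... | false = anyF-intro i p

anyF-elim : ∀ {n} {f : Fin n → Bool} → anyF f ≡ true → ∃[ i ] f i ≡ true
anyF-elim {suc n} {f} p with f zero in eq
... | true  = zero , eq
... | false = let i , q = anyF-elim p in suc i , q

anyF-none : ∀ {n} {f : Fin n → Bool} → anyF f ≡ false → ∀ i → f i ≡ false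
anyF-none p i = ¬true λ q → true≢false (anyF-intro i q) p

all-intro : ∀ {A : Set} {n} (f : A → Bool) (g : Fin n → A) → (∀ i → f (g i) ≡ true) → all f (tabulate g) ≡ true
all-intro {n = zero}  f g p = refl
all-intro {n = suc n} f g p = ∧-intro (p zero) (all-intro f (g ∘ suc) (p ∘ suc))

all-elim : ∀ {A : Set} {n} (f : A → Bool) (g : Fin n → A) → all f (tabulate g) ≡ true → ∀ i → f (g i) ≡ true
all-elim f g p zero    = ∧-elimˡ p
all-elim f g p (suc i) = all-elim f (g ∘ suc) (∧-elimʳ {f (g zero)} p) i

-- Relations

infix 4 _⊑_ _≗₂_

_⊑_ : ∀ {n} → BRel n → BRel n → Set
R ⊑ S = ∀ i j → R i j ≡ true → S i j ≡ true

_≗₂_ : ∀ {n} → BRel n → BRel n → Set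
R ≗₂ S = ∀ i j → R i j ≡ S i j

⊑-trans : ∀ {n} {R S T : BRel n} → R ⊑ S → S ⊑ T → R ⊑ T
⊑-trans p q i j = q i j ∘ p i j

≗₂⇒⊑ : ∀ {n} {R S : BRel n} → R ≗₂ S → R ⊑ S
≗₂⇒⊑ p i j = trans (sym (p i j))

≗₂⇒⊒ : ∀ {n} {R S : BRel n} → R ≗₂ S → S ⊑ R
≗₂⇒⊒ p i j = trans (p i j)

⊑-antisym : ∀ {n} {R S : BRel n} → R ⊑ S → S ⊑ R → R ≗₂ S
⊑-antisym p q i j = bool-ext (p i j) (q i j)

≗₂-sym : ∀ {n} {R S : BRel n} → R ≗₂ S → S ≗₂ R
≗₂-sym p i j = sym (p i j)

private
  implies-intro : ∀ {a b} → (a ≡ true → b ≡ true) → not a ∨ b ≡ true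
  implies-intro {false} f = refl
  implies-intro {true}  f = f refl

  implies-elim : ∀ {a b} → not a ∨ b ≡ true → a ≡ true → b ≡ true
  implies-elim p refl = p

≤ᵇ-intro : ∀ {n} {R S : BRel n} → R ⊑ S → (R ≤ᵇ S) ≡ true
≤ᵇ-intro {R = R} {S} p =
  all-intro (λ i → all (λ j → not (R i j) ∨ S i j) (allFin _)) id λ i →
    all-intro (λ j → not (R i j) ∨ S i j) id λ j → implies-intro (p i j)

≤ᵇ-elim : ∀ {n} (R S : BRel n) → (R ≤ᵇ S) ≡ true → R ⊑ S
≤ᵇ-elim R S p i j =
  implies-elim (all-elim (λ j → not (R i j) ∨ S i j) id
    (all-elim (λ i → all (λ j → not (R i j) ∨ S i j) (allFin _)) id p i) j)

≤ᵇ-ext : ∀ {n n'} {R S : BRel n} {R' S' : BRel n'} →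
         (R ⊑ S → R' ⊑ S') → (R' ⊑ S' → R ⊑ S) → (R ≤ᵇ S) ≡ (R' ≤ᵇ S')
≤ᵇ-ext f g = bool-ext (≤ᵇ-intro ∘ f ∘ ≤ᵇ-elim _ _) (≤ᵇ-intro ∘ g ∘ ≤ᵇ-elim _ _)

≤ᵇ-cong : ∀ {n} {R R' S S' : BRel n} → R ≗₂ R' → S ≗₂ S' → (R ≤ᵇ S) ≡ (R' ≤ᵇ S')
≤ᵇ-cong p q = ≤ᵇ-ext (λ r → ⊑-trans (≗₂⇒⊒ p) (⊑-trans r (≗₂⇒⊑ q)))
                     (λ r → ⊑-trans (≗₂⇒⊑ p) (⊑-trans r (≗₂⇒⊒ q)))

≐ᵇ-intro : ∀ {n} {R S : BRel n} → R ≗₂ S → (R ≐ᵇ S) ≡ true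
≐ᵇ-intro p = ∧-intro (≤ᵇ-intro (≗₂⇒⊑ p)) (≤ᵇ-intro (≗₂⇒⊒ p))

≐ᵇ-elim : ∀ {n} (R S : BRel n) → (R ≐ᵇ S) ≡ true → R ≗₂ S
≐ᵇ-elim R S p = ⊑-antisym {R = R} {S} (≤ᵇ-elim R S (∧-elimˡ p)) (≤ᵇ-elim S R (∧-elimʳ {R ≤ᵇ S} p))

≐ᵇ-cong : ∀ {n} {R R' S S' : BRel n} → R ≗₂ R' → S ≗₂ S' → (R ≐ᵇ S) ≡ (R' ≐ᵇ S')
≐ᵇ-cong p q = cong₂ _∧_ (≤ᵇ-cong p q) (≤ᵇ-cong q p)

≐ᵇ-sym : ∀ {n} (R S : BRel n) → (R ≐ᵇ S) ≡ (S ≐ᵇ R)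
≐ᵇ-sym R S = bool-ext (≐ᵇ-intro ∘ ≗₂-sym ∘ ≐ᵇ-elim R S) (≐ᵇ-intro ∘ ≗₂-sym ∘ ≐ᵇ-elim S R)

record IsEquiv {n} (R : BRel n) : Set where
  field
    reflexive  : ∀ i → R i i ≡ true
    symmetric  : ∀ i j → R i j ≡ true → R j i ≡ true
    transitive : ∀ i j k → R i j ≡ true → R j k ≡ true → R i k ≡ true

  sym-≡ : ∀ i j → R i j ≡ R j i
  sym-≡ i j = bool-ext (symmetric i j) (symmetric j i)

  class-≡ : ∀ i j → R i j ≡ true → ∀ k → R i k ≡ R j k
  class-≡ i j p k = bool-ext (transitive j i k (symmetric i j p)) (transitive i j k p)

open IsEquiv public

⟦⟧-equiv : ∀ {n} (π : SetPartition n) → IsEquiv ⟦ π ⟧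
⟦⟧-equiv π .reflexive  i = ≡ᵇ-intro {π i} refl
⟦⟧-equiv π .symmetric  i j p = ≡ᵇ-intro {π j} (sym (≡ᵇ-elim {π i} p))
⟦⟧-equiv π .transitive i j k p q = ≡ᵇ-intro {π i} (trans (≡ᵇ-elim p) (≡ᵇ-elim q))

⋀-equiv : ∀ {n} {R S : BRel n} → IsEquiv R → IsEquiv S → IsEquiv (R ⋀ S)
⋀-equiv r s .reflexive i = ∧-intro (reflexive r i) (reflexive s i)
⋀-equiv r s .symmetric i j p = ∧-intro (symmetric r i j (∧-elimˡ p)) (symmetric s i j (∧-elimʳ p))
⋀-equiv r s .transitive i j k p q =
  ∧-intro (transitive r i j k (∧-elimˡ p) (∧-elimˡ q)) (transitive s i j k (∧-elimʳ p) (∧-elimʳ q))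

⋀-greatest : ∀ {n} (T R S : BRel n) → (T ≤ᵇ (R ⋀ S)) ≡ (T ≤ᵇ R) ∧ (T ≤ᵇ S)
⋀-greatest T R S = bool-ext
  (λ p → let T⊑ = ≤ᵇ-elim T (R ⋀ S) p in
    ∧-intro (≤ᵇ-intro λ i j q → ∧-elimˡ (T⊑ i j q)) (≤ᵇ-intro λ i j q → ∧-elimʳ {R i j} (T⊑ i j q)))
  (λ p → ≤ᵇ-intro λ i j q →
    ∧-intro (≤ᵇ-elim T R (∧-elimˡ p) i j q) (≤ᵇ-elim T S (∧-elimʳ {T ≤ᵇ R} p) i j q))

𝟘̂-least : ∀ {n} {R : BRel n} → IsEquiv R → ⟦ 𝟘̂ ⟧ ⊑ R
𝟘̂-least {R = R} r i j p = subst (λ k → R i k ≡ true) (toℕ-injective (≡ᵇ-elim p)) (reflexive r i)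

-- Join

private
  ∨-introˡ : ∀ {a b} → a ≡ true → a ∨ b ≡ true
  ∨-introˡ refl = refl

  ∨-introʳ : ∀ {a b} → b ≡ true → a ∨ b ≡ true
  ∨-introʳ {true}  p = refl
  ∨-introʳ {false} p = p

  ∨-elim : ∀ {a b} {C : Set} → (a ≡ true → C) → (b ≡ true → C) → a ∨ b ≡ true → C
  ∨-elim {true}  f g p = f refl
  ∨-elim {false} f g p = g p

iter-⊒ : ∀ {n} k (T U : BRel n) → U ⊑ T → U ⊑ iter k T
iter-⊒ zero    T U p = p
iter-⊒ (suc k) T U p = iter-⊒ k _ U λ i j q → ∨-introˡ (p i j q)

iter-⊑ : ∀ {n} k (T U : BRel n) → IsEquiv U → T ⊑ U → iter k T ⊑ U
iter-⊑ zero    T U u p = p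
iter-⊑ (suc k) T U u p = iter-⊑ k _ U u λ i j →
  ∨-elim (p i j) λ q →
    let l , r = anyF-elim (trans (sym (any-tabulate (λ l → T i l ∧ T l j) id)) q)
    in transitive u i l j (p i l (∧-elimˡ r)) (p l j (∧-elimʳ {T i l} r))

-- A squaring step only adds pairs, and it adds none outside an equivalence that contains the
-- relation so far. Hence every iterate lies below the same equivalences as the union it starts
-- from.
⋁-least : ∀ {n} (R S U : BRel n) → IsEquiv U → (R ⋁ S ≤ᵇ U) ≡ (R ≤ᵇ U) ∧ (S ≤ᵇ U)
⋁-least {n} R S U u = bool-ext
  (λ p → ∧-intro (≤ᵇ-intro (⊑-trans (iter-⊒ n _ R λ i j → ∨-introˡ) (≤ᵇ-elim (R ⋁ S) U p)))
                 (≤ᵇ-intro (⊑-trans (iter-⊒ n _ S λ i j → ∨-introʳ {R i j}) (≤ᵇ-elim (R ⋁ S) U p))))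
  (λ p → ≤ᵇ-intro (iter-⊑ n _ U u λ i j →
    ∨-elim (≤ᵇ-elim R U (∧-elimˡ p) i j) (≤ᵇ-elim S U (∧-elimʳ {R ≤ᵇ U} p) i j)))

-- Enumeration of set partitions

-- Existence and uniqueness are tied to a position of the list, in the form in which a sum over the
-- list collapses to one term.
data ExactlyOne {A : Set} (P : A → Set) : List A → Set where
  here  : ∀ {x xs} → P x → All (λ y → ¬ P y) xs → ExactlyOne P (x ∷ xs)
  there : ∀ {x xs} → ¬ P x → ExactlyOne P xs → ExactlyOne P (x ∷ xs)

module _ {A : Set} {P : A → Set} where

  one-resp : ∀ {Q : A → Set} → (∀ x → P x → Q x) → (∀ x → Q x → P x) →
             ∀ {xs} → ExactlyOne P xs → ExactlyOne Q xs
  one-resp f g (here p ps)  = here (f _ p) (All.map (λ ¬p q → ¬p (g _ q)) ps)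
  one-resp f g (there ¬p o) = there (¬p ∘ g _) (one-resp f g o)

  one-map : ∀ {B : Set} {f : B → A} {xs} → ExactlyOne (P ∘ f) xs → ExactlyOne P (map f xs)
  one-map (here p ps)  = here p (All.map⁺ ps)
  one-map (there ¬p o) = there ¬p (one-map o)

  one-++ˡ : ∀ {xs ys} → ExactlyOne P xs → All (λ y → ¬ P y) ys → ExactlyOne P (xs ++ ys)
  one-++ˡ (here p ps)  qs = here p (All.++⁺ ps qs)
  one-++ˡ (there ¬p o) qs = there ¬p (one-++ˡ o qs)

  one-++ʳ : ∀ {xs ys} → All (λ y → ¬ P y) xs → ExactlyOne P ys → ExactlyOne P (xs ++ ys)
  one-++ʳ []        o = o
  one-++ʳ (¬p ∷ ps) o = there ¬p (one-++ʳ ps o)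

  module _ {B : Set} {R Q : B → Set} {f : B → List A}
           (one  : ∀ x → R x → Q x → ExactlyOne P (f x))
           (none : ∀ x → R x → ¬ Q x → All (λ y → ¬ P y) (f x)) where

    none-concatMap : ∀ {xs} → All R xs → All (λ y → ¬ Q y) xs → All (λ y → ¬ P y) (concatMap f xs)
    none-concatMap []       []       = []
    none-concatMap (r ∷ rs) (q ∷ qs) = All.++⁺ (none _ r q) (none-concatMap rs qs)

    one-concatMap : ∀ {xs} → All R xs → ExactlyOne Q xs → ExactlyOne P (concatMap f xs)
    one-concatMap (r ∷ rs) (here q qs)  = one-++ˡ (one _ r q) (none-concatMap rs qs)
    one-concatMap (r ∷ rs) (there ¬q o) = one-++ʳ (none _ r ¬q) (one-concatMap rs o)

  one-applyUpTo : ∀ f n l → l ℕ.< n → P (f l) → (∀ k → k ℕ.< n → P (f k) → k ≡ l) →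
                  ExactlyOne P (applyUpTo f n)
  one-applyUpTo f (suc n) zero    _ p uniq = here p
    (All.applyUpTo⁺₁ (f ∘ suc) n λ i<n q → case uniq _ (ℕ.s≤s i<n) q of λ ())
  one-applyUpTo f (suc n) (suc l) (ℕ.s≤s l<n) p uniq = there
    (λ q → case uniq 0 (ℕ.s≤s ℕ.z≤n) q of λ ())
    (one-applyUpTo (f ∘ suc) n l l<n p λ k k<n q → ℕ.suc-injective (uniq (suc k) (ℕ.s≤s k<n) q))

_↔̇_ : Set → Set → Set
A ↔̇ B = (A → B) × (B → A)

-- A pair (l , s) records that an earlier element has label l in the vector
-- and label s in the partition.
Match : ∀ {k} → List (ℕ × ℕ) → Vec ℕ k → SetPartition k → Set
Match P v σ = (∀ i j → (lookup v i ≡ lookup v j) ↔̇ (σ i ≡ σ j))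
            × All (λ (l , s) → ∀ i → (lookup v i ≡ l) ↔̇ (σ i ≡ s)) P

Compat : List (ℕ × ℕ) → ℕ → ℕ → Set
Compat P l s = All (λ (l' , s') → (l ≡ l') ↔̇ (s ≡ s')) P

module _ {k} {P : List (ℕ × ℕ)} {l : ℕ} {v : Vec ℕ k} {σ : SetPartition (suc k)} where

  match-uncons : Match P (l ∷ v) σ → Compat P l (σ zero) × Match ((l , σ zero) ∷ P) v (σ ∘ suc)
  match-uncons (ker , out) =
    All.map (λ f → f zero) out ,
    (λ i j → ker (suc i) (suc j)) , (λ i → ker (suc i) zero) ∷ All.map (λ f i → f (suc i)) out

  match-cons : Compat P l (σ zero) → Match ((l , σ zero) ∷ P) v (σ ∘ suc) → Match P (l ∷ v) σ
  match-cons c (ker , h ∷ out) = ker' , All.zipWith (λ (f , g) → out' f g) (c , out)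
    where
    ker' : ∀ i j → (lookup (l ∷ v) i ≡ lookup (l ∷ v) j) ↔̇ (σ i ≡ σ j)
    ker' zero    zero    = (λ _ → refl) , (λ _ → refl)
    ker' zero    (suc j) = sym ∘ proj₁ (h j) ∘ sym , sym ∘ proj₂ (h j) ∘ sym
    ker' (suc i) zero    = h i
    ker' (suc i) (suc j) = ker i j
    out' : ∀ {l' s'} → (l ≡ l') ↔̇ (σ zero ≡ s') →
           (∀ i → (lookup v i ≡ l') ↔̇ (σ (suc i) ≡ s')) →
           ∀ i → (lookup (l ∷ v) i ≡ l') ↔̇ (σ i ≡ s')
    out' f g zero    = f
    out' f g (suc i) = g i

-- The state of a restricted growth function after some elements: the labels in use are exactly
-- those below `m`, and the pairs in `P` are the graph of a bijection between vector labels and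
-- partition labels.
record Canonical (m : ℕ) (P : List (ℕ × ℕ)) : Set where
  field
    covers     : ∀ l → l ℕ.< m → ∃[ s ] (l , s) ∈ P
    bounded    : ∀ {l s} → (l , s) ∈ P → l ℕ.< m
    consistent : ∀ {l s} → (l , s) ∈ P → Compat P l s

open Canonical

nextBound : ℕ → ℕ → ℕ
nextBound l m = if l ≡ᵇ m then suc m else m

canonical-extend : ∀ {m P l s} → Canonical m P → l ℕ.< suc m → Compat P l s →
                   Canonical (nextBound l m) ((l , s) ∷ P)
canonical-extend {m} {P} {l} {s} can l≤m c with l ≡ᵇ m in eq
... | true with ≡ᵇ-elim {l} eq
...   | refl = record
  { covers = λ k k≤m → case ℕ.m≤n⇒m<n∨m≡n (ℕ.≤-pred k≤m) of λ where
      (inj₁ k<m) → let s , p = covers can k k<m in s , there p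
      (inj₂ refl) → s , here refl
  ; bounded = λ where
      (here refl) → ℕ.n<1+n m
      (there p)   → ℕ.m<n⇒m<1+n (bounded can p)
  ; consistent = λ where
      (here refl) → ((λ _ → refl) , (λ _ → refl)) ∷ c
      (there p)   → (let f , g = All.lookup c p in sym ∘ f ∘ sym , sym ∘ g ∘ sym) ∷ consistent can p }
canonical-extend {m} {P} {l} {s} can l≤m c | false = record
  { covers = λ k k<m → let s , p = covers can k k<m in s , there p
  ; bounded = λ where
      (here refl) → ℕ.≤∧≢⇒< (ℕ.≤-pred l≤m) λ l≡m → true≢false (≡ᵇ-intro l≡m) eq
      (there p)   → bounded can p
  ; consistent = λ where
      (here refl) → ((λ _ → refl) , (λ _ → refl)) ∷ c
      (there p)   → (let f , g = All.lookup c p in sym ∘ f ∘ sym , sym ∘ g ∘ sym) ∷ consistent can p }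

-- A partition label seen before forces its old vector label. A fresh one excludes every label below
-- `m`, because `covers` says that each of them is taken, so the new label `m` is the only choice.
one-compat : ∀ {m P} → Canonical m P → ∀ s → ExactlyOne (λ l → Compat P l s) (upTo (suc m))
one-compat {m} {P} can s with any? (λ (_ , s') → s ℕ.≟ s') P
... | yes found with find found
...   | (l , .s) , p , refl =
  one-applyUpTo id (suc m) l (ℕ.m<n⇒m<1+n (bounded can p)) (consistent can p)
    λ k _ c → proj₂ (All.lookup c p) refl
one-compat {m} {P} can s | no fresh =
  one-applyUpTo id (suc m) m (ℕ.n<1+n m)
    (All.tabulate λ p → (λ { refl → contradiction (bounded can p) (ℕ.<-irrefl refl) }) ,
                        (λ { refl → contradiction (lose p refl) fresh }))
    λ k k≤m c → case ℕ.m≤n⇒m<n∨m≡n (ℕ.≤-pred k≤m) of λ where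
      (inj₁ k<m) → let s' , p = covers can k k<m in
                   contradiction (lose p (proj₁ (All.lookup c p) refl)) fresh
      (inj₂ k≡m) → k≡m

one-rgf : ∀ k {m P} → Canonical m P → (σ : SetPartition k) → ExactlyOne (λ v → Match P v σ) (rgf k m)
one-rgf zero    can σ = here ((λ ()) , All.tabulate λ _ ()) []
one-rgf (suc k) {m} {P} can σ = one-concatMap
  (λ l l≤m c → one-map (one-resp (λ v → match-cons c) (λ v → proj₂ ∘ match-uncons)
                          (one-rgf k (canonical-extend can l≤m c) (σ ∘ suc))))
  (λ l _ ¬c → All.map⁺ (All.tabulate λ _ → ¬c ∘ proj₁ ∘ match-uncons))
  (All.applyUpTo⁺₁ id (suc m) id)
  (one-compat can (σ zero))

one-partition : ∀ {n} (σ : SetPartition n) → ExactlyOne (λ τ → ⟦ τ ⟧ ≗₂ ⟦ σ ⟧) (allPartitions n)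
one-partition {n} σ = one-map (one-resp
  (λ v (ker , _) i j → bool-ext (≡ᵇ-intro ∘ proj₁ (ker i j) ∘ ≡ᵇ-elim) (≡ᵇ-intro ∘ proj₂ (ker i j) ∘ ≡ᵇ-elim))
  (λ v p → (λ i j → ≡ᵇ-elim ∘ trans (sym (p i j)) ∘ ≡ᵇ-intro , ≡ᵇ-elim ∘ trans (p i j) ∘ ≡ᵇ-intro) , [])
  (one-rgf n canonical-[] σ))
  where
  canonical-[] : Canonical 0 []
  canonical-[] = record { covers = λ _ () ; bounded = λ () ; consistent = λ () }

-- Sums over lists

module ListSum (R : CommutativeRing 0ℓ 0ℓ) where
  open CommutativeRing R renaming (refl to ≈-refl; sym to ≈-sym; trans to ≈-trans)
  open SetoidReasoning setoid

  sumL : ∀ {A : Set} → (A → Carrier) → List A → Carrier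
  sumL f = foldr (λ a acc → f a + acc) 0#

  sum-cong : ∀ {A : Set} {f g : A → Carrier} xs → (∀ x → f x ≈ g x) → sumL f xs ≈ sumL g xs
  sum-cong []       p = ≈-refl
  sum-cong (x ∷ xs) p = +-cong (p x) (sum-cong xs p)

  sum-0 : ∀ {A : Set} {f : A → Carrier} {xs} → All (λ x → f x ≈ 0#) xs → sumL f xs ≈ 0#
  sum-0 []       = ≈-refl
  sum-0 (p ∷ ps) = ≈-trans (+-cong p (sum-0 ps)) (+-identityˡ 0#)

  sum-+ : ∀ {A : Set} (f g : A → Carrier) xs → sumL (λ x → f x + g x) xs ≈ sumL f xs + sumL g xs
  sum-+ f g []       = ≈-sym (+-identityˡ 0#)
  sum-+ f g (x ∷ xs) = begin
    f x + g x + sumL (λ x → f x + g x) xs ≈⟨ +-congˡ (sum-+ f g xs) ⟩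
    f x + g x + (sumL f xs + sumL g xs)   ≈⟨ +-assoc _ _ _ ⟩
    f x + (g x + (sumL f xs + sumL g xs)) ≈⟨ +-congˡ (+-assoc _ _ _) ⟨
    f x + (g x + sumL f xs + sumL g xs)   ≈⟨ +-congˡ (+-congʳ (+-comm _ _)) ⟩
    f x + (sumL f xs + g x + sumL g xs)   ≈⟨ +-congˡ (+-assoc _ _ _) ⟩
    f x + (sumL f xs + (g x + sumL g xs)) ≈⟨ +-assoc _ _ _ ⟨
    f x + sumL f xs + (g x + sumL g xs)   ∎

  sum-* : ∀ {A : Set} c (f : A → Carrier) xs → sumL (λ x → c * f x) xs ≈ c * sumL f xs
  sum-* c f []       = ≈-sym (zeroʳ c)
  sum-* c f (x ∷ xs) = ≈-trans (+-congˡ (sum-* c f xs)) (≈-sym (distribˡ c (f x) _))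

  sum-one : ∀ {A : Set} {P : A → Set} {f : A → Carrier} {c xs} → ExactlyOne P xs →
            (∀ x → P x → f x ≈ c) → (∀ x → ¬ P x → f x ≈ 0#) → sumL f xs ≈ c
  sum-one (here p ps)  on off = ≈-trans (+-cong (on _ p) (sum-0 (All.map (off _) ps))) (+-identityʳ _)
  sum-one (there ¬p o) on off = ≈-trans (+-cong (off _ ¬p) (sum-one o on off)) (+-identityˡ _)

  sum-partition : ∀ {n} {f : SetPartition n → Carrier} {c} (σ : SetPartition n) →
    (∀ τ → ⟦ τ ⟧ ≗₂ ⟦ σ ⟧ → f τ ≈ c) → (∀ τ → (⟦ τ ⟧ ≐ᵇ ⟦ σ ⟧) ≡ false → f τ ≈ 0#) →
    sumL f (allPartitions n) ≈ c
  sum-partition σ on off = sum-one (one-partition σ) on λ τ ¬p → off τ (¬true (¬p ∘ ≐ᵇ-elim ⟦ τ ⟧ ⟦ σ ⟧))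

-- Counting and block representatives

cnt : ∀ {n} → (Fin n → Bool) → ℕ
cnt {zero}  f = 0
cnt {suc n} f = (if f zero then 1 else 0) ℕ.+ cnt (f ∘ suc)

cnt-cong : ∀ {n} {f g : Fin n → Bool} → (∀ i → f i ≡ g i) → cnt f ≡ cnt g
cnt-cong {zero}  p = refl
cnt-cong {suc n} p = cong₂ (λ b k → (if b then 1 else 0) ℕ.+ k) (p zero) (cnt-cong (p ∘ suc))

cnt-none : ∀ {n} {f : Fin n → Bool} → (∀ i → f i ≡ false) → cnt f ≡ 0
cnt-none {zero}  p = refl
cnt-none {suc n} p rewrite p zero = cnt-none (p ∘ suc)

cnt-split : ∀ {n} (f g : Fin n → Bool) → cnt f ≡ cnt (λ i → not (g i) ∧ f i) ℕ.+ cnt (λ i → g i ∧ f i)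
cnt-split {zero}  f g = refl
cnt-split {suc n} f g with g zero
... | true  = trans (cong (b ℕ.+_) (cnt-split (f ∘ suc) (g ∘ suc))) 
  (x∙yz≈y∙xz b (cnt (λ i → not (g (suc i)) ∧ f (suc i))) _)
  where
  b = if f zero then 1 else 0
  open import Algebra.Properties.CommutativeSemigroup ℕ.+-commutativeSemigroup using (x∙yz≈y∙xz)
... | false = trans (cong (b ℕ.+_) (cnt-split (f ∘ suc) (g ∘ suc))) 
  (sym (ℕ.+-assoc b (cnt (λ i → not (g (suc i)) ∧ f (suc i))) _))
  where b = if f zero then 1 else 0

foldr-tabulate : ∀ {A B : Set} {n} (_⊕_ : A → B → B) (z : B) (f : Fin n → A) {k} (g : Fin k → Fin n) →
                 foldr (λ i acc → f i ⊕ acc) z (tabulate g) ≡ Data.Vec.Functional.foldr _⊕_ z (f ∘ g)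
foldr-tabulate _⊕_ z f {zero}  g = refl
foldr-tabulate _⊕_ z f {suc k} g = cong (f (g zero) ⊕_) (foldr-tabulate _⊕_ z f (g ∘ suc))

count≡cnt : ∀ {n} (f : Fin n → Bool) → count f ≡ cnt f
count≡cnt f = trans (foldr-tabulate ℕ._+_ 0 (λ i → if f i then 1 else 0) id) (go f)
  where
  go : ∀ {n} (f : Fin n → Bool) → Data.Vec.Functional.foldr ℕ._+_ 0 (λ i → if f i then 1 else 0) ≡ cnt f
  go {zero}  f = refl
  go {suc n} f = cong ((if f zero then 1 else 0) ℕ.+_) (go (f ∘ suc))

sub : ∀ {n} → BRel (suc n) → BRel n
sub R i j = R (suc i) (suc j)

sub-equiv : ∀ {n} {R : BRel (suc n)} → IsEquiv R → IsEquiv (sub R)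
sub-equiv r .reflexive  i     = reflexive r (suc i)
sub-equiv r .symmetric  i j   = symmetric r (suc i) (suc j)
sub-equiv r .transitive i j k = transitive r (suc i) (suc j) (suc k)

joined : ∀ {n} → BRel (suc n) → Bool
joined R = anyF (λ j → R zero (suc j))

least : ∀ {n} → BRel n → Fin n → Bool
least R zero    = true
least R (suc j) = not (R (suc j) zero) ∧ least (sub R) j

-- Deleting the element zero never changes which later elements are block maxima, whereas the
-- minimum of its block moves. The recursions therefore mark a block by its maximum, although the
-- given definitions use the minimum.
greatest : ∀ {n} → BRel n → Fin n → Bool
greatest R zero    = not (joined R)
greatest R (suc j) = greatest (sub R) j

isBlockMin≡least : ∀ {n} (R : BRel n) i → isBlockMin R i ≡ least R i
isBlockMin≡least {n} R i =
  trans (cong not (any-tabulate (λ j → R i j ∧ (toℕ j ℕ.<ᵇ toℕ i)) id)) (go R i)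
  where
  none : ∀ {n} (f : Fin n → Bool) → anyF (λ j → f j ∧ false) ≡ false
  none {zero}  f = refl
  none {suc n} f rewrite ∧-zeroʳ (f zero) = none (f ∘ suc)
  go : ∀ {n} (R : BRel n) i → not (anyF (λ j → R i j ∧ (toℕ j ℕ.<ᵇ toℕ i))) ≡ least R i
  go {suc n} R zero    = cong not (none (R zero))
  go {suc n} R (suc i) rewrite ∧-identityʳ (R (suc i) zero) with R (suc i) zero
  ... | true  = refl
  ... | false = go (sub R) i

least-cong : ∀ {n} {R S : BRel n} → R ≗₂ S → ∀ i → least R i ≡ least S i
least-cong p zero    = refl
least-cong p (suc i) = cong₂ (λ a b → not a ∧ b) (p (suc i) zero) (least-cong (λ i j → p (suc i) (suc j)) i)

-- The two conditions say that `Q` is empty or a single block of `R`, and a block has one maximum.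
greatest-class : ∀ {n} {R : BRel n} → IsEquiv R → (Q : Fin n → Bool) →
  (∀ i j → Q i ≡ true → Q j ≡ true → R i j ≡ true) → (∀ i j → R i j ≡ true → Q i ≡ true → Q j ≡ true) →
  cnt (λ j → greatest R j ∧ Q j) ≡ (if anyF Q then 1 else 0)
greatest-class {zero}  r Q con sat = refl
greatest-class {suc n} {R} r Q con sat
  rewrite greatest-class (sub-equiv r) (Q ∘ suc) (λ i j → con (suc i) (suc j)) (λ i j → sat (suc i) (suc j))
  with Q zero in q | joined R in eq
... | false | true  = refl
... | false | false = refl
... | true  | true  with i , p ← anyF-elim eq
                    rewrite anyF-intro {f = Q ∘ suc} i (sat zero (suc i) p q) = refl
... | true  | false with anyF (Q ∘ suc) in eq'
...   | false = refl
...   | true  with i , p ← anyF-elim eq' = true≢false (anyF-intro i (con zero (suc i) q p)) eq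

cnt-greatest-joined : ∀ {n} {R : BRel (suc n)} → IsEquiv R →
  cnt (λ j → greatest (sub R) j ∧ R zero (suc j)) ≡ (if joined R then 1 else 0)
cnt-greatest-joined {R = R} r = greatest-class (sub-equiv r) (λ j → R zero (suc j))
  (λ i j p q → transitive r (suc i) zero (suc j) (symmetric r _ _ p) q)
  (λ i j p q → transitive r zero (suc i) (suc j) q p)

-- Both sides count the blocks of `R` inside `Q`. When zero is deleted, its block loses its minimum
-- and, if other elements remain, gains a new one: `X` counts the minima outside that block and `Y`
-- the new one. On the other side zero is a maximum only if it is alone. That `Y` is 0 or 1 comes
-- from the same lemma for the later elements.
cnt-least≡cnt-greatest : ∀ {n} {R : BRel n} → IsEquiv R → (Q : Fin n → Bool) →
  (∀ i j → R i j ≡ true → Q i ≡ true → Q j ≡ true) →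
  cnt (λ j → least R j ∧ Q j) ≡ cnt (λ j → greatest R j ∧ Q j)
cnt-least≡cnt-greatest {zero}  r Q sat = refl
cnt-least≡cnt-greatest {suc n} {R} r Q sat = begin
  a ℕ.+ cnt (λ j → (not (R (suc j) zero) ∧ least (sub R) j) ∧ Q (suc j))
    ≡⟨ cong (a ℕ.+_) (cnt-cong λ j → ∧-assoc (not (R (suc j) zero)) _ _) ⟩
  a ℕ.+ cnt (λ j → not (R (suc j) zero) ∧ least (sub R) j ∧ Q (suc j))
    ≡⟨ step (Q zero) refl ⟩
  b ℕ.+ (cnt (λ j → not (R (suc j) zero) ∧ least (sub R) j ∧ Q (suc j))
         ℕ.+ cnt (λ j → R (suc j) zero ∧ least (sub R) j ∧ Q (suc j)))
    ≡⟨ cong (b ℕ.+_) (cnt-split _ (λ j → R (suc j) zero)) ⟨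
  b ℕ.+ cnt (λ j → least (sub R) j ∧ Q (suc j))
    ≡⟨ cong (b ℕ.+_) (cnt-least≡cnt-greatest (sub-equiv r) (Q ∘ suc) (λ i j → sat (suc i) (suc j))) ⟩
  b ℕ.+ cnt (λ j → greatest (sub R) j ∧ Q (suc j)) ∎
  where
  open ≡-Reasoning
  a = if Q zero then 1 else 0
  b = if not (joined R) ∧ Q zero then 1 else 0
  X = cnt (λ j → not (R (suc j) zero) ∧ least (sub R) j ∧ Q (suc j))
  Y = cnt (λ j → R (suc j) zero ∧ least (sub R) j ∧ Q (suc j))

  class-of-zero : Q zero ≡ true → Y ≡ (if joined R then 1 else 0)
  class-of-zero q = begin
    Y ≡⟨ cnt-cong (λ j → bool-ext
           (λ p → ∧-intro (∧-elimˡ (∧-elimʳ {R (suc j) zero} p)) (symmetric r _ _ (∧-elimˡ p)))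
           (λ p → let l = ∧-elimˡ p ; s = ∧-elimʳ {least (sub R) j} p in
                  ∧-intro (symmetric r _ _ s) (∧-intro l (sat zero (suc j) s q)))) ⟩
    cnt (λ j → least (sub R) j ∧ R zero (suc j))
      ≡⟨ cnt-least≡cnt-greatest (sub-equiv r) (λ j → R zero (suc j)) (λ i j p s → transitive r zero (suc i) (suc j) s p) ⟩
    cnt (λ j → greatest (sub R) j ∧ R zero (suc j)) ≡⟨ cnt-greatest-joined r ⟩
    (if joined R then 1 else 0) ∎

  step : ∀ q → Q zero ≡ q → (if q then 1 else 0) ℕ.+ X ≡ (if not (joined R) ∧ q then 1 else 0) ℕ.+ (X ℕ.+ Y)
  step true q rewrite class-of-zero q with joined R
  ... | true  = ℕ.+-comm 1 X
  ... | false = cong suc (sym (ℕ.+-identityʳ X))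
  step false q = begin
    X                  ≡⟨ ℕ.+-identityʳ X ⟨
    X ℕ.+ 0            ≡⟨ cong (X ℕ.+_) (cnt-none λ j → ¬true λ p →
                           true≢false (sat (suc j) zero (∧-elimˡ p) (∧-elimʳ {least (sub R) j} (∧-elimʳ {R (suc j) zero} p))) q) ⟨
    X ℕ.+ Y            ≡⟨ cong (λ c → (if c then 1 else 0) ℕ.+ (X ℕ.+ Y)) (∧-zeroʳ (not (joined R))) ⟨
    (if not (joined R) ∧ false then 1 else 0) ℕ.+ (X ℕ.+ Y) ∎

cnt-least-joined : ∀ {n} {R : BRel (suc n)} → IsEquiv R →
  cnt (λ j → least (sub R) j ∧ R zero (suc j)) ≡ (if joined R then 1 else 0)
cnt-least-joined {R = R} r = trans
  (cnt-least≡cnt-greatest (sub-equiv r) (λ j → R zero (suc j)) (λ i j p s → transitive r zero (suc i) (suc j) s p))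
  (cnt-greatest-joined r)

-- Products over blocks

module BlockProduct (M : CommutativeMonoid 0ℓ 0ℓ) where
  open CommutativeMonoid M renaming (refl to ≈-refl; sym to ≈-sym; trans to ≈-trans)
  open FinSum M using (sum; sum-cong-≋; ∑-distrib-+)
  open SetoidReasoning setoid

  -- `sum` is the fold of the monoid `M`, so it is a product in both instances below.
  blockProduct : ∀ {n} → BRel n → (Fin n → Carrier) → Carrier
  blockProduct R g = sum (λ i → if least R i then g i else ε)

  private
    if-cong : ∀ b {x y z : Carrier} → (b ≡ true → x ≈ y) → (if b then x else z) ≈ (if b then y else z)
    if-cong true  p = p refl
    if-cong false p = ≈-refl

    sum-ε : ∀ {n} (f : Fin n → Bool) {x} → cnt f ≡ 0 → sum (λ i → if f i then x else ε) ≈ ε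
    sum-ε {zero}  f p = ≈-refl
    sum-ε {suc n} f p with f zero
    ... | false = ≈-trans (identityˡ _) (sum-ε (f ∘ suc) p)

    sum-single : ∀ {n} (f : Fin n → Bool) {x} → cnt f ≡ 1 → sum (λ i → if f i then x else ε) ≈ x
    sum-single {suc n} f p with f zero
    ... | true  = ≈-trans (∙-congˡ (sum-ε (f ∘ suc) (ℕ.suc-injective p))) (identityʳ _)
    ... | false = ≈-trans (identityˡ _) (sum-single (f ∘ suc) p)

    sum-indicator : ∀ {n} (f : Fin n → Bool) {x} b → cnt f ≡ (if b then 1 else 0) →
                    sum (λ i → if f i then x else ε) ≈ (if b then x else ε)
    sum-indicator f true  p = sum-single f p
    sum-indicator f false p = sum-ε f p

  blockProduct-cong : ∀ {n} {R S : BRel n} {f g : Fin n → Carrier} → R ≗₂ S → (∀ i → f i ≈ g i) →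
                      blockProduct R f ≈ blockProduct S g
  blockProduct-cong {R = R} {S} {f} {g} p q = sum-cong-≋ λ i →
    ≈-trans (if-cong (least R i) λ _ → q i)
            (reflexive′ (cong (λ b → if b then g i else ε) (least-cong p i)))
    where
    reflexive′ : ∀ {x y} → x ≡ y → x ≈ y
    reflexive′ refl = ≈-refl

  -- Removing the element zero changes only the factor of its own block;
  -- Y is the product over the other blocks.
  blockProduct-peel : ∀ {n} {R : BRel (suc n)} → IsEquiv R → ∀ {g G x} →
    (∀ j → R zero (suc j) ≡ false → g (suc j) ≈ G j) → (∀ j → R zero (suc j) ≡ true → G j ≈ x) →
    ∃[ Y ] blockProduct R g ≈ g zero ∙ Y × blockProduct (sub R) G ≈ Y ∙ (if joined R then x else ε)
  blockProduct-peel {R = R} r {g} {G} {x} off on =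
    sum (λ j → if not (R (suc j) zero) ∧ least (sub R) j then G j else ε) ,
    ∙-congˡ (sum-cong-≋ λ j → if-cong _ λ p → off j (¬true λ q →
      true≢false (symmetric r _ _ q) (not-elim (∧-elimˡ p)))) ,
    (begin
      sum (λ j → if least (sub R) j then G j else ε)
        ≈⟨ sum-cong-≋ (λ j → split (R (suc j) zero) (R zero (suc j)) (least (sub R) j) (sym-≡ r _ _) (on j)) ⟩
      sum (λ j → (if not (R (suc j) zero) ∧ least (sub R) j then G j else ε) ∙ (if least (sub R) j ∧ R zero (suc j) then x else ε))
        ≈⟨ ∑-distrib-+ (λ j → if not (R (suc j) zero) ∧ least (sub R) j then G j else ε) _ ⟩
      _ ∙ sum (λ j → if least (sub R) j ∧ R zero (suc j) then x else ε)
        ≈⟨ ∙-congˡ (sum-indicator (λ j → least (sub R) j ∧ R zero (suc j)) (joined R) (cnt-least-joined r)) ⟩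
      _ ∙ (if joined R then x else ε) ∎)
    where
    not-elim : ∀ {b} → not b ≡ true → b ≡ false
    not-elim {false} _ = refl
    split : ∀ a b c {y} → a ≡ b → (b ≡ true → y ≈ x) →
            (if c then y else ε) ≈ (if not a ∧ c then y else ε) ∙ (if c ∧ b then x else ε)
    split true  .true  true  refl p = ≈-trans (p refl) (≈-sym (identityˡ x))
    split true  .true  false refl p = ≈-sym (identityˡ ε)
    split false .false true  refl p = ≈-sym (identityʳ _)
    split false .false false refl p = ≈-sym (identityʳ _)

-- Factorials and signs of a partition as block products

module ℕ* = BlockProduct ℕ.*-1-commutativeMonoid
module ℤ* = BlockProduct ℤ.*-1-commutativeMonoid

prodBlocksℕ≡ : ∀ {n} (R : BRel n) g → prodBlocksℕ R g ≡ ℕ*.blockProduct R g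
prodBlocksℕ≡ R g = trans (foldr-tabulate ℕ._*_ 1 (λ i → if isBlockMin R i then g i else 1) id)
  (FinSum.sum-cong-≗ ℕ.*-1-commutativeMonoid λ i → cong (λ b → if b then g i else 1) (isBlockMin≡least R i))

prodBlocksℤ≡ : ∀ {n} (R : BRel n) g → prodBlocksℤ R g ≡ ℤ*.blockProduct R g
prodBlocksℤ≡ R g = trans (foldr-tabulate ℤ._*_ 1ℤ (λ i → if isBlockMin R i then g i else 1ℤ) id)
  (FinSum.sum-cong-≗ ℤ.*-1-commutativeMonoid λ i → cong (λ b → if b then g i else 1ℤ) (isBlockMin≡least R i))

-- With all elements marked this is `fact R`. With the block maxima of some σ below `R` marked it is
-- λ(σ,R)!, since each block of σ is then counted once.
blockFact : ∀ {n} → (Fin n → Bool) → BRel n → ℕ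
blockFact mark R = ℕ*.blockProduct R (λ i → cnt (λ j → mark j ∧ R i j) !)

blockFact-cong : ∀ {n} {f g : Fin n → Bool} {R S : BRel n} →
  (∀ i → cnt (λ j → f j ∧ R i j) ≡ cnt (λ j → g j ∧ S i j)) → R ≗₂ S → blockFact f R ≡ blockFact g S
blockFact-cong p q = ℕ*.blockProduct-cong q λ i → cong _! (p i)

-- Only the factor of the block of zero changes. If zero is marked, it drops from (c + 1)! to c!,
-- which leaves the factor c + 1; if the block disappears together with zero, then c = 0 and the
-- missing factor c! is 1.
blockFact-suc : ∀ {n} (mark : Fin (suc n) → Bool) {R : BRel (suc n)} → IsEquiv R →
  blockFact mark R ≡ (if mark zero then suc (cnt (λ j → mark (suc j) ∧ R zero (suc j))) else 1)
                     ℕ.* blockFact (mark ∘ suc) (sub R)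
blockFact-suc mark {R} r with Y , p , q ← ℕ*.blockProduct-peel r
    {g = λ i → cnt (λ j → mark j ∧ R i j) !}
    {G = λ i → cnt (λ j → mark (suc j) ∧ R (suc i) (suc j)) !}
    {x = cnt (λ j → mark (suc j) ∧ R zero (suc j)) !}
    (λ j s → cong (λ b → ((if b then 1 else 0) ℕ.+ cnt (λ k → mark (suc k) ∧ R (suc j) (suc k))) !)
               (trans (cong (mark zero ∧_) (trans (sym-≡ r (suc j) zero) s)) (∧-zeroʳ (mark zero))))
    (λ j s → cong _! (cnt-cong λ k → cong (mark (suc k) ∧_) (sym (class-≡ r zero (suc j) s (suc k))))) = begin
  blockFact mark R ≡⟨ p ⟩
  ((if mark zero ∧ R zero zero then 1 else 0) ℕ.+ c) ! ℕ.* Y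
    ≡⟨ cong (λ b → ((if b then 1 else 0) ℕ.+ c) ! ℕ.* Y) (trans (cong (mark zero ∧_) (reflexive r zero)) (∧-identityʳ _)) ⟩
  ((if mark zero then 1 else 0) ℕ.+ c) ! ℕ.* Y
    ≡⟨ factor (mark zero) ⟩
  f ℕ.* (Y ℕ.* c !) ≡⟨ cong (λ z → f ℕ.* (Y ℕ.* z)) (empty (joined R) refl) ⟨
  f ℕ.* (Y ℕ.* (if joined R then c ! else 1)) ≡⟨ cong (f ℕ.*_) q ⟨
  f ℕ.* blockFact (mark ∘ suc) (sub R) ∎
  where
  open ≡-Reasoning
  c = cnt (λ j → mark (suc j) ∧ R zero (suc j))
  f = if mark zero then suc c else 1
  factor : ∀ b {Y} → ((if b then 1 else 0) ℕ.+ c) ! ℕ.* Y ≡ (if b then suc c else 1) ℕ.* (Y ℕ.* c !)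
  factor true  {Y} = trans (ℕ.*-assoc (suc c) (c !) Y) (cong (suc c ℕ.*_) (ℕ.*-comm (c !) Y))
  factor false {Y} = trans (ℕ.*-comm (c !) Y) (sym (ℕ.*-identityˡ _))
  empty : ∀ b → joined R ≡ b → (if b then c ! else 1) ≡ c !
  empty true  _  = refl
  empty false eq = sym (cong _! (cnt-none λ j → trans (cong (mark (suc j) ∧_) (anyF-none eq j)) (∧-zeroʳ (mark (suc j)))))

fact≡ : ∀ {n} (R : BRel n) → fact R ≡ blockFact (λ _ → true) R
fact≡ R = trans (prodBlocksℕ≡ R _) (ℕ*.blockProduct-cong (λ _ _ → refl) λ i → cong _! (count≡cnt (R i)))

fact-cong : ∀ {n} {R S : BRel n} → R ≗₂ S → fact R ≡ fact S
fact-cong {R = R} {S} p = trans (fact≡ R) (trans (blockFact-cong (λ i → cnt-cong (p i)) p) (sym (fact≡ S)))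

lamFact≡ : ∀ {n} (σ π : SetPartition n) → ⟦ σ ⟧ ⊑ ⟦ π ⟧ → lamFact σ π ≡ blockFact (greatest ⟦ σ ⟧) ⟦ π ⟧
lamFact≡ σ π σ≤π = trans (prodBlocksℕ≡ ⟦ π ⟧ _) (ℕ*.blockProduct-cong (λ _ _ → refl) λ i → cong _!
  (trans (count≡cnt (λ j → isBlockMin ⟦ σ ⟧ j ∧ ⟦ π ⟧ i j))
  (trans (cnt-cong λ j → cong (_∧ ⟦ π ⟧ i j) (isBlockMin≡least ⟦ σ ⟧ j))
         (cnt-least≡cnt-greatest (⟦⟧-equiv σ) (⟦ π ⟧ i) λ j k p q → transitive (⟦⟧-equiv π) i j k q (σ≤π j k p)))))

sgn≡ : ∀ {n} (σ : SetPartition n) → sgn σ ≡ ℤ*.blockProduct ⟦ σ ⟧ (λ i → negOnePow (cnt (⟦ σ ⟧ i) ℕ.∸ 1))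
sgn≡ σ = trans (prodBlocksℤ≡ ⟦ σ ⟧ _)
  (ℤ*.blockProduct-cong (λ _ _ → refl) λ i → cong (λ k → negOnePow (k ℕ.∸ 1)) (count≡cnt (⟦ σ ⟧ i)))

sgn-cong : ∀ {n} {σ τ : SetPartition n} → ⟦ σ ⟧ ≗₂ ⟦ τ ⟧ → sgn σ ≡ sgn τ
sgn-cong {σ = σ} {τ} p = trans (sgn≡ σ) (trans
  (ℤ*.blockProduct-cong p λ i → cong (λ k → negOnePow (k ℕ.∸ 1)) (cnt-cong (p i))) (sym (sgn≡ τ)))

joinSign : Bool → ℤ
joinSign b = if b then ℤ.-1ℤ else 1ℤ

-- Deleting zero shortens its cycle by one, which reverses the sign, unless zero is a fixed point.
sgn-suc : ∀ {n} (σ : SetPartition (suc n)) → sgn σ ≡ joinSign (joined ⟦ σ ⟧) ℤ.* sgn (σ ∘ suc)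
sgn-suc σ with Y , p , q ← ℤ*.blockProduct-peel (⟦⟧-equiv σ)
    {g = λ i → negOnePow (cnt (⟦ σ ⟧ i) ℕ.∸ 1)}
    {G = λ i → negOnePow (cnt (⟦ σ ∘ suc ⟧ i) ℕ.∸ 1)}
    {x = negOnePow (cnt (λ j → ⟦ σ ⟧ zero (suc j)) ℕ.∸ 1)}
    (λ j s → cong (λ b → negOnePow ((if b then 1 else 0) ℕ.+ cnt (λ k → ⟦ σ ⟧ (suc j) (suc k)) ℕ.∸ 1)) (trans (sym-≡ (⟦⟧-equiv σ) (suc j) zero) s))
    (λ j s → cong (λ k → negOnePow (k ℕ.∸ 1)) (cnt-cong λ k → sym (class-≡ (⟦⟧-equiv σ) zero (suc j) s (suc k)))) = begin
  sgn σ ≡⟨ sgn≡ σ ⟩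
  ℤ*.blockProduct ⟦ σ ⟧ (λ i → negOnePow (cnt (⟦ σ ⟧ i) ℕ.∸ 1)) ≡⟨ p ⟩
  negOnePow ((if ⟦ σ ⟧ zero zero then 1 else 0) ℕ.+ c ℕ.∸ 1) ℤ.* Y
    ≡⟨ cong (λ b → negOnePow ((if b then 1 else 0) ℕ.+ c ℕ.∸ 1) ℤ.* Y) (reflexive (⟦⟧-equiv σ) zero) ⟩
  negOnePow c ℤ.* Y ≡⟨ step (joined ⟦ σ ⟧) refl ⟩
  joinSign (joined ⟦ σ ⟧) ℤ.* (Y ℤ.* (if joined ⟦ σ ⟧ then x else 1ℤ)) ≡⟨ cong (joinSign (joined ⟦ σ ⟧) ℤ.*_) q ⟨
  joinSign (joined ⟦ σ ⟧) ℤ.* ℤ*.blockProduct ⟦ σ ∘ suc ⟧ (λ i → negOnePow (cnt (⟦ σ ∘ suc ⟧ i) ℕ.∸ 1)) ≡⟨ cong (joinSign (joined ⟦ σ ⟧) ℤ.*_) (sgn≡ (σ ∘ suc)) ⟨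
  joinSign (joined ⟦ σ ⟧) ℤ.* sgn (σ ∘ suc) ∎
  where
  open ≡-Reasoning
  c = cnt (λ j → ⟦ σ ⟧ zero (suc j))
  x = negOnePow (c ℕ.∸ 1)
  cnt-pos : ∀ {n} {f : Fin n → Bool} → anyF f ≡ true → ∃[ k ] cnt f ≡ suc k
  cnt-pos {suc n} {f} p with f zero
  ... | true  = _ , refl
  ... | false = cnt-pos {f = f ∘ suc} p
  negate : ∀ {c k} Y → c ≡ suc k → negOnePow c ℤ.* Y ≡ ℤ.-1ℤ ℤ.* (Y ℤ.* negOnePow (c ℕ.∸ 1))
  negate {k = k} Y refl = begin
    - negOnePow k ℤ.* Y           ≡⟨ ℤ.neg-distribˡ-* (negOnePow k) Y ⟨
    - (negOnePow k ℤ.* Y)         ≡⟨ cong -_ (ℤ.*-comm (negOnePow k) Y) ⟩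
    - (Y ℤ.* negOnePow k)         ≡⟨ ℤ.-1*i≡-i _ ⟨
    ℤ.-1ℤ ℤ.* (Y ℤ.* negOnePow k) ∎
  step : ∀ b → joined ⟦ σ ⟧ ≡ b → ∀ {Y} → negOnePow c ℤ.* Y ≡ joinSign b ℤ.* (Y ℤ.* (if b then x else 1ℤ))
  step true eq {Y} = negate Y (proj₂ (cnt-pos {f = λ j → ⟦ σ ⟧ zero (suc j)} eq))
  step false eq {Y} = begin
    negOnePow c ℤ.* Y     ≡⟨ cong (λ k → negOnePow k ℤ.* Y) (cnt-none {f = λ j → ⟦ σ ⟧ zero (suc j)} (anyF-none eq)) ⟩
    1ℤ ℤ.* Y              ≡⟨ cong (1ℤ ℤ.*_) (ℤ.*-identityʳ Y) ⟨
    1ℤ ℤ.* (Y ℤ.* 1ℤ)     ∎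

sgn-square : ∀ {n} (σ : SetPartition n) → sgn σ ℤ.* sgn σ ≡ 1ℤ
sgn-square {zero}  σ = refl
sgn-square {suc n} σ = begin
  sgn σ ℤ.* sgn σ   ≡⟨ cong₂ ℤ._*_ (sgn-suc σ) (sgn-suc σ) ⟩
  (s ℤ.* u) ℤ.* (s ℤ.* u) ≡⟨ medial s u s u ⟩
  (s ℤ.* s) ℤ.* (u ℤ.* u) ≡⟨ cong₂ ℤ._*_ (square (joined ⟦ σ ⟧)) (sgn-square (σ ∘ suc)) ⟩
  1ℤ ∎
  where
  open ≡-Reasoning
  open import Algebra.Properties.CommutativeSemigroup ℤ.*-commutativeSemigroup using () renaming (interchange to medial)
  s = joinSign (joined ⟦ σ ⟧)
  u = sgn (σ ∘ suc)
  square : ∀ b → joinSign b ℤ.* joinSign b ≡ 1ℤ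
  square true  = refl
  square false = refl

module ℤΣ = SemiringSum ℤ.+-*-semiring
module ℤL = ListSum ℤ.+-*-commutativeRing
open ℤΣ using () renaming (sum to ∑)

-- Weighted sums over merging processes

𝟙 : Bool → ℤ
𝟙 b = if b then 1ℤ else 0ℤ

𝟙-∧ : ∀ a b → 𝟙 (a ∧ b) ≡ 𝟙 a ℤ.* 𝟙 b
𝟙-∧ true  b = sym (ℤ.*-identityˡ (𝟙 b))
𝟙-∧ false b = refl

∑-𝟙 : ∀ {n} (f : Fin n → Bool) → ∑ (𝟙 ∘ f) ≡ + cnt f
∑-𝟙 {zero}  f = refl
∑-𝟙 {suc n} f with f zero
... | true  = cong (λ z → 1ℤ ℤ.+ z) (∑-𝟙 (f ∘ suc))
... | false = trans (ℤ.+-identityˡ _) (∑-𝟙 (f ∘ suc))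

fresh : ∀ {n} → SetPartition n → SetPartition (suc n)
fresh σ zero    = 0
fresh σ (suc i) = suc (σ i)

join : ∀ {n} → Fin n → SetPartition n → SetPartition (suc n)
join j σ zero    = σ j
join j σ (suc i) = σ i

anyF-false : ∀ n → anyF {n} (λ _ → false) ≡ false
anyF-false zero    = refl
anyF-false (suc n) = anyF-false n

joined-join : ∀ {n} (j : Fin n) σ → joined ⟦ join j σ ⟧ ≡ true
joined-join j σ = anyF-intro j (≡ᵇ-intro {σ j} refl)

freshWeight : ∀ {n} → BRel (suc n) → ℤ
freshWeight ρ = if joined ρ then 0ℤ else 1ℤ

-- If `ρ` already relates zero to later elements, zero has to follow them; the conjunction selects
-- the one maximum of their block, so that this happens with total weight 1. Otherwise each block of
-- `ρ` among the later elements offers one merge, indexed by its maximum.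
joinWeight : ∀ {n} → ℤ → BRel (suc n) → Fin n → ℤ
joinWeight t ρ j = if joined ρ then 𝟙 (greatest (sub ρ) j ∧ ρ zero (suc j))
                   else t ℤ.* 𝟙 (greatest (sub ρ) j)

extend : ∀ {n} → ℤ → BRel (suc n) → (SetPartition (suc n) → ℤ) → SetPartition n → ℤ
extend t ρ F σ = freshWeight ρ ℤ.* F (fresh σ) ℤ.+ ∑ (λ j → joinWeight t ρ j ℤ.* F (join j σ))

-- The blocks of ρ are inserted one by one; each is either kept apart, or
-- merged, with weight t, with the block of σ containing one of the earlier
-- blocks of ρ.  So σ ≥ ρ is reached with total weight t^r c, where r is its
-- rank in the interval above ρ and c a product of factorials, which is the
-- absolute value of μ(ρ,σ).
∑≥ : ∀ {n} → ℤ → BRel n → (SetPartition n → ℤ) → ℤ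
∑≥ {zero}  t ρ F = F (λ ())
∑≥ {suc n} t ρ F = ∑≥ t (sub ρ) (extend t ρ F)

lift-⊑ : ∀ {n} {R S : BRel (suc n)} → IsEquiv R → IsEquiv S →
         (∀ k → R zero (suc k) ≡ true → S zero (suc k) ≡ true) → sub R ⊑ sub S → R ⊑ S
lift-⊑ r s p q zero    zero    _ = reflexive s zero
lift-⊑ r s p q zero    (suc j) x = p j x
lift-⊑ r s p q (suc i) zero    x = symmetric s _ _ (p i (symmetric r _ _ x))
lift-⊑ r s p q (suc i) (suc j) x = q i j x

-- The process never leaves the interval above `ρ`: every step that would separate elements related
-- by `ρ` has weight zero.
∑≥-cong : ∀ {n} t {ρ : BRel n} → IsEquiv ρ → ∀ {F G} → (∀ σ → ρ ⊑ ⟦ σ ⟧ → F σ ≡ G σ) → ∑≥ t ρ F ≡ ∑≥ t ρ G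
∑≥-cong {zero}  t r p = p _ (λ ())
∑≥-cong {suc n} t {ρ} r {F} {G} p = ∑≥-cong t (sub-equiv r) λ σ ρ≤σ →
  cong₂ ℤ._+_ (fresh≡ σ ρ≤σ) (ℤΣ.sum-cong-≗ (join≡ σ ρ≤σ))
  where
  fresh≡ : ∀ σ → sub ρ ⊑ ⟦ σ ⟧ → freshWeight ρ ℤ.* F (fresh σ) ≡ freshWeight ρ ℤ.* G (fresh σ)
  fresh≡ σ ρ≤σ with joined ρ in eq
  ... | true  = refl
  ... | false = cong (λ z → 1ℤ ℤ.* z) (p (fresh σ)
                  (lift-⊑ r (⟦⟧-equiv (fresh σ)) (λ k q → true≢false q (anyF-none eq k)) ρ≤σ))
  join≡ : ∀ σ → sub ρ ⊑ ⟦ σ ⟧ → ∀ j → joinWeight t ρ j ℤ.* F (join j σ) ≡ joinWeight t ρ j ℤ.* G (join j σ)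
  join≡ σ ρ≤σ j with joined ρ in eq
  ... | false = cong (λ z → t ℤ.* 𝟙 (greatest (sub ρ) j) ℤ.* z) (p (join j σ)
                  (lift-⊑ r (⟦⟧-equiv (join j σ)) (λ k q → true≢false q (anyF-none eq k)) ρ≤σ))
  ... | true with greatest (sub ρ) j ∧ ρ zero (suc j) in eq'
  ...   | false = refl
  ...   | true  = cong (λ z → 1ℤ ℤ.* z) (p (join j σ)
                    (lift-⊑ r (⟦⟧-equiv (join j σ)) (λ k q → ρ≤σ j k
                      (transitive r (suc j) zero (suc k) (symmetric r _ _ (∧-elimʳ {greatest (sub ρ) j} eq')) q)) ρ≤σ))

∑≥-cong′ : ∀ {n} t (ρ : BRel n) {F G} → (∀ σ → F σ ≡ G σ) → ∑≥ t ρ F ≡ ∑≥ t ρ G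
∑≥-cong′ {zero}  t ρ p = p _
∑≥-cong′ {suc n} t ρ p = ∑≥-cong′ t (sub ρ) λ σ →
  cong₂ (λ x y → freshWeight ρ ℤ.* x ℤ.+ y) (p (fresh σ))
        (ℤΣ.sum-cong-≗ λ j → cong (λ z → joinWeight t ρ j ℤ.* z) (p (join j σ)))

∑≥-+ : ∀ {n} t (ρ : BRel n) F G → ∑≥ t ρ (λ σ → F σ ℤ.+ G σ) ≡ ∑≥ t ρ F ℤ.+ ∑≥ t ρ G
∑≥-+ {zero}  t ρ F G = refl
∑≥-+ {suc n} t ρ F G = trans (∑≥-cong′ t (sub ρ) λ σ → begin
  w ℤ.* (F (fresh σ) ℤ.+ G (fresh σ)) ℤ.+ ∑ (λ j → v j ℤ.* (F (join j σ) ℤ.+ G (join j σ)))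
    ≡⟨ cong₂ ℤ._+_ (ℤ.*-distribˡ-+ w (F (fresh σ)) (G (fresh σ)))
        (trans (ℤΣ.sum-cong-≗ λ j → ℤ.*-distribˡ-+ (v j) (F (join j σ)) (G (join j σ)))
               (ℤΣ.∑-distrib-+ (λ j → v j ℤ.* F (join j σ)) (λ j → v j ℤ.* G (join j σ)))) ⟩
  (w ℤ.* F (fresh σ) ℤ.+ w ℤ.* G (fresh σ)) ℤ.+ (∑ (λ j → v j ℤ.* F (join j σ)) ℤ.+ ∑ (λ j → v j ℤ.* G (join j σ)))
    ≡⟨ medial (w ℤ.* F (fresh σ)) (w ℤ.* G (fresh σ)) (∑ (λ j → v j ℤ.* F (join j σ))) (∑ (λ j → v j ℤ.* G (join j σ))) ⟩
  extend t ρ F σ ℤ.+ extend t ρ G σ ∎)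
  (∑≥-+ t (sub ρ) (extend t ρ F) (extend t ρ G))
  where
  open ≡-Reasoning
  w = freshWeight ρ
  v = joinWeight t ρ
  medial : ∀ a b c d → (a ℤ.+ b) ℤ.+ (c ℤ.+ d) ≡ (a ℤ.+ c) ℤ.+ (b ℤ.+ d)
  medial = solve-∀

private
  x*[y*z]≡y*[x*z] : ∀ x y z → x ℤ.* (y ℤ.* z) ≡ y ℤ.* (x ℤ.* z)
  x*[y*z]≡y*[x*z] = solve-∀

∑≥-* : ∀ {n} t (ρ : BRel n) c F → ∑≥ t ρ (λ σ → c ℤ.* F σ) ≡ c ℤ.* ∑≥ t ρ F
∑≥-* {zero}  t ρ c F = refl
∑≥-* {suc n} t ρ c F = trans (∑≥-cong′ t (sub ρ) λ σ → begin
  w ℤ.* (c ℤ.* F (fresh σ)) ℤ.+ ∑ (λ j → v j ℤ.* (c ℤ.* F (join j σ)))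
    ≡⟨ cong₂ ℤ._+_ (x*[y*z]≡y*[x*z] w c (F (fresh σ)))
        (trans (ℤΣ.sum-cong-≗ λ j → x*[y*z]≡y*[x*z] (v j) c (F (join j σ)))
               (sym (ℤΣ.*-distribˡ-sum c (λ j → v j ℤ.* F (join j σ))))) ⟩
  c ℤ.* (w ℤ.* F (fresh σ)) ℤ.+ c ℤ.* ∑ (λ j → v j ℤ.* F (join j σ))
    ≡⟨ ℤ.*-distribˡ-+ c (w ℤ.* F (fresh σ)) (∑ (λ j → v j ℤ.* F (join j σ))) ⟨
  c ℤ.* extend t ρ F σ ∎)
  (∑≥-* t (sub ρ) c (extend t ρ F))
  where
  open ≡-Reasoning
  w = freshWeight ρ
  v = joinWeight t ρ

∑≥-0 : ∀ {n} t (ρ : BRel n) → ∑≥ t ρ (λ _ → 0ℤ) ≡ 0ℤ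
∑≥-0 t ρ = ∑≥-* t ρ 0ℤ (λ _ → 0ℤ)

∑≥-sum : ∀ {n} {A : Set} t (ρ : BRel n) (F : A → SetPartition n → ℤ) xs →
         ∑≥ t ρ (λ σ → sumℤ (λ a → F a σ) xs) ≡ sumℤ (λ a → ∑≥ t ρ (F a)) xs
∑≥-sum t ρ F []       = ∑≥-0 t ρ
∑≥-sum t ρ F (a ∷ as) = trans (∑≥-+ t ρ (F a) (λ σ → sumℤ (λ a → F a σ) as))
                              (cong (λ z → ∑≥ t ρ (F a) ℤ.+ z) (∑≥-sum t ρ F as))

-- The sum of the weights below R

boundedWeight : ∀ {n} → ℤ → BRel n → BRel n → ℤ
boundedWeight {zero}  t ρ R = 1ℤ
boundedWeight {suc n} t ρ R =
  (if joined ρ then 1ℤ else 1ℤ ℤ.+ t ℤ.* + cnt (λ j → greatest (sub ρ) j ∧ R zero (suc j)))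
  ℤ.* boundedWeight t (sub ρ) (sub R)

-- To stay below `R`, a new block of `ρ` is either kept apart or merged, with weight `t`, through
-- one of the earlier blocks of `ρ` in its block of `R`. The number of these choices does not depend
-- on the partition built so far, so the sum factors.
∑≥-bounded : ∀ {n} t {ρ R : BRel n} → IsEquiv ρ → IsEquiv R → ρ ⊑ R →
             ∑≥ t ρ (λ σ → 𝟙 (⟦ σ ⟧ ≤ᵇ R)) ≡ boundedWeight t ρ R
∑≥-bounded {zero}  t ρ≈ R≈ ρ≤R = refl
∑≥-bounded {suc n} t {ρ} {R} ρ≈ R≈ ρ≤R = begin
  ∑≥ t (sub ρ) (extend t ρ (λ σ → 𝟙 (⟦ σ ⟧ ≤ᵇ R)))
    ≡⟨ ∑≥-cong′ t (sub ρ) (λ σ → cong₂ (λ a b → w ℤ.* 𝟙 a ℤ.+ b) (fresh≤ σ) (ℤΣ.sum-cong-≗ (joins σ))) ⟩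
  ∑≥ t (sub ρ) (λ σ → w ℤ.* A σ ℤ.+ ∑ (λ j → A σ ℤ.* (v j ℤ.* 𝟙 (R zero (suc j)))))
    ≡⟨ ∑≥-cong′ t (sub ρ) (λ σ → trans (cong (λ z → w ℤ.* A σ ℤ.+ z) (sym (ℤΣ.*-distribˡ-sum (A σ) (λ j → v j ℤ.* 𝟙 (R zero (suc j))))))
        (factor w (A σ) V)) ⟩
  ∑≥ t (sub ρ) (λ σ → (w ℤ.+ V) ℤ.* A σ)
    ≡⟨ ∑≥-* t (sub ρ) (w ℤ.+ V) A ⟩
  (w ℤ.+ V) ℤ.* ∑≥ t (sub ρ) A
    ≡⟨ cong₂ ℤ._*_ total (∑≥-bounded t (sub-equiv ρ≈) (sub-equiv R≈) (λ i j → ρ≤R (suc i) (suc j))) ⟩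
  boundedWeight t ρ R ∎
  where
  open ≡-Reasoning
  w = freshWeight ρ
  v = joinWeight t ρ
  V = ∑ (λ j → v j ℤ.* 𝟙 (R zero (suc j)))
  A : SetPartition n → ℤ
  A σ = 𝟙 (⟦ σ ⟧ ≤ᵇ sub R)

  factor : ∀ w a v → w ℤ.* a ℤ.+ a ℤ.* v ≡ (w ℤ.+ v) ℤ.* a
  factor = solve-∀

  fresh≤ : ∀ σ → (⟦ fresh σ ⟧ ≤ᵇ R) ≡ (⟦ σ ⟧ ≤ᵇ sub R)
  fresh≤ σ = ≤ᵇ-ext (λ p i j → p (suc i) (suc j)) (lift-⊑ (⟦⟧-equiv (fresh σ)) R≈ λ k ())

  join≤ : ∀ σ j → (⟦ join j σ ⟧ ≤ᵇ R) ≡ (⟦ σ ⟧ ≤ᵇ sub R) ∧ R zero (suc j)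
  join≤ σ j = bool-ext
    (λ p → let q = ≤ᵇ-elim ⟦ join j σ ⟧ R p in
      ∧-intro (≤ᵇ-intro {R = ⟦ σ ⟧} λ i k → q (suc i) (suc k)) (q zero (suc j) (≡ᵇ-intro {σ j} refl)))
    (λ p → let q = ≤ᵇ-elim ⟦ σ ⟧ (sub R) (∧-elimˡ p) in
      ≤ᵇ-intro (lift-⊑ (⟦⟧-equiv (join j σ)) R≈
        (λ k s → transitive R≈ zero (suc j) (suc k) (∧-elimʳ {⟦ σ ⟧ ≤ᵇ sub R} p) (q j k s)) q))

  joins : ∀ σ j → v j ℤ.* 𝟙 (⟦ join j σ ⟧ ≤ᵇ R) ≡ A σ ℤ.* (v j ℤ.* 𝟙 (R zero (suc j)))
  joins σ j = trans (cong (λ z → v j ℤ.* z) (trans (cong 𝟙 (join≤ σ j)) (𝟙-∧ (⟦ σ ⟧ ≤ᵇ sub R) (R zero (suc j)))))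
                    (x*[y*z]≡y*[x*z] (v j) (A σ) (𝟙 (R zero (suc j))))

  absorb : ∀ a b → (a ≡ true → b ≡ true) → 𝟙 a ℤ.* 𝟙 b ≡ 𝟙 a
  absorb true  b p rewrite p refl = refl
  absorb false b p = refl

  total : w ℤ.+ V ≡ (if joined ρ then 1ℤ else 1ℤ ℤ.+ t ℤ.* + cnt (λ j → greatest (sub ρ) j ∧ R zero (suc j)))
  total with joined ρ in eq
  ... | true = trans (ℤ.+-identityˡ _) (begin
    ∑ (λ j → 𝟙 (greatest (sub ρ) j ∧ ρ zero (suc j)) ℤ.* 𝟙 (R zero (suc j)))
      ≡⟨ ℤΣ.sum-cong-≗ (λ j → absorb (greatest (sub ρ) j ∧ ρ zero (suc j)) (R zero (suc j))
          λ p → ρ≤R zero (suc j) (∧-elimʳ {greatest (sub ρ) j} p)) ⟩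
    ∑ (λ j → 𝟙 (greatest (sub ρ) j ∧ ρ zero (suc j))) ≡⟨ ∑-𝟙 (λ j → greatest (sub ρ) j ∧ ρ zero (suc j)) ⟩
    + cnt (λ j → greatest (sub ρ) j ∧ ρ zero (suc j)) ≡⟨ cong +_ (trans (cnt-greatest-joined ρ≈) (cong (λ b → if b then 1 else 0) eq)) ⟩
    1ℤ ∎)
  ... | false = cong (λ z → 1ℤ ℤ.+ z) (begin
    ∑ (λ j → t ℤ.* 𝟙 (greatest (sub ρ) j) ℤ.* 𝟙 (R zero (suc j)))
      ≡⟨ ℤΣ.sum-cong-≗ (λ j → trans (ℤ.*-assoc t (𝟙 (greatest (sub ρ) j)) (𝟙 (R zero (suc j))))
          (cong (λ z → t ℤ.* z) (sym (𝟙-∧ (greatest (sub ρ) j) (R zero (suc j)))))) ⟩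
    ∑ (λ j → t ℤ.* 𝟙 (greatest (sub ρ) j ∧ R zero (suc j)))
      ≡⟨ ℤΣ.*-distribˡ-sum t (λ j → 𝟙 (greatest (sub ρ) j ∧ R zero (suc j))) ⟨
    t ℤ.* ∑ (λ j → 𝟙 (greatest (sub ρ) j ∧ R zero (suc j)))
      ≡⟨ cong (λ z → t ℤ.* z) (∑-𝟙 (λ j → greatest (sub ρ) j ∧ R zero (suc j))) ⟩
    t ℤ.* + cnt (λ j → greatest (sub ρ) j ∧ R zero (suc j)) ∎)

-- Within one block of `R`, the blocks of `ρ` arrive one after another and contribute 1, 2, 3, ...,
-- which is the recursion of `blockFact-suc` with the maxima of `ρ` marked.
boundedWeight-1 : ∀ {n} (ρ : BRel n) {R : BRel n} → IsEquiv R →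
                  boundedWeight 1ℤ ρ R ≡ + blockFact (greatest ρ) R
boundedWeight-1 {zero}  ρ r = refl
boundedWeight-1 {suc n} ρ {R} r = begin
  f ℤ.* boundedWeight 1ℤ (sub ρ) (sub R)      ≡⟨ cong₂ ℤ._*_ (factor (joined ρ)) (boundedWeight-1 (sub ρ) (sub-equiv r)) ⟩
  + g ℤ.* + blockFact (greatest (sub ρ)) (sub R) ≡⟨ ℤ.pos-* g _ ⟨
  + (g ℕ.* blockFact (greatest (sub ρ)) (sub R)) ≡⟨ cong +_ (blockFact-suc (greatest ρ) r) ⟨
  + blockFact (greatest ρ) R ∎
  where
  open ≡-Reasoning
  c = cnt (λ j → greatest (sub ρ) j ∧ R zero (suc j))
  f = if joined ρ then 1ℤ else 1ℤ ℤ.+ 1ℤ ℤ.* + c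
  g = if not (joined ρ) then suc c else 1
  factor : ∀ b → (if b then 1ℤ else 1ℤ ℤ.+ 1ℤ ℤ.* + c) ≡ + (if not b then suc c else 1)
  factor true  = refl
  factor false = cong (λ z → 1ℤ ℤ.+ z) (ℤ.*-identityˡ (+ c))

-- When R and ρ agree on the later elements, a new block of ρ is merged by R
-- with at most one of their blocks, so its factor is 1 or 1 - 1 = 0.
boundedWeight--1 : ∀ {n} {ρ R : BRel n} → IsEquiv ρ → IsEquiv R → ρ ⊑ R →
                   boundedWeight ℤ.-1ℤ ρ R ≡ 𝟙 (R ≤ᵇ ρ)
boundedWeight--1 {zero}  ρ≈ R≈ ρ≤R = refl
boundedWeight--1 {suc n} {ρ} {R} ρ≈ R≈ ρ≤R =
  trans (cong (λ z → f (joined ρ) ℤ.* z) (boundedWeight--1 (sub-equiv ρ≈) (sub-equiv R≈) (λ i j → ρ≤R (suc i) (suc j))))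
        (step (sub R ≤ᵇ sub ρ) (joined ρ) refl refl)
  where
  c = cnt (λ j → greatest (sub ρ) j ∧ R zero (suc j))
  f : Bool → ℤ
  f b = if b then 1ℤ else 1ℤ ℤ.+ ℤ.-1ℤ ℤ.* + c
  step : ∀ a b → (sub R ≤ᵇ sub ρ) ≡ a → joined ρ ≡ b → f b ℤ.* 𝟙 a ≡ 𝟙 (R ≤ᵇ ρ)
  step false b p q = trans (ℤ.*-zeroʳ (f b)) (cong 𝟙 (sym (¬true λ s →
    true≢false (≤ᵇ-intro {R = sub R} {sub ρ} λ i j → ≤ᵇ-elim R ρ s (suc i) (suc j)) p)))
  step true true p q = cong 𝟙 (sym (≤ᵇ-intro (lift-⊑ R≈ ρ≈ zero-related sub≤)))
    where
    sub≤ = ≤ᵇ-elim (sub R) (sub ρ) p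
    zero-related : ∀ k → R zero (suc k) ≡ true → ρ zero (suc k) ≡ true
    zero-related k s with i , u ← anyF-elim q =
      transitive ρ≈ zero (suc i) (suc k) u
        (sub≤ i k (transitive R≈ (suc i) zero (suc k) (symmetric R≈ _ _ (ρ≤R zero (suc i) u)) s))
  step true false p q = trans (cong (λ k → (1ℤ ℤ.+ ℤ.-1ℤ ℤ.* + k) ℤ.* 1ℤ) merged)
                              (last (joined R) refl)
    where
    sub≤ = ≤ᵇ-elim (sub R) (sub ρ) p
    merged : c ≡ (if joined R then 1 else 0)
    merged = greatest-class (sub-equiv ρ≈) (λ j → R zero (suc j))
      (λ i j x y → sub≤ i j (transitive R≈ (suc i) zero (suc j) (symmetric R≈ _ _ x) y))
      (λ i j x y → transitive R≈ zero (suc i) (suc j) y (ρ≤R (suc i) (suc j) x))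
    last : ∀ d → joined R ≡ d → (1ℤ ℤ.+ ℤ.-1ℤ ℤ.* + (if d then 1 else 0)) ℤ.* 1ℤ ≡ 𝟙 (R ≤ᵇ ρ)
    last true  u = cong 𝟙 (sym (¬true λ s → let i , x = anyF-elim u in
      true≢false (≤ᵇ-elim R ρ s zero (suc i) x) (anyF-none q i)))
    last false u = cong 𝟙 (sym (≤ᵇ-intro (lift-⊑ R≈ ρ≈ (λ k s → true≢false s (anyF-none u k)) sub≤)))

-- A path from ρ to σ has weight t to the number of its merges, and each merge reverses the sign of
-- the partition. Replacing t = 1 by t = -1 therefore multiplies the weight of σ by sgn ρ sgn σ.
∑≥-sign : ∀ {n} (ρ : SetPartition n) F →
          ∑≥ ℤ.-1ℤ ⟦ ρ ⟧ F ≡ sgn ρ ℤ.* ∑≥ 1ℤ ⟦ ρ ⟧ (λ σ → sgn σ ℤ.* F σ)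
∑≥-sign {zero}  ρ F = sym (trans (ℤ.*-identityˡ _) (ℤ.*-identityˡ _))
∑≥-sign {suc n} ρ F = begin
  ∑≥ ℤ.-1ℤ ⟦ ρ ∘ suc ⟧ (extend ℤ.-1ℤ ⟦ ρ ⟧ F)
    ≡⟨ ∑≥-sign (ρ ∘ suc) (extend ℤ.-1ℤ ⟦ ρ ⟧ F) ⟩
  u ℤ.* ∑≥ 1ℤ ⟦ ρ ∘ suc ⟧ (λ σ → sgn σ ℤ.* extend ℤ.-1ℤ ⟦ ρ ⟧ F σ)
    ≡⟨ cong (λ z → u ℤ.* z) (∑≥-cong′ 1ℤ ⟦ ρ ∘ suc ⟧ term) ⟩
  u ℤ.* ∑≥ 1ℤ ⟦ ρ ∘ suc ⟧ (λ σ → s ℤ.* extend 1ℤ ⟦ ρ ⟧ G σ)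
    ≡⟨ cong (λ z → u ℤ.* z) (∑≥-* 1ℤ ⟦ ρ ∘ suc ⟧ s (extend 1ℤ ⟦ ρ ⟧ G)) ⟩
  u ℤ.* (s ℤ.* T) ≡⟨ x*[y*z]≡y*[x*z] u s T ⟩
  s ℤ.* (u ℤ.* T) ≡⟨ ℤ.*-assoc s u T ⟨
  (s ℤ.* u) ℤ.* T ≡⟨ cong (λ z → z ℤ.* T) (sgn-suc ρ) ⟨
  sgn ρ ℤ.* T ∎
  where
  open ≡-Reasoning
  G : SetPartition (suc n) → ℤ
  G σ = sgn σ ℤ.* F σ
  u = sgn (ρ ∘ suc)
  s = joinSign (joined ⟦ ρ ⟧)
  T = ∑≥ 1ℤ ⟦ ρ ∘ suc ⟧ (extend 1ℤ ⟦ ρ ⟧ G)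
  w = freshWeight ⟦ ρ ⟧
  v = joinWeight ℤ.-1ℤ ⟦ ρ ⟧
  v⁺ = joinWeight 1ℤ ⟦ ρ ⟧

  sgn-fresh : ∀ σ → sgn (fresh σ) ≡ sgn σ
  sgn-fresh σ = trans (sgn-suc (fresh σ)) (trans
    (cong (λ b → joinSign b ℤ.* sgn (fresh σ ∘ suc)) (anyF-false n))
    (trans (ℤ.*-identityˡ _) (sgn-cong {σ = fresh σ ∘ suc} {σ} λ _ _ → refl)))

  sgn-join : ∀ j σ → sgn (join j σ) ≡ ℤ.-1ℤ ℤ.* sgn σ
  sgn-join j σ = trans (sgn-suc (join j σ)) (cong (λ b → joinSign b ℤ.* sgn σ) (joined-join j σ))

  w-sign : w ≡ s ℤ.* w
  w-sign with joined ⟦ ρ ⟧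
  ... | true  = refl
  ... | false = refl

  -- `s` is the sign that ρ gains by including zero, and the final -1 is the one gained by
  -- `join j σ`. They cancel when ρ itself forces the join; otherwise the -1 remains and is the
  -- weight t.
  v-sign : ∀ j → v j ≡ s ℤ.* v⁺ j ℤ.* ℤ.-1ℤ
  v-sign j with joined ⟦ ρ ⟧ | 𝟙 (greatest (sub ⟦ ρ ⟧) j ∧ ⟦ ρ ⟧ zero (suc j)) | 𝟙 (greatest (sub ⟦ ρ ⟧) j)
  ... | true  | x | _ = lemma x
    where
    lemma : ∀ x → x ≡ ℤ.-1ℤ ℤ.* x ℤ.* ℤ.-1ℤ
    lemma = solve-∀
  ... | false | _ | x = lemma x
    where
    lemma : ∀ x → ℤ.-1ℤ ℤ.* x ≡ 1ℤ ℤ.* (1ℤ ℤ.* x) ℤ.* ℤ.-1ℤ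
    lemma = solve-∀

  rearrange : ∀ s v a f → a ℤ.* (s ℤ.* v ℤ.* ℤ.-1ℤ ℤ.* f) ≡ s ℤ.* (v ℤ.* (ℤ.-1ℤ ℤ.* a ℤ.* f))
  rearrange = solve-∀

  rearrange′ : ∀ s w a f → a ℤ.* (s ℤ.* w ℤ.* f) ≡ s ℤ.* (w ℤ.* (a ℤ.* f))
  rearrange′ = solve-∀

  term : ∀ σ → sgn σ ℤ.* extend ℤ.-1ℤ ⟦ ρ ⟧ F σ ≡ s ℤ.* extend 1ℤ ⟦ ρ ⟧ G σ
  term σ = begin
    a ℤ.* (w ℤ.* F (fresh σ) ℤ.+ ∑ (λ j → v j ℤ.* F (join j σ)))
      ≡⟨ ℤ.*-distribˡ-+ a (w ℤ.* F (fresh σ)) (∑ (λ j → v j ℤ.* F (join j σ))) ⟩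
    a ℤ.* (w ℤ.* F (fresh σ)) ℤ.+ a ℤ.* ∑ (λ j → v j ℤ.* F (join j σ))
      ≡⟨ cong₂ ℤ._+_
          (trans (cong (λ z → a ℤ.* (z ℤ.* F (fresh σ))) w-sign)
            (trans (rearrange′ s w a (F (fresh σ))) (cong (λ z → s ℤ.* (w ℤ.* (z ℤ.* F (fresh σ)))) (sym (sgn-fresh σ)))))
          (trans (ℤΣ.*-distribˡ-sum a (λ j → v j ℤ.* F (join j σ)))
            (trans (ℤΣ.sum-cong-≗ λ j → trans (cong (λ z → a ℤ.* (z ℤ.* F (join j σ))) (v-sign j))
                     (trans (rearrange s (v⁺ j) a (F (join j σ))) (cong (λ z → s ℤ.* (v⁺ j ℤ.* (z ℤ.* F (join j σ)))) (sym (sgn-join j σ)))))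
              (sym (ℤΣ.*-distribˡ-sum s (λ j → v⁺ j ℤ.* G (join j σ)))))) ⟩
    s ℤ.* (w ℤ.* G (fresh σ)) ℤ.+ s ℤ.* ∑ (λ j → v⁺ j ℤ.* G (join j σ))
      ≡⟨ ℤ.*-distribˡ-+ s (w ℤ.* G (fresh σ)) (∑ (λ j → v⁺ j ℤ.* G (join j σ))) ⟨
    s ℤ.* extend 1ℤ ⟦ ρ ⟧ G σ ∎
    where a = sgn σ

-- Positivity

Natural : ℤ → Set
Natural z = ∃[ k ] z ≡ + k

Positive : ℤ → Set
Positive z = ∃[ k ] z ≡ + suc k

natural-+ : ∀ {x y} → Natural x → Natural y → Natural (x ℤ.+ y)
natural-+ (j , refl) (k , refl) = j ℕ.+ k , refl

natural-* : ∀ {x y} → Natural x → Natural y → Natural (x ℤ.* y)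
natural-* (j , refl) (k , refl) = j ℕ.* k , sym (ℤ.pos-* j k)

positive-+ˡ : ∀ {x y} → Positive x → Natural y → Positive (x ℤ.+ y)
positive-+ˡ (j , refl) (k , refl) = j ℕ.+ k , refl

positive-+ʳ : ∀ {x y} → Natural x → Positive y → Positive (x ℤ.+ y)
positive-+ʳ {x} {y} p q = subst Positive (ℤ.+-comm y x) (positive-+ˡ q p)

natural-𝟙 : ∀ b → Natural (𝟙 b)
natural-𝟙 true  = 1 , refl
natural-𝟙 false = 0 , refl

natural-∑ : ∀ {n} {f : Fin n → ℤ} → (∀ i → Natural (f i)) → Natural (∑ f)
natural-∑ {zero}  p = 0 , refl
natural-∑ {suc n} p = natural-+ (p zero) (natural-∑ (p ∘ suc))

positive-∑ : ∀ {n} {f : Fin n → ℤ} → (∀ i → Natural (f i)) → ∀ i → Positive (f i) → Positive (∑ f)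
positive-∑ p zero    q = positive-+ˡ q (natural-∑ (p ∘ suc))
positive-∑ p (suc i) q = positive-+ʳ (p zero) (positive-∑ (p ∘ suc) i q)

module _ {n} (ρ : BRel (suc n)) {F : SetPartition (suc n) → ℤ} (p : ∀ σ → Natural (F σ)) (σ : SetPartition n) where

  natural-fresh : Natural (freshWeight ρ ℤ.* F (fresh σ))
  natural-fresh with joined ρ
  ... | true  = 0 , refl
  ... | false = natural-* (1 , refl) (p (fresh σ))

  natural-join : ∀ j → Natural (joinWeight 1ℤ ρ j ℤ.* F (join j σ))
  natural-join j with joined ρ
  ... | true  = natural-* (natural-𝟙 (greatest (sub ρ) j ∧ ρ zero (suc j))) (p (join j σ))
  ... | false = natural-* (natural-* (1 , refl) (natural-𝟙 (greatest (sub ρ) j))) (p (join j σ))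

  natural-extend : Natural (extend 1ℤ ρ F σ)
  natural-extend = natural-+ natural-fresh (natural-∑ natural-join)

greatest-𝟘̂ : ∀ {n} (j : Fin n) → greatest ⟦ 𝟘̂ ⟧ j ≡ true
greatest-𝟘̂ {suc n} zero    = cong not (anyF-false n)
greatest-𝟘̂ {suc n} (suc j) = greatest-𝟘̂ j

lift-≗ : ∀ {n} {R S : BRel (suc n)} → IsEquiv R → IsEquiv S →
         (∀ k → R zero (suc k) ≡ S zero (suc k)) → sub R ≗₂ sub S → R ≗₂ S
lift-≗ r s p q = ⊑-antisym (lift-⊑ r s (λ k → trans (sym (p k))) (≗₂⇒⊑ q))
                           (lift-⊑ s r (λ k → trans (p k)) (≗₂⇒⊒ q))

-- No term is negative, so it suffices to follow one path to τ. Above the bottom every element is a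
-- block maximum, hence zero can be joined with weight 1 to any element of its block in τ, or be
-- kept apart if it is alone there.
positive-∑≥ : ∀ {n} (τ : SetPartition n) {F : SetPartition n → ℤ} → (∀ σ → Natural (F σ)) →
              (∀ σ → ⟦ σ ⟧ ≗₂ ⟦ τ ⟧ → Positive (F σ)) → Positive (∑≥ 1ℤ ⟦ 𝟘̂ ⟧ F)
positive-∑≥ {zero}  τ p q = q _ λ ()
positive-∑≥ {suc n} τ {F} p q = positive-∑≥ (τ ∘ suc) (natural-extend ⟦ 𝟘̂ ⟧ p) step
  where
  step : ∀ σ → ⟦ σ ⟧ ≗₂ ⟦ τ ∘ suc ⟧ → Positive (extend 1ℤ ⟦ 𝟘̂ ⟧ F σ)
  step σ σ≗τ with joined ⟦ τ ⟧ in eq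
  ... | true with j , u ← anyF-elim eq =
    positive-+ʳ (natural-fresh ⟦ 𝟘̂ ⟧ p σ) (positive-∑ (natural-join ⟦ 𝟘̂ ⟧ p σ) j positive-join)
    where
    weight : joinWeight 1ℤ ⟦ 𝟘̂ ⟧ j ≡ 1ℤ
    weight = trans (cong (λ b → if b then 𝟙 (greatest ⟦ 𝟘̂ ⟧ j ∧ false) else 1ℤ ℤ.* 𝟙 (greatest ⟦ 𝟘̂ ⟧ j)) (anyF-false n))
                   (cong (λ b → 1ℤ ℤ.* 𝟙 b) (greatest-𝟘̂ j))
    positive-join : Positive (joinWeight 1ℤ ⟦ 𝟘̂ ⟧ j ℤ.* F (join j σ))
    positive-join = subst Positive (sym (trans (cong (λ z → z ℤ.* F (join j σ)) weight) (ℤ.*-identityˡ _)))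
      (q (join j σ) (lift-≗ (⟦⟧-equiv (join j σ)) (⟦⟧-equiv τ)
        (λ k → trans (σ≗τ j k) (sym (class-≡ (⟦⟧-equiv τ) zero (suc j) u (suc k)))) σ≗τ))
  ... | false = positive-+ˡ positive-fresh (natural-∑ (natural-join ⟦ 𝟘̂ ⟧ p σ))
    where
    positive-fresh : Positive (freshWeight {n} ⟦ 𝟘̂ ⟧ ℤ.* F (fresh σ))
    positive-fresh = subst Positive (sym (trans (cong (λ b → (if b then 0ℤ else 1ℤ) ℤ.* F (fresh σ)) (anyF-false n)) (ℤ.*-identityˡ _)))
      (q (fresh σ) (lift-≗ (⟦⟧-equiv (fresh σ)) (⟦⟧-equiv τ) (λ k → sym (anyF-none eq k)) σ≗τ))

-- The Möbius function

weight : ∀ {n} → ℤ → BRel n → SetPartition n → ℤ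
weight t ρ τ = ∑≥ t ρ (λ σ → 𝟙 (⟦ σ ⟧ ≐ᵇ ⟦ τ ⟧))

-- This trades a sum over the enumeration for a merging sum, which does recurse on n. Each outcome
-- of the process is collected by the one listed partition with the same kernel.
weight-expand : ∀ {n} t (ρ : BRel n) F → (∀ σ τ → ⟦ σ ⟧ ≗₂ ⟦ τ ⟧ → F σ ≡ F τ) →
                sumℤ (λ τ → weight t ρ τ ℤ.* F τ) (allPartitions n) ≡ ∑≥ t ρ F
weight-expand {n} t ρ F F-cong = begin
  sumℤ (λ τ → weight t ρ τ ℤ.* F τ) (allPartitions n)
    ≡⟨ ℤL.sum-cong (allPartitions n) (λ τ → trans (ℤ.*-comm (weight t ρ τ) (F τ)) (sym (∑≥-* t ρ (F τ) (λ σ → 𝟙 (⟦ σ ⟧ ≐ᵇ ⟦ τ ⟧))))) ⟩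
  sumℤ (λ τ → ∑≥ t ρ (λ σ → F τ ℤ.* 𝟙 (⟦ σ ⟧ ≐ᵇ ⟦ τ ⟧))) (allPartitions n)
    ≡⟨ ∑≥-sum t ρ (λ τ σ → F τ ℤ.* 𝟙 (⟦ σ ⟧ ≐ᵇ ⟦ τ ⟧)) (allPartitions n) ⟨
  ∑≥ t ρ (λ σ → sumℤ (λ τ → F τ ℤ.* 𝟙 (⟦ σ ⟧ ≐ᵇ ⟦ τ ⟧)) (allPartitions n))
    ≡⟨ ∑≥-cong′ t ρ (λ σ → ℤL.sum-partition σ
        (λ τ p → trans (cong (λ b → F τ ℤ.* 𝟙 b) (≐ᵇ-intro (≗₂-sym p))) (trans (ℤ.*-identityʳ (F τ)) (F-cong τ σ p)))
        (λ τ p → trans (cong (λ b → F τ ℤ.* 𝟙 b) (trans (≐ᵇ-sym ⟦ σ ⟧ ⟦ τ ⟧) p)) (ℤ.*-zeroʳ (F τ)))) ⟩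
  ∑≥ t ρ F ∎
  where open ≡-Reasoning

weight-support : ∀ {n} t (ρ π : SetPartition n) → (⟦ ρ ⟧ ≤ᵇ ⟦ π ⟧) ≡ false → weight t ⟦ ρ ⟧ π ≡ 0ℤ
weight-support t ρ π p = trans
  (∑≥-cong t (⟦⟧-equiv ρ) λ σ ρ≤σ → cong 𝟙 (¬true λ q →
    true≢false (≤ᵇ-intro {R = ⟦ ρ ⟧} {⟦ π ⟧} (⊑-trans ρ≤σ (≗₂⇒⊑ (≐ᵇ-elim ⟦ σ ⟧ ⟦ π ⟧ q)))) p))
  (∑≥-0 t ⟦ ρ ⟧)

≤ᵇ-congˡ : ∀ {n} (R : BRel n) σ τ → ⟦ σ ⟧ ≗₂ ⟦ τ ⟧ → 𝟙 (⟦ σ ⟧ ≤ᵇ R) ≡ 𝟙 (⟦ τ ⟧ ≤ᵇ R)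
≤ᵇ-congˡ R σ τ p = cong 𝟙 (≤ᵇ-cong p λ _ _ → refl)

∑≥-≤ : ∀ {n} t (ρ : SetPartition n) {R : BRel n} → IsEquiv R →
       ∑≥ t ⟦ ρ ⟧ (λ σ → 𝟙 (⟦ σ ⟧ ≤ᵇ R)) ≡ 𝟙 (⟦ ρ ⟧ ≤ᵇ R) ℤ.* boundedWeight t ⟦ ρ ⟧ R
∑≥-≤ t ρ {R} r with ⟦ ρ ⟧ ≤ᵇ R in eq
... | true  = trans (∑≥-bounded t (⟦⟧-equiv ρ) r (≤ᵇ-elim ⟦ ρ ⟧ R eq)) (sym (ℤ.*-identityˡ _))
... | false = trans (∑≥-cong t (⟦⟧-equiv ρ) λ σ ρ≤σ → cong 𝟙 (¬true λ q →
                       true≢false (≤ᵇ-intro {R = ⟦ ρ ⟧} {R} (⊑-trans ρ≤σ (≤ᵇ-elim ⟦ σ ⟧ R q))) eq))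
                    (∑≥-0 t ⟦ ρ ⟧)

-- Read through `weight-expand`, this is the identity that characterises the Möbius function, now
-- for the weights at t = -1.
∑≥--1 : ∀ {n} (ρ : SetPartition n) {R : BRel n} → IsEquiv R →
        ∑≥ ℤ.-1ℤ ⟦ ρ ⟧ (λ σ → 𝟙 (⟦ σ ⟧ ≤ᵇ R)) ≡ 𝟙 (⟦ ρ ⟧ ≐ᵇ R)
∑≥--1 ρ {R} r = trans (∑≥-≤ ℤ.-1ℤ ρ r) (trans (step (⟦ ρ ⟧ ≤ᵇ R) refl) (sym (𝟙-∧ (⟦ ρ ⟧ ≤ᵇ R) (R ≤ᵇ ⟦ ρ ⟧))))
  where
  step : ∀ b → (⟦ ρ ⟧ ≤ᵇ R) ≡ b → 𝟙 b ℤ.* boundedWeight ℤ.-1ℤ ⟦ ρ ⟧ R ≡ 𝟙 b ℤ.* 𝟙 (R ≤ᵇ ⟦ ρ ⟧)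
  step true  eq = cong (λ z → 1ℤ ℤ.* z) (boundedWeight--1 (⟦⟧-equiv ρ) r (≤ᵇ-elim ⟦ ρ ⟧ R eq))
  step false eq = refl

-- The number of blocks as a measure for descent in the lattice

blocks : ∀ {n} → BRel n → ℕ
blocks R = cnt (greatest R)

blocks≤n : ∀ {n} (R : BRel n) → blocks R ℕ.≤ n
blocks≤n {zero}  R = ℕ.z≤n
blocks≤n {suc n} R with joined R
... | true  = ℕ.m≤n⇒m≤1+n (blocks≤n (sub R))
... | false = ℕ.s≤s (blocks≤n (sub R))

blocks-anti : ∀ {n} {R S : BRel n} → R ⊑ S → blocks S ℕ.≤ blocks R
blocks-anti {zero}  p = ℕ.z≤n
blocks-anti {suc n} {R} {S} p = ℕ.+-mono-≤ first (blocks-anti λ i j → p (suc i) (suc j))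
  where
  first : (if not (joined S) then 1 else 0) ℕ.≤ (if not (joined R) then 1 else 0)
  first with joined R in r | joined S in s
  ... | true  | true  = ℕ.≤-refl
  ... | true  | false = let i , q = anyF-elim r in true≢false (anyF-intro i (p zero (suc i) q)) s
  ... | false | true  = ℕ.z≤n
  ... | false | false = ℕ.≤-refl

-- If `S` joined zero to a later element and `R` did not, `S` would be one block behind on zero and
-- could not catch up, since `sub S` has at most as many blocks as `sub R`. Contrapositively, a
-- strict coarsening loses a block, which drives the inductions below.
blocks-reflects : ∀ {n} {R S : BRel n} → IsEquiv R → IsEquiv S → R ⊑ S → blocks R ℕ.≤ blocks S → S ⊑ R
blocks-reflects {zero}  r s p q ()
blocks-reflects {suc n} {R} {S} r s p q = lift-⊑ s r zero-related sub≤
  where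
  sub≤ : sub S ⊑ sub R
  sub≤ = blocks-reflects (sub-equiv r) (sub-equiv s) (λ i j → p (suc i) (suc j)) (drop q)
    where
    drop : blocks R ℕ.≤ blocks S → blocks (sub R) ℕ.≤ blocks (sub S)
    drop q with joined R in x | joined S in y
    ... | true  | true  = q
    ... | true  | false = let i , u = anyF-elim x in true≢false (anyF-intro i (p zero (suc i) u)) y
    ... | false | true  = ℕ.<⇒≤ q
    ... | false | false = ℕ.≤-pred q
  joined-R : ∀ {k} → S zero (suc k) ≡ true → joined R ≡ true
  joined-R {k} u with joined R in x
  ... | true  = refl
  ... | false = contradiction (ℕ.≤-trans q′ (blocks-anti {R = sub R} {sub S} λ i j → p (suc i) (suc j))) ℕ.1+n≰n
    where
    q′ : suc (blocks (sub R)) ℕ.≤ blocks (sub S)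
    q′ = subst (λ b → suc (blocks (sub R)) ℕ.≤ (if not b then 1 else 0) ℕ.+ blocks (sub S))
               (anyF-intro {f = λ j → S zero (suc j)} k u) q
  zero-related : ∀ k → S zero (suc k) ≡ true → R zero (suc k) ≡ true
  zero-related k u with i , v ← anyF-elim (joined-R u) =
    transitive r zero (suc i) (suc k) v
      (sub≤ i k (transitive s (suc i) zero (suc k) (symmetric s _ _ (p zero (suc i) v)) u))

-- The weights satisfy the recursion that defines μ. Each call replaces π by some τ strictly below
-- it, which has more blocks, so one unit of fuel pays for one block. With no fuel left, ρ below π
-- forces ρ = π, and the default value 0 is never returned in error.
möbius≡weight : ∀ {n} k (ρ π : SetPartition n) → blocks ⟦ ρ ⟧ ℕ.≤ blocks ⟦ π ⟧ ℕ.+ k →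
                möbius k ρ π ≡ weight ℤ.-1ℤ ⟦ ρ ⟧ π
möbius≡weight {n} k ρ π fuel = step k fuel (⟦ ρ ⟧ ≐ᵇ ⟦ π ⟧) (⟦ ρ ⟧ ≤ᵇ ⟦ π ⟧) refl refl
  where
  open ≡-Reasoning
  strict : SetPartition n → Bool
  strict τ = (⟦ ρ ⟧ ≤ᵇ ⟦ τ ⟧) ∧ (⟦ τ ⟧ ≤ᵇ ⟦ π ⟧) ∧ not (⟦ τ ⟧ ≐ᵇ ⟦ π ⟧)
  V : SetPartition n → ℤ
  V = weight ℤ.-1ℤ ⟦ ρ ⟧
  rest : ℤ
  rest = sumℤ (λ τ → if strict τ then V τ else 0ℤ) (allPartitions n)

  -- The recursion for μ sums over ρ ≤ τ < π only. The remaining τ below π may be included because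
  -- their weight is zero.
  split : ∀ τ → V τ ℤ.* 𝟙 (⟦ τ ⟧ ≤ᵇ ⟦ π ⟧) ≡ V τ ℤ.* 𝟙 (⟦ τ ⟧ ≐ᵇ ⟦ π ⟧) ℤ.+ (if strict τ then V τ else 0ℤ)
  split τ = go (⟦ ρ ⟧ ≤ᵇ ⟦ τ ⟧) (⟦ τ ⟧ ≤ᵇ ⟦ π ⟧) (⟦ π ⟧ ≤ᵇ ⟦ τ ⟧) (weight-support ℤ.-1ℤ ρ τ)
    where
    go : ∀ a b c {v} → (a ≡ false → v ≡ 0ℤ) →
         v ℤ.* 𝟙 b ≡ v ℤ.* 𝟙 (b ∧ c) ℤ.+ (if a ∧ b ∧ not (b ∧ c) then v else 0ℤ)
    go false b c p rewrite p refl = refl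
    go true false c {v} p = sym (ℤ.+-identityʳ (v ℤ.* 0ℤ))
    go true true true {v} p = sym (ℤ.+-identityʳ (v ℤ.* 1ℤ))
    go true true false {v} p = trans (ℤ.*-identityʳ v) (sym (trans (cong (λ z → z ℤ.+ v) (ℤ.*-zeroʳ v)) (ℤ.+-identityˡ v)))

  total : 𝟙 (⟦ ρ ⟧ ≐ᵇ ⟦ π ⟧) ≡ V π ℤ.+ rest
  total = begin
    𝟙 (⟦ ρ ⟧ ≐ᵇ ⟦ π ⟧) ≡⟨ ∑≥--1 ρ (⟦⟧-equiv π) ⟨
    ∑≥ ℤ.-1ℤ ⟦ ρ ⟧ (λ σ → 𝟙 (⟦ σ ⟧ ≤ᵇ ⟦ π ⟧)) ≡⟨ weight-expand ℤ.-1ℤ ⟦ ρ ⟧ _ (≤ᵇ-congˡ ⟦ π ⟧) ⟨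
    sumℤ (λ τ → V τ ℤ.* 𝟙 (⟦ τ ⟧ ≤ᵇ ⟦ π ⟧)) (allPartitions n)
      ≡⟨ ℤL.sum-cong (allPartitions n) split ⟩
    sumℤ (λ τ → V τ ℤ.* 𝟙 (⟦ τ ⟧ ≐ᵇ ⟦ π ⟧) ℤ.+ (if strict τ then V τ else 0ℤ)) (allPartitions n)
      ≡⟨ ℤL.sum-+ (λ τ → V τ ℤ.* 𝟙 (⟦ τ ⟧ ≐ᵇ ⟦ π ⟧)) (λ τ → if strict τ then V τ else 0ℤ) (allPartitions n) ⟩
    sumℤ (λ τ → V τ ℤ.* 𝟙 (⟦ τ ⟧ ≐ᵇ ⟦ π ⟧)) (allPartitions n) ℤ.+ rest
      ≡⟨ cong (λ z → z ℤ.+ rest) (weight-expand ℤ.-1ℤ ⟦ ρ ⟧ (λ τ → 𝟙 (⟦ τ ⟧ ≐ᵇ ⟦ π ⟧))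
          λ σ τ p → cong 𝟙 (≐ᵇ-cong p λ _ _ → refl)) ⟩
    V π ℤ.+ rest ∎

  step : ∀ k → blocks ⟦ ρ ⟧ ℕ.≤ blocks ⟦ π ⟧ ℕ.+ k → ∀ b c → (⟦ ρ ⟧ ≐ᵇ ⟦ π ⟧) ≡ b → (⟦ ρ ⟧ ≤ᵇ ⟦ π ⟧) ≡ c →
         möbiusWith n k ρ π b c ≡ V π
  step k fuel true c p q = begin
    1ℤ               ≡⟨ cong 𝟙 p ⟨
    𝟙 (⟦ ρ ⟧ ≐ᵇ ⟦ π ⟧) ≡⟨ total ⟩
    V π ℤ.+ rest     ≡⟨ cong (λ z → V π ℤ.+ z) (ℤL.sum-0 (All.universal (λ τ → cong (λ b → if b then V τ else 0ℤ) (empty τ)) (allPartitions n))) ⟩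
    V π ℤ.+ 0ℤ       ≡⟨ ℤ.+-identityʳ (V π) ⟩
    V π ∎
    where
    empty : ∀ τ → strict τ ≡ false
    empty τ = ¬true λ s →
      let ρ≤τ = ≤ᵇ-elim ⟦ ρ ⟧ ⟦ τ ⟧ (∧-elimˡ s)
          s′ = ∧-elimʳ {⟦ ρ ⟧ ≤ᵇ ⟦ τ ⟧} s
          τ≤π = ≤ᵇ-elim ⟦ τ ⟧ ⟦ π ⟧ (∧-elimˡ s′)
          π≤τ = ⊑-trans (≗₂⇒⊒ (≐ᵇ-elim ⟦ ρ ⟧ ⟦ π ⟧ p)) ρ≤τ
      in true≢false (∧-elimʳ {⟦ τ ⟧ ≤ᵇ ⟦ π ⟧} s′) (cong not (≐ᵇ-intro (⊑-antisym τ≤π π≤τ)))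
  step k fuel false false p q = sym (weight-support ℤ.-1ℤ ρ π q)
  step zero fuel false true p q = true≢false (≐ᵇ-intro (⊑-antisym ρ≤π
    (blocks-reflects (⟦⟧-equiv ρ) (⟦⟧-equiv π) ρ≤π (subst (blocks ⟦ ρ ⟧ ℕ.≤_) (ℕ.+-identityʳ _) fuel)))) p
    where ρ≤π = ≤ᵇ-elim ⟦ ρ ⟧ ⟦ π ⟧ q
  step (suc k) fuel false true p q = begin
    - sumℤ (λ τ → if strict τ then möbius k ρ τ else 0ℤ) (allPartitions n)
      ≡⟨ cong -_ (ℤL.sum-cong (allPartitions n) (λ τ → recurse τ (strict τ) refl)) ⟩
    - rest ≡⟨ ℤ.+-identityˡ (- rest) ⟨
    0ℤ ℤ.+ - rest ≡⟨ cong (λ z → z ℤ.+ - rest) (trans (sym (cong 𝟙 p)) total) ⟩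
    V π ℤ.+ rest ℤ.+ - rest ≡⟨ cancel (V π) rest ⟩
    V π ∎
    where
    cancel : ∀ v r → v ℤ.+ r ℤ.+ - r ≡ v
    cancel = solve-∀
    recurse : ∀ τ b → strict τ ≡ b → (if b then möbius k ρ τ else 0ℤ) ≡ (if b then V τ else 0ℤ)
    recurse τ false s = refl
    recurse τ true  s = möbius≡weight k ρ τ (ℕ.≤-trans fuel
      (subst (ℕ._≤ blocks ⟦ τ ⟧ ℕ.+ k) (sym (ℕ.+-suc (blocks ⟦ π ⟧) k)) (ℕ.+-monoˡ-≤ k (ℕ.≰⇒> λ t≤p →
        let s′ = ∧-elimʳ {⟦ ρ ⟧ ≤ᵇ ⟦ τ ⟧} s
            τ≤π = ≤ᵇ-elim ⟦ τ ⟧ ⟦ π ⟧ (∧-elimˡ s′)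
        in true≢false (∧-elimʳ {⟦ τ ⟧ ≤ᵇ ⟦ π ⟧} s′)
             (cong not (≐ᵇ-intro (⊑-antisym τ≤π (blocks-reflects (⟦⟧-equiv τ) (⟦⟧-equiv π) τ≤π t≤p))))))))

μ≡weight : ∀ {n} (ρ π : SetPartition n) → μ ρ π ≡ weight ℤ.-1ℤ ⟦ ρ ⟧ π
μ≡weight {n} ρ π = möbius≡weight n ρ π (ℕ.≤-trans (blocks≤n ⟦ ρ ⟧) (ℕ.m≤n+m n (blocks ⟦ π ⟧)))

μ-support : ∀ {n} (ρ π : SetPartition n) → (⟦ ρ ⟧ ≤ᵇ ⟦ π ⟧) ≡ false → μ ρ π ≡ 0ℤ
μ-support ρ π p = trans (μ≡weight ρ π) (weight-support ℤ.-1ℤ ρ π p)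

μ-cong : ∀ {n} (ρ σ τ : SetPartition n) → ⟦ σ ⟧ ≗₂ ⟦ τ ⟧ → μ ρ σ ≡ μ ρ τ
μ-cong ρ σ τ p = trans (μ≡weight ρ σ) (trans
  (∑≥-cong′ ℤ.-1ℤ ⟦ ρ ⟧ λ υ → cong 𝟙 (≐ᵇ-cong {R = ⟦ υ ⟧} (λ _ _ → refl) p)) (sym (μ≡weight ρ τ)))

∑μ : ∀ {n} (ρ : SetPartition n) {R : BRel n} → IsEquiv R →
     sumℤ (λ τ → μ ρ τ ℤ.* 𝟙 (⟦ τ ⟧ ≤ᵇ R)) (allPartitions n) ≡ 𝟙 (⟦ ρ ⟧ ≐ᵇ R)
∑μ {n} ρ {R} r = begin
  sumℤ (λ τ → μ ρ τ ℤ.* 𝟙 (⟦ τ ⟧ ≤ᵇ R)) (allPartitions n)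
    ≡⟨ ℤL.sum-cong (allPartitions n) (λ τ → cong (λ z → z ℤ.* 𝟙 (⟦ τ ⟧ ≤ᵇ R)) (μ≡weight ρ τ)) ⟩
  sumℤ (λ τ → weight ℤ.-1ℤ ⟦ ρ ⟧ τ ℤ.* 𝟙 (⟦ τ ⟧ ≤ᵇ R)) (allPartitions n)
    ≡⟨ weight-expand ℤ.-1ℤ ⟦ ρ ⟧ _ (≤ᵇ-congˡ R) ⟩
  ∑≥ ℤ.-1ℤ ⟦ ρ ⟧ (λ σ → 𝟙 (⟦ σ ⟧ ≤ᵇ R)) ≡⟨ ∑≥--1 ρ r ⟩
  𝟙 (⟦ ρ ⟧ ≐ᵇ R) ∎
  where open ≡-Reasoning

sgn-cancel : ∀ {n} (σ : SetPartition n) z → sgn σ ℤ.* (sgn σ ℤ.* z) ≡ z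
sgn-cancel σ z = trans (sym (ℤ.*-assoc (sgn σ) (sgn σ) z))
  (trans (cong (λ s → s ℤ.* z) (sgn-square σ)) (ℤ.*-identityˡ z))

∑μ-sgn : ∀ {n} (ρ : SetPartition n) {R : BRel n} → IsEquiv R →
  sumℤ (λ τ → μ ρ τ ℤ.* (sgn τ ℤ.* 𝟙 (⟦ τ ⟧ ≤ᵇ R))) (allPartitions n)
  ≡ sgn ρ ℤ.* (𝟙 (⟦ ρ ⟧ ≤ᵇ R) ℤ.* + blockFact (greatest ⟦ ρ ⟧) R)
∑μ-sgn {n} ρ {R} r = begin
  sumℤ (λ τ → μ ρ τ ℤ.* F τ) (allPartitions n)
    ≡⟨ ℤL.sum-cong (allPartitions n) (λ τ → cong (λ z → z ℤ.* F τ) (μ≡weight ρ τ)) ⟩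
  sumℤ (λ τ → weight ℤ.-1ℤ ⟦ ρ ⟧ τ ℤ.* F τ) (allPartitions n)
    ≡⟨ weight-expand ℤ.-1ℤ ⟦ ρ ⟧ F (λ σ τ p → cong₂ ℤ._*_ (sgn-cong {σ = σ} {τ} p) (≤ᵇ-congˡ R σ τ p)) ⟩
  ∑≥ ℤ.-1ℤ ⟦ ρ ⟧ F ≡⟨ ∑≥-sign ρ F ⟩
  sgn ρ ℤ.* ∑≥ 1ℤ ⟦ ρ ⟧ (λ σ → sgn σ ℤ.* F σ)
    ≡⟨ cong (λ z → sgn ρ ℤ.* z) (begin
      ∑≥ 1ℤ ⟦ ρ ⟧ (λ σ → sgn σ ℤ.* F σ) ≡⟨ ∑≥-cong′ 1ℤ ⟦ ρ ⟧ (λ σ → sgn-cancel σ (𝟙 (⟦ σ ⟧ ≤ᵇ R))) ⟩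
      ∑≥ 1ℤ ⟦ ρ ⟧ (λ σ → 𝟙 (⟦ σ ⟧ ≤ᵇ R)) ≡⟨ ∑≥-≤ 1ℤ ρ r ⟩
      𝟙 (⟦ ρ ⟧ ≤ᵇ R) ℤ.* boundedWeight 1ℤ ⟦ ρ ⟧ R ≡⟨ cong (λ z → 𝟙 (⟦ ρ ⟧ ≤ᵇ R) ℤ.* z) (boundedWeight-1 ⟦ ρ ⟧ r) ⟩
      𝟙 (⟦ ρ ⟧ ≤ᵇ R) ℤ.* + blockFact (greatest ⟦ ρ ⟧) R ∎) ⟩
  sgn ρ ℤ.* (𝟙 (⟦ ρ ⟧ ≤ᵇ R) ℤ.* + blockFact (greatest ⟦ ρ ⟧) R) ∎
  where
  open ≡-Reasoning
  F : SetPartition n → ℤ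
  F τ = sgn τ ℤ.* 𝟙 (⟦ τ ⟧ ≤ᵇ R)

sgn-𝟘̂ : ∀ {n} → sgn (𝟘̂ {n}) ≡ 1ℤ
sgn-𝟘̂ {zero}  = refl
sgn-𝟘̂ {suc n} = trans (sgn-suc (𝟘̂ {suc n})) (trans
  (cong₂ (λ b z → joinSign b ℤ.* z) (anyF-false n) (trans (sgn-cong {σ = 𝟘̂ ∘ suc} {𝟘̂ {n}} λ _ _ → refl) (sgn-𝟘̂ {n})))
  refl)

μ𝟘̂ : ∀ {n} (τ : SetPartition n) → μ 𝟘̂ τ ≡ sgn τ ℤ.* weight 1ℤ ⟦ 𝟘̂ ⟧ τ
μ𝟘̂ {n} τ = begin
  μ 𝟘̂ τ ≡⟨ μ≡weight 𝟘̂ τ ⟩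
  weight ℤ.-1ℤ ⟦ 𝟘̂ ⟧ τ ≡⟨ ∑≥-sign 𝟘̂ (λ σ → 𝟙 (⟦ σ ⟧ ≐ᵇ ⟦ τ ⟧)) ⟩
  sgn (𝟘̂ {n}) ℤ.* ∑≥ 1ℤ ⟦ 𝟘̂ ⟧ (λ σ → sgn σ ℤ.* 𝟙 (⟦ σ ⟧ ≐ᵇ ⟦ τ ⟧))
    ≡⟨ cong (λ z → z ℤ.* ∑≥ 1ℤ ⟦ 𝟘̂ ⟧ (λ σ → sgn σ ℤ.* 𝟙 (⟦ σ ⟧ ≐ᵇ ⟦ τ ⟧))) (sgn-𝟘̂ {n}) ⟩
  1ℤ ℤ.* ∑≥ 1ℤ ⟦ 𝟘̂ ⟧ (λ σ → sgn σ ℤ.* 𝟙 (⟦ σ ⟧ ≐ᵇ ⟦ τ ⟧)) ≡⟨ ℤ.*-identityˡ _ ⟩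
  ∑≥ 1ℤ ⟦ 𝟘̂ ⟧ (λ σ → sgn σ ℤ.* 𝟙 (⟦ σ ⟧ ≐ᵇ ⟦ τ ⟧))
    ≡⟨ ∑≥-cong′ 1ℤ ⟦ 𝟘̂ ⟧ (λ σ → replace σ (⟦ σ ⟧ ≐ᵇ ⟦ τ ⟧) refl) ⟩
  ∑≥ 1ℤ ⟦ 𝟘̂ ⟧ (λ σ → sgn τ ℤ.* 𝟙 (⟦ σ ⟧ ≐ᵇ ⟦ τ ⟧))
    ≡⟨ ∑≥-* 1ℤ ⟦ 𝟘̂ ⟧ (sgn τ) (λ σ → 𝟙 (⟦ σ ⟧ ≐ᵇ ⟦ τ ⟧)) ⟩
  sgn τ ℤ.* weight 1ℤ ⟦ 𝟘̂ ⟧ τ ∎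
  where
  open ≡-Reasoning
  replace : ∀ σ b → (⟦ σ ⟧ ≐ᵇ ⟦ τ ⟧) ≡ b → sgn σ ℤ.* 𝟙 b ≡ sgn τ ℤ.* 𝟙 b
  replace σ true  p = cong (λ z → z ℤ.* 1ℤ) (sgn-cong {σ = σ} {τ} (≐ᵇ-elim ⟦ σ ⟧ ⟦ τ ⟧ p))
  replace σ false p = trans (ℤ.*-zeroʳ (sgn σ)) (sym (ℤ.*-zeroʳ (sgn τ)))

weight-𝟘̂-positive : ∀ {n} (τ : SetPartition n) → Positive (weight 1ℤ ⟦ 𝟘̂ ⟧ τ)
weight-𝟘̂-positive τ = positive-∑≥ τ (λ σ → natural-𝟙 (⟦ σ ⟧ ≐ᵇ ⟦ τ ⟧))
  λ σ p → 0 , cong 𝟙 (≐ᵇ-intro p)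

absMu0≡weight : ∀ {n} (τ : SetPartition n) → + absMu0 τ ≡ weight 1ℤ ⟦ 𝟘̂ ⟧ τ
absMu0≡weight {n} τ with k , p ← weight-𝟘̂-positive τ = begin
  + ℤ.∣ μ 𝟘̂ τ ∣ ≡⟨ cong (λ z → + ℤ.∣ z ∣) (trans (μ𝟘̂ τ) (cong (λ z → sgn τ ℤ.* z) p)) ⟩
  + ℤ.∣ sgn τ ℤ.* + suc k ∣ ≡⟨ cong +_ (ℤ.abs-* (sgn τ) (+ suc k)) ⟩
  + (ℤ.∣ sgn τ ∣ ℕ.* suc k) ≡⟨ cong (λ j → + (j ℕ.* suc k)) ∣sgn∣ ⟩
  + (1 ℕ.* suc k) ≡⟨ cong +_ (ℕ.*-identityˡ (suc k)) ⟩
  + suc k ≡⟨ p ⟨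
  weight 1ℤ ⟦ 𝟘̂ ⟧ τ ∎
  where
  open ≡-Reasoning
  ∣sgn∣ : ℤ.∣ sgn τ ∣ ≡ 1
  ∣sgn∣ = ℕ.m*n≡1⇒m≡1 ℤ.∣ sgn τ ∣ ℤ.∣ sgn τ ∣ (trans (sym (ℤ.abs-* (sgn τ) (sgn τ))) (cong ℤ.∣_∣ (sgn-square τ)))

-- This keeps `÷ℕ` away from its conventional value at zero and makes the diagonal of the system
-- relating h to p invertible.
absMu0-nonZero : ∀ {n} (τ : SetPartition n) → ∃[ k ] absMu0 τ ≡ suc k
absMu0-nonZero τ with k , p ← weight-𝟘̂-positive τ = k , ℤ.+-injective (trans (absMu0≡weight τ) p)

μ𝟘̂≡sgn*absMu0 : ∀ {n} (τ : SetPartition n) → μ 𝟘̂ τ ≡ sgn τ ℤ.* + absMu0 τ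
μ𝟘̂≡sgn*absMu0 τ = trans (μ𝟘̂ τ) (cong (λ z → sgn τ ℤ.* z) (sym (absMu0≡weight τ)))

-- In classical terms, |μ(0̂,τ)| is the number of permutations whose cycles are the blocks of τ, and
-- `fact R` is the number of permutations that map every block of `R` to itself.
∑absMu0 : ∀ {n} {R : BRel n} → IsEquiv R →
          sumℤ (λ τ → + absMu0 τ ℤ.* 𝟙 (⟦ τ ⟧ ≤ᵇ R)) (allPartitions n) ≡ + fact R
∑absMu0 {n} {R} r = begin
  sumℤ (λ τ → + absMu0 τ ℤ.* 𝟙 (⟦ τ ⟧ ≤ᵇ R)) (allPartitions n)
    ≡⟨ ℤL.sum-cong (allPartitions n) (λ τ → cong (λ z → z ℤ.* 𝟙 (⟦ τ ⟧ ≤ᵇ R)) (absMu0≡weight τ)) ⟩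
  sumℤ (λ τ → weight 1ℤ ⟦ 𝟘̂ ⟧ τ ℤ.* 𝟙 (⟦ τ ⟧ ≤ᵇ R)) (allPartitions n)
    ≡⟨ weight-expand 1ℤ ⟦ 𝟘̂ ⟧ _ (≤ᵇ-congˡ R) ⟩
  ∑≥ 1ℤ ⟦ 𝟘̂ ⟧ (λ σ → 𝟙 (⟦ σ ⟧ ≤ᵇ R))
    ≡⟨ ∑≥-bounded 1ℤ (⟦⟧-equiv 𝟘̂) r (𝟘̂-least r) ⟩
  boundedWeight 1ℤ ⟦ 𝟘̂ ⟧ R ≡⟨ boundedWeight-1 ⟦ 𝟘̂ ⟧ r ⟩
  + blockFact (greatest ⟦ 𝟘̂ ⟧) R
    ≡⟨ cong +_ (blockFact-cong {R = R} (λ i → cnt-cong λ j → cong (_∧ R i j) (greatest-𝟘̂ j)) λ _ _ → refl) ⟩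
  + blockFact (λ _ → true) R ≡⟨ cong +_ (fact≡ R) ⟨
  + fact R ∎
  where
  open ≡-Reasoning

open import Data.Rational.Base as ℚ using (ℚ; _+_; _*_; 0ℚ; 1ℚ)
import Data.Rational.Properties as ℚ
open import Algebra.Properties.Group ℚ.+-0-group using () renaming (∙-cancelʳ to +-cancelʳ)
import Data.Rational.Unnormalised.Base as ℚᵘ
import Data.Rational.Unnormalised.Properties as ℚᵘ
open import Data.Rational.Solver using (module +-*-Solver)


module ℚL = ListSum ℚ.+-*-commutativeRing

-- The rational form of the identities

private
  cast≃ : ∀ z → ℚ.toℚᵘ (ℤ→ℚ z) ℚᵘ.≃ ℚᵘ.mkℚᵘ z 0
  cast≃ z = ℚ.toℚᵘ-fromℚᵘ (ℚᵘ.mkℚᵘ z 0)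

-- Normalising `z ℚ./ 1` does not compute for a variable `z`, so the identities for casts are
-- checked on unnormalised fractions.
cast-+ : ∀ a b → ℤ→ℚ (a ℤ.+ b) ≡ ℤ→ℚ a + ℤ→ℚ b
cast-+ a b = ℚ.toℚᵘ-injective (begin
  ℚ.toℚᵘ (ℤ→ℚ (a ℤ.+ b)) ≈⟨ cast≃ (a ℤ.+ b) ⟩
  ℚᵘ.mkℚᵘ (a ℤ.+ b) 0 ≡⟨ cong₂ (λ x y → ℚᵘ.mkℚᵘ (x ℤ.+ y) 0) (ℤ.*-identityʳ a) (ℤ.*-identityʳ b) ⟨
  ℚᵘ.mkℚᵘ a 0 ℚᵘ.+ ℚᵘ.mkℚᵘ b 0 ≈⟨ ℚᵘ.+-cong (cast≃ a) (cast≃ b) ⟨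
  ℚ.toℚᵘ (ℤ→ℚ a) ℚᵘ.+ ℚ.toℚᵘ (ℤ→ℚ b) ≈⟨ ℚ.toℚᵘ-homo-+ (ℤ→ℚ a) (ℤ→ℚ b) ⟨
  ℚ.toℚᵘ (ℤ→ℚ a + ℤ→ℚ b) ∎)
  where open ℚᵘ.≃-Reasoning

cast-* : ∀ a b → ℤ→ℚ (a ℤ.* b) ≡ ℤ→ℚ a * ℤ→ℚ b
cast-* a b = ℚ.toℚᵘ-injective (begin
  ℚ.toℚᵘ (ℤ→ℚ (a ℤ.* b)) ≈⟨ cast≃ (a ℤ.* b) ⟩
  ℚᵘ.mkℚᵘ a 0 ℚᵘ.* ℚᵘ.mkℚᵘ b 0 ≈⟨ ℚᵘ.*-cong (cast≃ a) (cast≃ b) ⟨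
  ℚ.toℚᵘ (ℤ→ℚ a) ℚᵘ.* ℚ.toℚᵘ (ℤ→ℚ b) ≈⟨ ℚ.toℚᵘ-homo-* (ℤ→ℚ a) (ℤ→ℚ b) ⟨
  ℚ.toℚᵘ (ℤ→ℚ a * ℤ→ℚ b) ∎)
  where open ℚᵘ.≃-Reasoning

cast-𝟙 : ∀ b → ℤ→ℚ (𝟙 b) ≡ δ b
cast-𝟙 true  = refl
cast-𝟙 false = refl

cast-sum : ∀ {A : Set} (f : A → ℤ) xs → ℤ→ℚ (sumℤ f xs) ≡ sumℚ (ℤ→ℚ ∘ f) xs
cast-sum f []       = refl
cast-sum f (x ∷ xs) = trans (cast-+ (f x) (sumℤ f xs)) (cong (λ z → ℤ→ℚ (f x) + z) (cast-sum f xs))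

reciprocal : ∀ d → ℕ→ℚ (suc d) * (1ℚ ÷ℕ suc d) ≡ 1ℚ
reciprocal d = trans (cong (ℕ→ℚ (suc d) *_) (ℚ.*-identityˡ ((+ 1) ℚ./ suc d))) (ℚ.toℚᵘ-injective (begin
  ℚ.toℚᵘ (ℕ→ℚ (suc d) * ((+ 1) ℚ./ suc d)) ≈⟨ ℚ.toℚᵘ-homo-* (ℕ→ℚ (suc d)) ((+ 1) ℚ./ suc d) ⟩
  ℚ.toℚᵘ (ℕ→ℚ (suc d)) ℚᵘ.* ℚ.toℚᵘ ((+ 1) ℚ./ suc d)
    ≈⟨ ℚᵘ.*-cong (cast≃ (+ suc d)) (ℚ.toℚᵘ-fromℚᵘ (ℚᵘ.mkℚᵘ (+ 1) d)) ⟩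
  ℚᵘ.mkℚᵘ (+ suc d) 0 ℚᵘ.* ℚᵘ.mkℚᵘ (+ 1) d ≈⟨ ℚᵘ.*≡* (cross (+ suc d)) ⟩
  ℚᵘ.1ℚᵘ ∎))
  where
  open ℚᵘ.≃-Reasoning
  cross : ∀ x → x ℤ.* 1ℤ ℤ.* 1ℤ ≡ 1ℤ ℤ.* (1ℤ ℤ.* x)
  cross = solve-∀

-- Division becomes multiplication without a case distinction later; at d = 0 both sides are 0.
÷ℕ-reciprocal : ∀ q d → q ÷ℕ d ≡ q * (1ℚ ÷ℕ d)
÷ℕ-reciprocal q zero    = sym (ℚ.*-zeroʳ q)
÷ℕ-reciprocal q (suc d) = cong (q *_) (sym (ℚ.*-identityˡ ((+ 1) ℚ./ suc d)))

δ-∧ : ∀ a b → δ (a ∧ b) ≡ δ a * δ b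
δ-∧ true  b = sym (ℚ.*-identityˡ (δ b))
δ-∧ false b = sym (ℚ.*-zeroˡ (δ b))

δ-⋀ : ∀ {n} (T R S : BRel n) → δ (T ≤ᵇ (R ⋀ S)) ≡ δ (T ≤ᵇ R) * δ (T ≤ᵇ S)
δ-⋀ T R S = trans (cong δ (⋀-greatest T R S)) (δ-∧ (T ≤ᵇ R) (T ≤ᵇ S))

module _ {n : ℕ} where
  open ≡-Reasoning

  μℚ : SetPartition n → SetPartition n → ℚ
  μℚ σ π = ℤ→ℚ (μ σ π)

  sgnℚ ∣μ∣ 1/∣μ∣ : SetPartition n → ℚ
  sgnℚ σ = ℤ→ℚ (sgn σ)
  ∣μ∣ σ = ℕ→ℚ (absMu0 σ)
  1/∣μ∣ σ = 1ℚ ÷ℕ absMu0 σ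

  ∣μ∣-inverse : ∀ σ → ∣μ∣ σ * 1/∣μ∣ σ ≡ 1ℚ
  ∣μ∣-inverse σ with k , p ← absMu0-nonZero σ rewrite p = reciprocal k

  ∣μ∣-cancel : ∀ σ {x y} → ∣μ∣ σ * x ≡ ∣μ∣ σ * y → x ≡ y
  ∣μ∣-cancel σ {x} {y} p = trans (sym (undo x)) (trans (cong (1/∣μ∣ σ *_) p) (undo y))
    where
    undo : ∀ z → 1/∣μ∣ σ * (∣μ∣ σ * z) ≡ z
    undo z = trans (sym (ℚ.*-assoc (1/∣μ∣ σ) (∣μ∣ σ) z))
      (trans (cong (_* z) (trans (ℚ.*-comm (1/∣μ∣ σ) (∣μ∣ σ)) (∣μ∣-inverse σ))) (ℚ.*-identityˡ z))

  ∣μ∣-cong : ∀ {σ τ} → ⟦ σ ⟧ ≗₂ ⟦ τ ⟧ → ∣μ∣ σ ≡ ∣μ∣ τ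
  ∣μ∣-cong {σ} {τ} p = cong (λ z → ℕ→ℚ ℤ.∣ z ∣) (μ-cong 𝟘̂ σ τ p)

  sgnℚ-square : ∀ σ → sgnℚ σ * sgnℚ σ ≡ 1ℚ
  sgnℚ-square σ = trans (sym (cast-* (sgn σ) (sgn σ))) (cong ℤ→ℚ (sgn-square σ))

  private
    cast-term : ∀ a b → ℤ→ℚ (a ℤ.* 𝟙 b) ≡ ℤ→ℚ a * δ b
    cast-term a b = trans (cast-* a (𝟙 b)) (cong (ℤ→ℚ a *_) (cast-𝟙 b))

  ∑μℚ : ∀ ρ {R : BRel n} → IsEquiv R → sumℚ (λ τ → μℚ ρ τ * δ (⟦ τ ⟧ ≤ᵇ R)) (allPartitions n) ≡ δ (⟦ ρ ⟧ ≐ᵇ R)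
  ∑μℚ ρ {R} r = begin
    sumℚ (λ τ → μℚ ρ τ * δ (⟦ τ ⟧ ≤ᵇ R)) (allPartitions n) ≡⟨ ℚL.sum-cong (allPartitions n) (λ τ → cast-term (μ ρ τ) (⟦ τ ⟧ ≤ᵇ R)) ⟨
    sumℚ (λ τ → ℤ→ℚ (μ ρ τ ℤ.* 𝟙 (⟦ τ ⟧ ≤ᵇ R))) (allPartitions n) ≡⟨ cast-sum (λ τ → μ ρ τ ℤ.* 𝟙 (⟦ τ ⟧ ≤ᵇ R)) (allPartitions n) ⟨
    ℤ→ℚ (sumℤ (λ τ → μ ρ τ ℤ.* 𝟙 (⟦ τ ⟧ ≤ᵇ R)) (allPartitions n)) ≡⟨ cong ℤ→ℚ (∑μ ρ r) ⟩
    ℤ→ℚ (𝟙 (⟦ ρ ⟧ ≐ᵇ R)) ≡⟨ cast-𝟙 (⟦ ρ ⟧ ≐ᵇ R) ⟩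
    δ (⟦ ρ ⟧ ≐ᵇ R) ∎

  ∑μℚ-sgn : ∀ ρ π → sumℚ (λ τ → μℚ ρ τ * (sgnℚ τ * ζ τ π)) (allPartitions n) ≡ sgnℚ ρ * (ζ ρ π * ℕ→ℚ (lamFact ρ π))
  ∑μℚ-sgn ρ π = begin
    sumℚ (λ τ → μℚ ρ τ * (sgnℚ τ * ζ τ π)) (allPartitions n)
      ≡⟨ ℚL.sum-cong (allPartitions n) (λ τ → trans (cast-* (μ ρ τ) (sgn τ ℤ.* 𝟙 (⟦ τ ⟧ ≤ᵇ ⟦ π ⟧))) (cong (μℚ ρ τ *_) (cast-term (sgn τ) (⟦ τ ⟧ ≤ᵇ ⟦ π ⟧)))) ⟨
    sumℚ (λ τ → ℤ→ℚ (μ ρ τ ℤ.* (sgn τ ℤ.* 𝟙 (⟦ τ ⟧ ≤ᵇ ⟦ π ⟧)))) (allPartitions n)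
      ≡⟨ cast-sum (λ τ → μ ρ τ ℤ.* (sgn τ ℤ.* 𝟙 (⟦ τ ⟧ ≤ᵇ ⟦ π ⟧))) (allPartitions n) ⟨
    ℤ→ℚ (sumℤ (λ τ → μ ρ τ ℤ.* (sgn τ ℤ.* 𝟙 (⟦ τ ⟧ ≤ᵇ ⟦ π ⟧))) (allPartitions n))
      ≡⟨ cong ℤ→ℚ (∑μ-sgn ρ (⟦⟧-equiv π)) ⟩
    ℤ→ℚ (sgn ρ ℤ.* (𝟙 (⟦ ρ ⟧ ≤ᵇ ⟦ π ⟧) ℤ.* + blockFact (greatest ⟦ ρ ⟧) ⟦ π ⟧))
      ≡⟨ cong (λ z → ℤ→ℚ (sgn ρ ℤ.* z)) (replace (⟦ ρ ⟧ ≤ᵇ ⟦ π ⟧) refl) ⟩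
    ℤ→ℚ (sgn ρ ℤ.* (𝟙 (⟦ ρ ⟧ ≤ᵇ ⟦ π ⟧) ℤ.* + lamFact ρ π))
      ≡⟨ trans (cast-* (sgn ρ) _) (cong (sgnℚ ρ *_) (trans (cast-* (𝟙 (⟦ ρ ⟧ ≤ᵇ ⟦ π ⟧)) (+ lamFact ρ π))
          (cong (_* ℕ→ℚ (lamFact ρ π)) (cast-𝟙 (⟦ ρ ⟧ ≤ᵇ ⟦ π ⟧))))) ⟩
    sgnℚ ρ * (ζ ρ π * ℕ→ℚ (lamFact ρ π)) ∎
    where
    replace : ∀ b → (⟦ ρ ⟧ ≤ᵇ ⟦ π ⟧) ≡ b → 𝟙 b ℤ.* + blockFact (greatest ⟦ ρ ⟧) ⟦ π ⟧ ≡ 𝟙 b ℤ.* + lamFact ρ π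
    replace true  p = cong (λ k → 1ℤ ℤ.* + k) (sym (lamFact≡ ρ π (≤ᵇ-elim ⟦ ρ ⟧ ⟦ π ⟧ p)))
    replace false p = refl

  ∑∣μ∣ : {R : BRel n} → IsEquiv R → sumℚ (λ τ → ∣μ∣ τ * δ (⟦ τ ⟧ ≤ᵇ R)) (allPartitions n) ≡ ℕ→ℚ (fact R)
  ∑∣μ∣ {R} r = begin
    sumℚ (λ τ → ∣μ∣ τ * δ (⟦ τ ⟧ ≤ᵇ R)) (allPartitions n) ≡⟨ ℚL.sum-cong (allPartitions n) (λ τ → cast-term (+ absMu0 τ) (⟦ τ ⟧ ≤ᵇ R)) ⟨
    sumℚ (λ τ → ℤ→ℚ (+ absMu0 τ ℤ.* 𝟙 (⟦ τ ⟧ ≤ᵇ R))) (allPartitions n) ≡⟨ cast-sum (λ τ → + absMu0 τ ℤ.* 𝟙 (⟦ τ ⟧ ≤ᵇ R)) (allPartitions n) ⟨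
    ℤ→ℚ (sumℤ (λ τ → + absMu0 τ ℤ.* 𝟙 (⟦ τ ⟧ ≤ᵇ R)) (allPartitions n)) ≡⟨ cong ℤ→ℚ (∑absMu0 r) ⟩
    ℕ→ℚ (fact R) ∎

  ∑∣μ∣-sgn : {R : BRel n} → IsEquiv R → sumℚ (λ τ → ∣μ∣ τ * (sgnℚ τ * δ (⟦ τ ⟧ ≤ᵇ R))) (allPartitions n) ≡ δ (isBottom R)
  ∑∣μ∣-sgn {R} r = begin
    sumℚ (λ τ → ∣μ∣ τ * (sgnℚ τ * δ (⟦ τ ⟧ ≤ᵇ R))) (allPartitions n)
      ≡⟨ ℚL.sum-cong (allPartitions n) (λ τ → trans (sym (ℚ.*-assoc (∣μ∣ τ) (sgnℚ τ) (δ (⟦ τ ⟧ ≤ᵇ R)))) (cong (_* δ (⟦ τ ⟧ ≤ᵇ R)) (begin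
          ∣μ∣ τ * sgnℚ τ ≡⟨ ℚ.*-comm (∣μ∣ τ) (sgnℚ τ) ⟩
          sgnℚ τ * ∣μ∣ τ ≡⟨ cast-* (sgn τ) (+ absMu0 τ) ⟨
          ℤ→ℚ (sgn τ ℤ.* + absMu0 τ) ≡⟨ cong ℤ→ℚ (μ𝟘̂≡sgn*absMu0 τ) ⟨
          μℚ 𝟘̂ τ ∎))) ⟩
    sumℚ (λ τ → μℚ 𝟘̂ τ * δ (⟦ τ ⟧ ≤ᵇ R)) (allPartitions n) ≡⟨ ∑μℚ 𝟘̂ r ⟩
    δ (⟦ 𝟘̂ ⟧ ≐ᵇ R) ≡⟨ cong (λ b → δ (b ∧ isBottom R)) (≤ᵇ-intro (𝟘̂-least r)) ⟩
    δ (isBottom R) ∎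

  -- Functions of the kernel and inversion of the zeta matrix

  KernelInvariant : (SetPartition n → ℚ) → Set
  KernelInvariant f = ∀ σ τ → ⟦ σ ⟧ ≗₂ ⟦ τ ⟧ → f σ ≡ f τ

  sum-δ : ∀ (f : SetPartition n → ℚ) → KernelInvariant f → ∀ σ → sumℚ (λ τ → f τ * δ (⟦ τ ⟧ ≐ᵇ ⟦ σ ⟧)) (allPartitions n) ≡ f σ
  sum-δ f f-cong σ = ℚL.sum-partition σ
    (λ τ p → trans (cong (λ b → f τ * δ b) (≐ᵇ-intro p)) (trans (ℚ.*-identityʳ (f τ)) (f-cong τ σ p)))
    (λ τ p → trans (cong (λ b → f τ * δ b) p) (ℚ.*-zeroʳ (f τ)))

  -- The system is unitriangular: the sum at τ is the value at τ plus values strictly below, which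
  -- agree by induction and cancel. A partition strictly below τ has more blocks, and never more
  -- than n, so n steps of descent suffice.
  zeta-injective : ∀ {f g} → KernelInvariant f → KernelInvariant g →
    (∀ τ → sumℚ (λ ρ → f ρ * ζ ρ τ) (allPartitions n) ≡ sumℚ (λ ρ → g ρ * ζ ρ τ) (allPartitions n)) → ∀ τ → f τ ≡ g τ
  zeta-injective {f} {g} f-cong g-cong sums τ = go n τ (ℕ.m≤n+m n (blocks ⟦ τ ⟧))
    where
    strict : SetPartition n → SetPartition n → Bool
    strict ρ τ = (⟦ ρ ⟧ ≤ᵇ ⟦ τ ⟧) ∧ not (⟦ τ ⟧ ≤ᵇ ⟦ ρ ⟧)
    below : (SetPartition n → ℚ) → SetPartition n → ℚ
    below f τ = sumℚ (λ ρ → if strict ρ τ then f ρ else 0ℚ) (allPartitions n)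

    split : ∀ {f} → KernelInvariant f → ∀ τ → sumℚ (λ ρ → f ρ * ζ ρ τ) (allPartitions n) ≡ f τ + below f τ
    split {f} f-cong τ = begin
      sumℚ (λ ρ → f ρ * ζ ρ τ) (allPartitions n)
        ≡⟨ ℚL.sum-cong (allPartitions n) (λ ρ → term (⟦ ρ ⟧ ≤ᵇ ⟦ τ ⟧) (⟦ τ ⟧ ≤ᵇ ⟦ ρ ⟧) (f ρ)) ⟩
      sumℚ (λ ρ → f ρ * δ (⟦ ρ ⟧ ≐ᵇ ⟦ τ ⟧) + (if strict ρ τ then f ρ else 0ℚ)) (allPartitions n)
        ≡⟨ ℚL.sum-+ (λ ρ → f ρ * δ (⟦ ρ ⟧ ≐ᵇ ⟦ τ ⟧)) (λ ρ → if strict ρ τ then f ρ else 0ℚ) (allPartitions n) ⟩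
      sumℚ (λ ρ → f ρ * δ (⟦ ρ ⟧ ≐ᵇ ⟦ τ ⟧)) (allPartitions n) + below f τ ≡⟨ cong (_+ below f τ) (sum-δ f f-cong τ) ⟩
      f τ + below f τ ∎
      where
      term : ∀ a b x → x * δ a ≡ x * δ (a ∧ b) + (if a ∧ not b then x else 0ℚ)
      term true  true  x = sym (ℚ.+-identityʳ (x * 1ℚ))
      term true  false x = trans (ℚ.*-identityʳ x) (sym (trans (cong (_+ x) (ℚ.*-zeroʳ x)) (ℚ.+-identityˡ x)))
      term false b     x = sym (ℚ.+-identityʳ (x * 0ℚ))

    go : ∀ k τ → n ℕ.≤ blocks ⟦ τ ⟧ ℕ.+ k → f τ ≡ g τ
    below≡ : ∀ k τ → n ℕ.≤ blocks ⟦ τ ⟧ ℕ.+ k → ∀ ρ b → strict ρ τ ≡ b →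
             (if b then f ρ else 0ℚ) ≡ (if b then g ρ else 0ℚ)

    go k τ q = +-cancelʳ (below g τ) (f τ) (g τ) (begin
      f τ + below g τ ≡⟨ cong (λ z → f τ + z) (ℚL.sum-cong (allPartitions n) λ ρ → below≡ k τ q ρ (strict ρ τ) refl) ⟨
      f τ + below f τ ≡⟨ split f-cong τ ⟨
      sumℚ (λ ρ → f ρ * ζ ρ τ) (allPartitions n) ≡⟨ sums τ ⟩
      sumℚ (λ ρ → g ρ * ζ ρ τ) (allPartitions n) ≡⟨ split g-cong τ ⟩
      g τ + below g τ ∎)

    below≡ k τ q ρ false s = refl
    below≡ k τ q ρ true  s = descend k q
      where
      more : blocks ⟦ τ ⟧ ℕ.< blocks ⟦ ρ ⟧
      more = ℕ.≰⇒> λ r → true≢false (∧-elimʳ {⟦ ρ ⟧ ≤ᵇ ⟦ τ ⟧} s) (cong not (≤ᵇ-intro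
        (blocks-reflects (⟦⟧-equiv ρ) (⟦⟧-equiv τ) (≤ᵇ-elim ⟦ ρ ⟧ ⟦ τ ⟧ (∧-elimˡ s)) r)))
      descend : ∀ k → n ℕ.≤ blocks ⟦ τ ⟧ ℕ.+ k → f ρ ≡ g ρ
      descend zero    q = contradiction (ℕ.≤-trans more (ℕ.≤-trans (blocks≤n ⟦ ρ ⟧)
                            (subst (n ℕ.≤_) (ℕ.+-identityʳ (blocks ⟦ τ ⟧)) q))) (ℕ.<-irrefl refl)
      descend (suc k) q = go k ρ (ℕ.≤-trans (subst (n ℕ.≤_) (ℕ.+-suc (blocks ⟦ τ ⟧) k) q) (ℕ.+-monoˡ-≤ k more))

-- A permutation of the variables is injective on labels and therefore preserves the kernel of a
-- word. This discharges the invariance premises of the bilinearity axioms.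
invariant : ∀ {n} {f : Series n} → KernelInvariant f → Invariant f
invariant f-cong ρ w = f-cong (λ i → to (w i)) w λ i j → bool-ext
  (λ p → ≡ᵇ-intro (trans (sym (strictlyInverseʳ (w i))) (trans (cong from (≡ᵇ-elim p)) (strictlyInverseʳ (w j)))))
  (λ p → ≡ᵇ-intro (cong to (≡ᵇ-elim p)))
  where open Inverse ρ

module _ {n : ℕ} (π : SetPartition n) where

  m-invariant : KernelInvariant (m π)
  m-invariant v w p = cong δ (≐ᵇ-cong p λ _ _ → refl)

  p-invariant : KernelInvariant (p π)
  p-invariant v w q = cong δ (≤ᵇ-cong {R = ⟦ π ⟧} (λ _ _ → refl) q)

  e-invariant : KernelInvariant (e π)
  e-invariant v w p = cong δ (≤ᵇ-cong (λ i j → cong (⟦ π ⟧ i j ∧_) (p i j)) λ _ _ → refl)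

  h-invariant : KernelInvariant (h π)
  h-invariant v w p = cong ℕ→ℚ (fact-cong λ i j → cong (_∧ ⟦ π ⟧ i j) (p i j))

-- Expansions in the bases m and p

module _ {n : ℕ} where
  open ≡-Reasoning
  open +-*-Solver using (solve; _:=_; _:*_; con)

  m-expansion : ∀ {f : Series n} → KernelInvariant f → ∀ w → f w ≡ sumℚ (λ τ → f τ * m τ w) (allPartitions n)
  m-expansion {f} f-cong w = sym (trans
    (ℚL.sum-cong (allPartitions n) λ τ → cong (λ b → f τ * δ b) (≐ᵇ-sym ⟦ w ⟧ ⟦ τ ⟧)) (sum-δ f f-cong w))

  -- ρ lies below ker w ∧ σ iff it lies below both, so `ζ ρ σ` times the coefficient of p_ρ at w
  -- tests ρ against the meet, and `∑∣μ∣` sums to the factorial of the meet.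
  h-expansion : ∀ σ (w : Word n) → h σ w ≡ sumℚ (λ ρ → (∣μ∣ ρ * ζ ρ σ) * p ρ w) (allPartitions n)
  h-expansion σ w = sym (trans
    (ℚL.sum-cong (allPartitions n) λ ρ → trans (ℚ.*-assoc (∣μ∣ ρ) (ζ ρ σ) (p ρ w)) (cong (∣μ∣ ρ *_)
      (trans (ℚ.*-comm (ζ ρ σ) (p ρ w)) (sym (δ-⋀ ⟦ ρ ⟧ ⟦ w ⟧ ⟦ σ ⟧)))))
    (∑∣μ∣ (⋀-equiv (⟦⟧-equiv w) (⟦⟧-equiv σ))))

  -- The same sum over the partitions below the meet, now with signs: |μ| times the sign is μ(0̂,ρ),
  -- and these values add up to 1 at the bottom and to 0 elsewhere.
  e-expansion : ∀ σ (w : Word n) → e σ w ≡ sumℚ (λ ρ → (∣μ∣ ρ * (sgnℚ ρ * ζ ρ σ)) * p ρ w) (allPartitions n)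
  e-expansion σ w = sym (trans
    (ℚL.sum-cong (allPartitions n) λ ρ → trans (assoc (∣μ∣ ρ) (sgnℚ ρ) (ζ ρ σ) (p ρ w))
      (cong (λ z → ∣μ∣ ρ * (sgnℚ ρ * z)) (sym (δ-⋀ ⟦ ρ ⟧ ⟦ σ ⟧ ⟦ w ⟧))))
    (∑∣μ∣-sgn (⋀-equiv (⟦⟧-equiv σ) (⟦⟧-equiv w))))
    where
    assoc : ∀ a b c d → a * (b * c) * d ≡ a * (b * (c * d))
    assoc = solve 4 (λ a b c d → a :* (b :* c) :* d := a :* (b :* (c :* d))) refl

  -- A word is itself a block labelling, and `p τ w` unfolds to `ζ τ w`; the identity is thus Möbius
  -- inversion at the partition `w`.
  m-in-p : ∀ σ (w : Word n) → m σ w ≡ sumℚ (λ τ → μℚ σ τ * p τ w) (allPartitions n)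
  m-in-p σ w = trans (cong δ (≐ᵇ-sym ⟦ w ⟧ ⟦ σ ⟧)) (sym (∑μℚ σ (⟦⟧-equiv w)))

-- Evaluation of the form on the four families

module MHForm {n} {B : Series n → Series n → ℚ} (form : IsMHForm n B) where
  open IsMHForm form
  open ≡-Reasoning
  open +-*-Solver using (solve; _:=_; _:*_; con)

  N : ℚ
  N = ℕ→ℚ (n !)

  sumˡ : ∀ {A : Set} (c : A → ℚ) (f : A → Series n) {g} → (∀ a → KernelInvariant (f a)) → KernelInvariant g →
         ∀ xs → B (λ w → sumℚ (λ a → c a * f a w) xs) g ≡ sumℚ (λ a → c a * B (f a) g) xs
  sumˡ c f {g} f-inv g-inv [] = begin
    -- The axioms do not mention the zero series, so it is written as a zero multiple of an
    -- invariant series; `g` is at hand.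
    B (λ _ → 0ℚ) g  ≡⟨ ext _ _ g g (λ w → sym (ℚ.*-zeroˡ (g w))) (λ _ → refl) ⟩
    B (0ℚ ·ˢ g) g   ≡⟨ scaleˡ 0ℚ g g (invariant g-inv) (invariant g-inv) ⟩
    0ℚ * B g g      ≡⟨ ℚ.*-zeroˡ (B g g) ⟩
    0ℚ              ∎
  sumˡ c f {g} f-inv g-inv (x ∷ xs) = begin
    B ((c x ·ˢ f x) +ˢ tail) g
      ≡⟨ addˡ (c x ·ˢ f x) tail g (invariant λ v w p → cong (c x *_) (f-inv x v w p))
          (invariant λ v w p → ℚL.sum-cong xs λ a → cong (c a *_) (f-inv a v w p)) (invariant g-inv) ⟩
    B (c x ·ˢ f x) g + B tail g
      ≡⟨ cong₂ _+_ (scaleˡ (c x) (f x) g (invariant (f-inv x)) (invariant g-inv)) (sumˡ c f f-inv g-inv xs) ⟩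
    c x * B (f x) g + sumℚ (λ a → c a * B (f a) g) xs ∎
    where
    tail : Series n
    tail w = sumℚ (λ a → c a * f a w) xs

  sumʳ : ∀ {A : Set} (c : A → ℚ) (f : A → Series n) {g} → (∀ a → KernelInvariant (f a)) → KernelInvariant g →
         ∀ xs → B g (λ w → sumℚ (λ a → c a * f a w) xs) ≡ sumℚ (λ a → c a * B g (f a)) xs
  sumʳ c f {g} f-inv g-inv [] = begin
    B g (λ _ → 0ℚ)  ≡⟨ ext g g _ _ (λ _ → refl) (λ w → sym (ℚ.*-zeroˡ (g w))) ⟩
    B g (0ℚ ·ˢ g)   ≡⟨ scaleʳ 0ℚ g g (invariant g-inv) (invariant g-inv) ⟩
    0ℚ * B g g      ≡⟨ ℚ.*-zeroˡ (B g g) ⟩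
    0ℚ              ∎
  sumʳ c f {g} f-inv g-inv (x ∷ xs) = begin
    B g ((c x ·ˢ f x) +ˢ tail)
      ≡⟨ addʳ g (c x ·ˢ f x) tail (invariant g-inv) (invariant λ v w p → cong (c x *_) (f-inv x v w p))
          (invariant λ v w p → ℚL.sum-cong xs λ a → cong (c a *_) (f-inv a v w p)) ⟩
    B g (c x ·ˢ f x) + B g tail
      ≡⟨ cong₂ _+_ (scaleʳ (c x) g (f x) (invariant g-inv) (invariant (f-inv x))) (sumʳ c f f-inv g-inv xs) ⟩
    c x * B g (f x) + sumℚ (λ a → c a * B g (f a)) xs ∎
    where
    tail : Series n
    tail w = sumℚ (λ a → c a * f a w) xs

  private
    left-comm : ∀ x y z → x * (y * z) ≡ y * (x * z)
    left-comm = solve 3 (λ x y z → x :* (y :* z) := y :* (x :* z)) refl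

  module _ {f : Series n} (f-inv : KernelInvariant f) where

    form-h : ∀ σ → B f (h σ) ≡ N * f σ
    form-h σ = begin
      B f (h σ) ≡⟨ ext _ _ (h σ) (h σ) (m-expansion f-inv) (λ _ → refl) ⟩
      B (λ w → sumℚ (λ τ → f τ * m τ w) (allPartitions n)) (h σ) ≡⟨ sumˡ f m m-invariant (h-invariant σ) (allPartitions n) ⟩
      sumℚ (λ τ → f τ * B (m τ) (h σ)) (allPartitions n)
        ≡⟨ ℚL.sum-cong (allPartitions n) (λ τ → trans (cong (f τ *_) (mh τ σ)) (left-comm (f τ) N (δ (⟦ τ ⟧ ≐ᵇ ⟦ σ ⟧)))) ⟩
      sumℚ (λ τ → N * (f τ * δ (⟦ τ ⟧ ≐ᵇ ⟦ σ ⟧))) (allPartitions n) ≡⟨ ℚL.sum-* N _ (allPartitions n) ⟩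
      N * sumℚ (λ τ → f τ * δ (⟦ τ ⟧ ≐ᵇ ⟦ σ ⟧)) (allPartitions n) ≡⟨ cong (N *_) (sum-δ f f-inv σ) ⟩
      N * f σ ∎

    -- The pairings with the p's are determined by those with the h's, because
    -- h is obtained from p by a triangular system.
    form-p : ∀ {G : SetPartition n → ℚ} → KernelInvariant G →
             (∀ τ → sumℚ (λ ρ → (∣μ∣ ρ * G ρ) * ζ ρ τ) (allPartitions n) ≡ N * f τ) → ∀ ρ → B f (p ρ) ≡ G ρ
    -- The unknowns of the unitriangular system are the products |μ|(ρ)⟨f, p_ρ⟩; the factor |μ|(ρ)
    -- is cancelled at the end.
    form-p {G} G-inv sums ρ = ∣μ∣-cancel ρ (zeta-injective
      (λ σ τ q → cong₂ _*_ (∣μ∣-cong q) (ext f f (p σ) (p τ) (λ _ → refl) λ w → cong δ (≤ᵇ-cong q λ _ _ → refl)))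
      (λ σ τ q → cong₂ _*_ (∣μ∣-cong q) (G-inv σ τ q))
      (λ τ → begin
        sumℚ (λ ρ → (∣μ∣ ρ * B f (p ρ)) * ζ ρ τ) (allPartitions n)
          ≡⟨ ℚL.sum-cong (allPartitions n) (λ ρ → swap (∣μ∣ ρ) (B f (p ρ)) (ζ ρ τ)) ⟩
        sumℚ (λ ρ → (∣μ∣ ρ * ζ ρ τ) * B f (p ρ)) (allPartitions n)
          ≡⟨ sumʳ (λ ρ → ∣μ∣ ρ * ζ ρ τ) p p-invariant f-inv (allPartitions n) ⟨
        B f (λ w → sumℚ (λ ρ → (∣μ∣ ρ * ζ ρ τ) * p ρ w) (allPartitions n))
          ≡⟨ ext f f _ _ (λ _ → refl) (h-expansion τ) ⟨
        B f (h τ) ≡⟨ form-h τ ⟩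
        N * f τ ≡⟨ sums τ ⟨
        sumℚ (λ ρ → (∣μ∣ ρ * G ρ) * ζ ρ τ) (allPartitions n) ∎) ρ)
      where
      swap : ∀ a b c → a * b * c ≡ a * c * b
      swap = solve 3 (λ a b c → a :* b :* c := a :* c :* b) refl

    form-m : ∀ σ → B f (m σ) ≡ sumℚ (λ τ → μℚ σ τ * B f (p τ)) (allPartitions n)
    form-m σ = trans (ext f f _ _ (λ _ → refl) (m-in-p σ)) (sumʳ (μℚ σ) p p-invariant f-inv (allPartitions n))

  e-p : ∀ π σ → B (e π) (p σ) ≡ sgnℚ σ * N * ζ σ π
  e-p π = form-p (e-invariant π)
    (λ σ τ q → cong₂ (λ x y → x * N * y) (cong ℤ→ℚ (sgn-cong {σ = σ} {τ} q)) (cong δ (≤ᵇ-cong q λ _ _ → refl)))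
    (λ τ → begin
      sumℚ (λ ρ → (∣μ∣ ρ * (sgnℚ ρ * N * ζ ρ π)) * ζ ρ τ) (allPartitions n)
        ≡⟨ ℚL.sum-cong (allPartitions n) (λ ρ → rearrange (∣μ∣ ρ) (sgnℚ ρ) N (ζ ρ π) (ζ ρ τ)) ⟩
      -- With τ read as a word, `ζ ρ τ` is the coefficient `p ρ τ`, so the check of the candidate
      -- becomes the expansion of e_π at the word τ.
      sumℚ (λ ρ → N * ((∣μ∣ ρ * (sgnℚ ρ * ζ ρ π)) * p ρ τ)) (allPartitions n) ≡⟨ ℚL.sum-* N _ (allPartitions n) ⟩
      N * sumℚ (λ ρ → (∣μ∣ ρ * (sgnℚ ρ * ζ ρ π)) * p ρ τ) (allPartitions n) ≡⟨ cong (N *_) (e-expansion π τ) ⟨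
      N * e π τ ∎)
    where
    rearrange : ∀ a s N b c → a * (s * N * b) * c ≡ N * ((a * (s * b)) * c)
    rearrange = solve 5 (λ a s N b c → a :* (s :* N :* b) :* c := N :* ((a :* (s :* b)) :* c)) refl

  -- One sign of ρ comes from expanding e_σ and another from ⟨e_π, p_ρ⟩. Their product is 1, and
  -- what remains is the unsigned sum below π ∧ σ.
  e-e : ∀ π σ → B (e π) (e σ) ≡ N * ℕ→ℚ (fact (⟦ π ⟧ ⋀ ⟦ σ ⟧))
  e-e π σ = begin
    B (e π) (e σ) ≡⟨ ext (e π) (e π) _ _ (λ _ → refl) (e-expansion σ) ⟩
    B (e π) (λ w → sumℚ (λ ρ → (∣μ∣ ρ * (sgnℚ ρ * ζ ρ σ)) * p ρ w) (allPartitions n))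
      ≡⟨ sumʳ (λ ρ → ∣μ∣ ρ * (sgnℚ ρ * ζ ρ σ)) p p-invariant (e-invariant π) (allPartitions n) ⟩
    sumℚ (λ ρ → (∣μ∣ ρ * (sgnℚ ρ * ζ ρ σ)) * B (e π) (p ρ)) (allPartitions n)
      ≡⟨ ℚL.sum-cong (allPartitions n) (λ ρ → begin
          (∣μ∣ ρ * (sgnℚ ρ * ζ ρ σ)) * B (e π) (p ρ)
            ≡⟨ cong ((∣μ∣ ρ * (sgnℚ ρ * ζ ρ σ)) *_) (e-p π ρ) ⟩
          (∣μ∣ ρ * (sgnℚ ρ * ζ ρ σ)) * (sgnℚ ρ * N * ζ ρ π)
            ≡⟨ rearrange (∣μ∣ ρ) (sgnℚ ρ) N (ζ ρ σ) (ζ ρ π) ⟩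
          (sgnℚ ρ * sgnℚ ρ) * (N * (∣μ∣ ρ * (ζ ρ π * ζ ρ σ)))
            ≡⟨ cong₂ (λ s z → s * (N * (∣μ∣ ρ * z))) (sgnℚ-square ρ) (sym (δ-⋀ ⟦ ρ ⟧ ⟦ π ⟧ ⟦ σ ⟧)) ⟩
          1ℚ * (N * (∣μ∣ ρ * δ (⟦ ρ ⟧ ≤ᵇ (⟦ π ⟧ ⋀ ⟦ σ ⟧)))) ≡⟨ ℚ.*-identityˡ _ ⟩
          N * (∣μ∣ ρ * δ (⟦ ρ ⟧ ≤ᵇ (⟦ π ⟧ ⋀ ⟦ σ ⟧))) ∎) ⟩
    sumℚ (λ ρ → N * (∣μ∣ ρ * δ (⟦ ρ ⟧ ≤ᵇ (⟦ π ⟧ ⋀ ⟦ σ ⟧)))) (allPartitions n) ≡⟨ ℚL.sum-* N _ (allPartitions n) ⟩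
    N * sumℚ (λ ρ → ∣μ∣ ρ * δ (⟦ ρ ⟧ ≤ᵇ (⟦ π ⟧ ⋀ ⟦ σ ⟧))) (allPartitions n)
      ≡⟨ cong (N *_) (∑∣μ∣ (⋀-equiv (⟦⟧-equiv π) (⟦⟧-equiv σ))) ⟩
    N * ℕ→ℚ (fact (⟦ π ⟧ ⋀ ⟦ σ ⟧)) ∎
    where
    rearrange : ∀ a s N b c → a * (s * b) * (s * N * c) ≡ (s * s) * (N * (a * (c * b)))
    rearrange = solve 5 (λ a s N b c → a :* (s :* b) :* (s :* N :* c) := (s :* s) :* (N :* (a :* (c :* b)))) refl

  e-m : ∀ π σ → B (e π) (m σ) ≡ sgnℚ σ * N * ℕ→ℚ (lamFact σ π) * ζ σ π
  e-m π σ = begin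
    B (e π) (m σ) ≡⟨ form-m (e-invariant π) σ ⟩
    sumℚ (λ τ → μℚ σ τ * B (e π) (p τ)) (allPartitions n)
      ≡⟨ ℚL.sum-cong (allPartitions n) (λ τ → trans (cong (μℚ σ τ *_) (e-p π τ)) (rearrange (μℚ σ τ) (sgnℚ τ) N (ζ τ π))) ⟩
    sumℚ (λ τ → N * (μℚ σ τ * (sgnℚ τ * ζ τ π))) (allPartitions n) ≡⟨ ℚL.sum-* N _ (allPartitions n) ⟩
    N * sumℚ (λ τ → μℚ σ τ * (sgnℚ τ * ζ τ π)) (allPartitions n) ≡⟨ cong (N *_) (∑μℚ-sgn σ π) ⟩
    N * (sgnℚ σ * (ζ σ π * ℕ→ℚ (lamFact σ π))) ≡⟨ rearrange′ N (sgnℚ σ) (ζ σ π) (ℕ→ℚ (lamFact σ π)) ⟩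
    sgnℚ σ * N * ℕ→ℚ (lamFact σ π) * ζ σ π ∎
    where
    rearrange : ∀ a s N b → a * (s * N * b) ≡ N * (a * (s * b))
    rearrange = solve 4 (λ a s N b → a :* (s :* N :* b) := N :* (a :* (s :* b))) refl
    rearrange′ : ∀ N s z l → N * (s * (z * l)) ≡ s * N * l * z
    rearrange′ = solve 4 (λ N s z l → N :* (s :* (z :* l)) := s :* N :* l :* z) refl

  h-h : ∀ π σ → B (h π) (h σ) ≡ N * ℕ→ℚ (fact (⟦ π ⟧ ⋀ ⟦ σ ⟧))
  h-h π σ = trans (form-h (h-invariant π) σ)
    (cong (λ k → N * ℕ→ℚ k) (fact-cong λ i j → ∧-comm (⟦ σ ⟧ i j) (⟦ π ⟧ i j)))

  h-p : ∀ π σ → B (h π) (p σ) ≡ N * ζ σ π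
  h-p π = form-p (h-invariant π) (λ σ τ q → cong (λ b → N * δ b) (≤ᵇ-cong q λ _ _ → refl)) λ τ → begin
    sumℚ (λ ρ → (∣μ∣ ρ * (N * ζ ρ π)) * ζ ρ τ) (allPartitions n)
      ≡⟨ ℚL.sum-cong (allPartitions n) (λ ρ → rearrange (∣μ∣ ρ) N (ζ ρ π) (ζ ρ τ)) ⟩
    sumℚ (λ ρ → N * ((∣μ∣ ρ * ζ ρ π) * p ρ τ)) (allPartitions n) ≡⟨ ℚL.sum-* N _ (allPartitions n) ⟩
    N * sumℚ (λ ρ → (∣μ∣ ρ * ζ ρ π) * p ρ τ) (allPartitions n) ≡⟨ cong (N *_) (h-expansion π τ) ⟨
    N * h π τ ∎
    where
    rearrange : ∀ a N b c → a * (N * b) * c ≡ N * (a * b * c)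
    rearrange = solve 4 (λ a N b c → a :* (N :* b) :* c := N :* (a :* b :* c)) refl

  -- The form is not assumed symmetric, so this is not the normalisation `mh` read backwards; it
  -- follows from `h-p` by Möbius inversion.
  h-m : ∀ π σ → B (h π) (m σ) ≡ N * δ (⟦ π ⟧ ≐ᵇ ⟦ σ ⟧)
  h-m π σ = begin
    B (h π) (m σ) ≡⟨ form-m (h-invariant π) σ ⟩
    sumℚ (λ τ → μℚ σ τ * B (h π) (p τ)) (allPartitions n)
      ≡⟨ ℚL.sum-cong (allPartitions n) (λ τ → trans (cong (μℚ σ τ *_) (h-p π τ)) (left-comm (μℚ σ τ) N (ζ τ π))) ⟩
    sumℚ (λ τ → N * (μℚ σ τ * ζ τ π)) (allPartitions n) ≡⟨ ℚL.sum-* N _ (allPartitions n) ⟩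
    N * sumℚ (λ τ → μℚ σ τ * ζ τ π) (allPartitions n) ≡⟨ cong (N *_) (∑μℚ σ (⟦⟧-equiv π)) ⟩
    N * δ (⟦ σ ⟧ ≐ᵇ ⟦ π ⟧) ≡⟨ cong (λ b → N * δ b) (≐ᵇ-sym ⟦ σ ⟧ ⟦ π ⟧) ⟩
    N * δ (⟦ π ⟧ ≐ᵇ ⟦ σ ⟧) ∎

  -- In the check of the candidate only ρ = π survives. The denominator is there to cancel the
  -- coefficient |μ|(π) with which p_π enters the h's.
  p-p : ∀ π σ → B (p π) (p σ) ≡ N * (δ (⟦ π ⟧ ≐ᵇ ⟦ σ ⟧) ÷ℕ absMu0 π)
  p-p π = form-p (p-invariant π)
    (λ σ τ q → cong (λ b → N * (δ b ÷ℕ absMu0 π)) (≐ᵇ-cong {R = ⟦ π ⟧} (λ _ _ → refl) q))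
    λ τ → ℚL.sum-partition π
      (λ ρ q → begin
        (∣μ∣ ρ * (N * (δ (⟦ π ⟧ ≐ᵇ ⟦ ρ ⟧) ÷ℕ absMu0 π))) * ζ ρ τ
          ≡⟨ cong₂ _*_ (cong₂ (λ c b → c * (N * (δ b ÷ℕ absMu0 π))) (∣μ∣-cong q) (≐ᵇ-intro (≗₂-sym q)))
                       (cong δ (≤ᵇ-cong q λ _ _ → refl)) ⟩
        (∣μ∣ π * (N * 1/∣μ∣ π)) * ζ π τ ≡⟨ cong (_* ζ π τ) (left-comm (∣μ∣ π) N (1/∣μ∣ π)) ⟩
        (N * (∣μ∣ π * 1/∣μ∣ π)) * ζ π τ ≡⟨ cong (λ z → N * z * ζ π τ) (∣μ∣-inverse π) ⟩
        N * 1ℚ * ζ π τ ≡⟨ cong (_* ζ π τ) (ℚ.*-identityʳ N) ⟩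
        N * p π τ ∎)
      (λ ρ q → begin
        (∣μ∣ ρ * (N * (δ (⟦ π ⟧ ≐ᵇ ⟦ ρ ⟧) ÷ℕ absMu0 π))) * ζ ρ τ
          ≡⟨ cong (λ z → (∣μ∣ ρ * (N * z)) * ζ ρ τ) (trans (÷ℕ-reciprocal _ (absMu0 π))
              (cong (λ b → δ b * 1/∣μ∣ π) (trans (≐ᵇ-sym ⟦ π ⟧ ⟦ ρ ⟧) q))) ⟩
        (∣μ∣ ρ * (N * (0ℚ * 1/∣μ∣ π))) * ζ ρ τ ≡⟨ vanish (∣μ∣ ρ) N (1/∣μ∣ π) (ζ ρ τ) ⟩
        0ℚ ∎)
    where
    vanish : ∀ a b c d → (a * (b * (0ℚ * c))) * d ≡ 0ℚ
    vanish = solve 4 (λ a b c d → (a :* (b :* (con 0ℚ :* c))) :* d := con 0ℚ) refl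

  μℚ-support : ∀ (σ τ : SetPartition n) → (⟦ σ ⟧ ≤ᵇ ⟦ τ ⟧) ≡ false → μℚ σ τ ≡ 0ℚ
  μℚ-support σ τ q = cong ℤ→ℚ (μ-support σ τ q)

  μℚ-ζ : ∀ (σ τ : SetPartition n) → μℚ σ τ * ζ σ τ ≡ μℚ σ τ
  μℚ-ζ σ τ = go (⟦ σ ⟧ ≤ᵇ ⟦ τ ⟧) (μℚ-support σ τ)
    where
    go : ∀ b {x} → (b ≡ false → x ≡ 0ℚ) → x * δ b ≡ x
    go true  {x} q = ℚ.*-identityʳ x
    go false {x} q = trans (ℚ.*-zeroʳ x) (sym (q refl))

  p-m : ∀ π σ → B (p π) (m σ) ≡ N * ((μℚ σ π * ζ σ π) ÷ℕ absMu0 π)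
  p-m π σ = begin
    B (p π) (m σ) ≡⟨ form-m (p-invariant π) σ ⟩
    sumℚ (λ τ → μℚ σ τ * B (p π) (p τ)) (allPartitions n)
      ≡⟨ ℚL.sum-cong (allPartitions n) (λ τ → begin
          μℚ σ τ * B (p π) (p τ) ≡⟨ cong (μℚ σ τ *_) (p-p π τ) ⟩
          μℚ σ τ * (N * (δ (⟦ π ⟧ ≐ᵇ ⟦ τ ⟧) ÷ℕ absMu0 π))
            ≡⟨ cong (λ z → μℚ σ τ * (N * z)) (÷ℕ-reciprocal _ (absMu0 π)) ⟩
          μℚ σ τ * (N * (δ (⟦ π ⟧ ≐ᵇ ⟦ τ ⟧) * 1/∣μ∣ π))
            ≡⟨ rearrange (μℚ σ τ) N (δ (⟦ π ⟧ ≐ᵇ ⟦ τ ⟧)) (1/∣μ∣ π) ⟩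
          (N * 1/∣μ∣ π) * (μℚ σ τ * δ (⟦ π ⟧ ≐ᵇ ⟦ τ ⟧))
            ≡⟨ cong (λ b → (N * 1/∣μ∣ π) * (μℚ σ τ * δ b)) (≐ᵇ-sym ⟦ π ⟧ ⟦ τ ⟧) ⟩
          (N * 1/∣μ∣ π) * (μℚ σ τ * δ (⟦ τ ⟧ ≐ᵇ ⟦ π ⟧)) ∎) ⟩
    sumℚ (λ τ → (N * 1/∣μ∣ π) * (μℚ σ τ * δ (⟦ τ ⟧ ≐ᵇ ⟦ π ⟧))) (allPartitions n) ≡⟨ ℚL.sum-* (N * 1/∣μ∣ π) _ (allPartitions n) ⟩
    (N * 1/∣μ∣ π) * sumℚ (λ τ → μℚ σ τ * δ (⟦ τ ⟧ ≐ᵇ ⟦ π ⟧)) (allPartitions n)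
      ≡⟨ cong ((N * 1/∣μ∣ π) *_) (sum-δ (μℚ σ) (λ τ υ q → cong ℤ→ℚ (μ-cong σ τ υ q)) π) ⟩
    (N * 1/∣μ∣ π) * μℚ σ π ≡⟨ rearrange′ N (1/∣μ∣ π) (μℚ σ π) ⟩
    N * (μℚ σ π * 1/∣μ∣ π) ≡⟨ cong (λ z → N * (z * 1/∣μ∣ π)) (μℚ-ζ σ π) ⟨
    N * ((μℚ σ π * ζ σ π) * 1/∣μ∣ π) ≡⟨ cong (N *_) (÷ℕ-reciprocal _ (absMu0 π)) ⟨
    N * ((μℚ σ π * ζ σ π) ÷ℕ absMu0 π) ∎
    where
    rearrange : ∀ a N b c → a * (N * (b * c)) ≡ (N * c) * (a * b)
    rearrange = solve 4 (λ a N b c → a :* (N :* (b :* c)) := (N :* c) :* (a :* b)) refl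
    rearrange′ : ∀ N c a → (N * c) * a ≡ N * (a * c)
    rearrange′ = solve 3 (λ N c a → (N :* c) :* a := N :* (a :* c)) refl

  -- The mirror image of `p-m`, derived on its own because symmetry is not given; it feeds `m-m`,
  -- where the right argument is expanded in the p's. The reciprocal cancels |μ|(ρ) and leaves the
  -- expansion of m_π.
  m-p : ∀ π σ → B (m π) (p σ) ≡ N * (μℚ π σ * 1/∣μ∣ σ)
  m-p π = form-p (m-invariant π)
    (λ σ τ q → cong₂ (λ x k → N * (ℤ→ℚ x * (1ℚ ÷ℕ ℤ.∣ k ∣))) (μ-cong π σ τ q) (μ-cong 𝟘̂ σ τ q))
    λ τ → begin
      sumℚ (λ ρ → (∣μ∣ ρ * (N * (μℚ π ρ * 1/∣μ∣ ρ))) * ζ ρ τ) (allPartitions n)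
        ≡⟨ ℚL.sum-cong (allPartitions n) (λ ρ → begin
            (∣μ∣ ρ * (N * (μℚ π ρ * 1/∣μ∣ ρ))) * ζ ρ τ ≡⟨ rearrange (∣μ∣ ρ) N (μℚ π ρ) (1/∣μ∣ ρ) (ζ ρ τ) ⟩
            (∣μ∣ ρ * 1/∣μ∣ ρ) * (N * (μℚ π ρ * ζ ρ τ)) ≡⟨ cong (_* (N * (μℚ π ρ * ζ ρ τ))) (∣μ∣-inverse ρ) ⟩
            1ℚ * (N * (μℚ π ρ * ζ ρ τ)) ≡⟨ ℚ.*-identityˡ _ ⟩
            N * (μℚ π ρ * ζ ρ τ) ∎) ⟩
      sumℚ (λ ρ → N * (μℚ π ρ * ζ ρ τ)) (allPartitions n) ≡⟨ ℚL.sum-* N _ (allPartitions n) ⟩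
      N * sumℚ (λ ρ → μℚ π ρ * p ρ τ) (allPartitions n) ≡⟨ cong (N *_) (m-in-p π τ) ⟨
      N * m π τ ∎
    where
    rearrange : ∀ c N a d z → c * (N * (a * d)) * z ≡ (c * d) * (N * (a * z))
    rearrange = solve 5 (λ c N a d z → c :* (N :* (a :* d)) :* z := (c :* d) :* (N :* (a :* z))) refl

  m-m : ∀ π σ → B (m π) (m σ) ≡ N *
    sumℚ (λ τ → if ⟦ π ⟧ ⋁ ⟦ σ ⟧ ≤ᵇ ⟦ τ ⟧ then (μℚ π τ * μℚ σ τ) ÷ℕ absMu0 τ else 0ℚ) (allPartitions n)
  m-m π σ = begin
    B (m π) (m σ) ≡⟨ form-m (m-invariant π) σ ⟩
    sumℚ (λ τ → μℚ σ τ * B (m π) (p τ)) (allPartitions n)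
      ≡⟨ ℚL.sum-cong (allPartitions n) (λ τ → begin
          μℚ σ τ * B (m π) (p τ) ≡⟨ cong (μℚ σ τ *_) (m-p π τ) ⟩
          μℚ σ τ * (N * (μℚ π τ * 1/∣μ∣ τ)) ≡⟨ rearrange (μℚ σ τ) N (μℚ π τ) (1/∣μ∣ τ) ⟩
          N * ((μℚ π τ * μℚ σ τ) * 1/∣μ∣ τ) ≡⟨ cong (N *_) (÷ℕ-reciprocal _ (absMu0 τ)) ⟨
          N * ((μℚ π τ * μℚ σ τ) ÷ℕ absMu0 τ)
            -- The product μ(π,τ)μ(σ,τ) vanishes unless τ is above both π and σ, so the condition τ
            -- ≥ π ∨ σ can be inserted without changing the sum.
            ≡⟨ cong (N *_) (restrict (absMu0 τ) (⟦ π ⟧ ≤ᵇ ⟦ τ ⟧) (⟦ σ ⟧ ≤ᵇ ⟦ τ ⟧) (μℚ-support π τ) (μℚ-support σ τ)) ⟩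
          N * (if (⟦ π ⟧ ≤ᵇ ⟦ τ ⟧) ∧ (⟦ σ ⟧ ≤ᵇ ⟦ τ ⟧) then (μℚ π τ * μℚ σ τ) ÷ℕ absMu0 τ else 0ℚ)
            ≡⟨ cong (λ b → N * (if b then (μℚ π τ * μℚ σ τ) ÷ℕ absMu0 τ else 0ℚ)) (⋁-least ⟦ π ⟧ ⟦ σ ⟧ ⟦ τ ⟧ (⟦⟧-equiv τ)) ⟨
          N * (if ⟦ π ⟧ ⋁ ⟦ σ ⟧ ≤ᵇ ⟦ τ ⟧ then (μℚ π τ * μℚ σ τ) ÷ℕ absMu0 τ else 0ℚ) ∎) ⟩
    sumℚ (λ τ → N * (if ⟦ π ⟧ ⋁ ⟦ σ ⟧ ≤ᵇ ⟦ τ ⟧ then (μℚ π τ * μℚ σ τ) ÷ℕ absMu0 τ else 0ℚ)) (allPartitions n)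
      ≡⟨ ℚL.sum-* N (λ τ → if ⟦ π ⟧ ⋁ ⟦ σ ⟧ ≤ᵇ ⟦ τ ⟧ then (μℚ π τ * μℚ σ τ) ÷ℕ absMu0 τ else 0ℚ) (allPartitions n) ⟩
    N * sumℚ (λ τ → if ⟦ π ⟧ ⋁ ⟦ σ ⟧ ≤ᵇ ⟦ τ ⟧ then (μℚ π τ * μℚ σ τ) ÷ℕ absMu0 τ else 0ℚ) (allPartitions n) ∎
    where
    rearrange : ∀ a N b c → a * (N * (b * c)) ≡ N * ((b * a) * c)
    rearrange = solve 4 (λ a N b c → a :* (N :* (b :* c)) := N :* ((b :* a) :* c)) refl
    0÷ : ∀ d → 0ℚ ÷ℕ d ≡ 0ℚ
    0÷ d = trans (÷ℕ-reciprocal 0ℚ d) (ℚ.*-zeroˡ (1ℚ ÷ℕ d))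
    restrict : ∀ d a b {x y} → (a ≡ false → x ≡ 0ℚ) → (b ≡ false → y ≡ 0ℚ) →
               (x * y) ÷ℕ d ≡ (if a ∧ b then (x * y) ÷ℕ d else 0ℚ)
    restrict d true  true  q r = refl
    restrict d true  false {x} {y} q r = trans (cong (λ z → (x * z) ÷ℕ d) (r refl)) (trans (cong (_÷ℕ d) (ℚ.*-zeroʳ x)) (0÷ d))
    restrict d false b     {x} {y} q r = trans (cong (λ z → (z * y) ÷ℕ d) (q refl)) (trans (cong (_÷ℕ d) (ℚ.*-zeroˡ y)) (0÷ d))

theorem4p4 : (n : ℕ) (B : Series n → Series n → ℚ) → IsMHForm n B →
    (π σ : SetPartition n) →
    (B (e π) (e σ) ≡ ℕ→ℚ (n !) * ℕ→ℚ (fact (⟦ π ⟧ ⋀ ⟦ σ ⟧)))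
    × (B (e π) (h σ) ≡ ℕ→ℚ (n !) * δ (isBottom (⟦ π ⟧ ⋀ ⟦ σ ⟧)))
    × (B (e π) (p σ) ≡ ℤ→ℚ (sgn σ) * ℕ→ℚ (n !) * ζ σ π)
    × (B (e π) (m σ) ≡ ℤ→ℚ (sgn σ) * ℕ→ℚ (n !) * ℕ→ℚ (lamFact σ π) * ζ σ π)
    × (B (h π) (h σ) ≡ ℕ→ℚ (n !) * ℕ→ℚ (fact (⟦ π ⟧ ⋀ ⟦ σ ⟧)))
    × (B (h π) (p σ) ≡ ℕ→ℚ (n !) * ζ σ π)
    × (B (h π) (m σ) ≡ ℕ→ℚ (n !) * δ (⟦ π ⟧ ≐ᵇ ⟦ σ ⟧))
    × (B (p π) (p σ) ≡ ℕ→ℚ (n !) * (δ (⟦ π ⟧ ≐ᵇ ⟦ σ ⟧) ÷ℕ absMu0 π))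
    × (B (p π) (m σ) ≡ ℕ→ℚ (n !) * ((ℤ→ℚ (μ σ π) * ζ σ π) ÷ℕ absMu0 π))
    × (B (m π) (m σ) ≡ ℕ→ℚ (n !) *
    sumℚ (λ τ → if ⟦ π ⟧ ⋁ ⟦ σ ⟧ ≤ᵇ ⟦ τ ⟧
    then (ℤ→ℚ (μ π τ) * ℤ→ℚ (μ σ τ)) ÷ℕ absMu0 τ
    else 0ℚ)
    (allPartitions n))
theorem4p4 n B form π σ =
  e-e π σ , form-h (e-invariant π) σ , e-p π σ , e-m π σ , h-h π σ , h-p π σ , h-m π σ ,
  p-p π σ , p-m π σ , m-m π σ
  where open MHForm form
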